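{- Let $W$ be one of the Coxeter groups $B_n$ with set of Coxeter generators $S$, let $p$ be a prime, and let $K\in E$, $L\in F$. If $p\neq 2$ then $d_{KL}=1$ if and only if $c_K$ and $c_L$ have conjugate $p$-regular parts (conjugate in $W$). If $p=2$ then $F=\{S\}$ and $d_{KS}=1$ for all $K\in E$.
   Context: For $J\subseteq S$, $W_J=\langle J\rangle$ and $c_J$ is a Coxeter element of $W_J$ (the product of the elements of $J$ in some order). $E$ is a set of representatives of the $W$-conjugacy classes of subsets of $S$. For $J,K\subseteq S$, $\beta_{JK}$ is the number of fixed points of $W_K$ on the coset space $W/W_J$; $M^c(W)=(\beta_{JK})_{J,K\in E}$ is the parabolic table of marks. For a prime $p$, $F\subseteq E$ is the set of $J\in E$ whose row of $M^c(W)$ is non-zero modulo $p$ (equivalently, $p\nmid [N_W(W_J):W_J]$). For $K\in E$, $L\in F$, $d_{KL}=1$ if columns $K$ and $L$ of $M^c(W)$ are equal modulo $p$, and $d_{KL}=0$ otherwise; $D=(d_{KL})$ is the decomposition matrix of the descent algebra $\Sigma_W$ modulo $p$. The $p$-regular part of $w\in W$ is the element $w'$ in the unique factorization $w=w'w''=w''w'$ with $w'$ of order prime to $p$ and $w''$ of $p$-power order. $B_n$ is realized as the group of all permutations of $\{\pm1,\dots,\pm n\}$ commuting with $i\mapsto -i$, with $S=\{s_0,\dots,s_{n-1}\}$, $s_0=(-1,1)$ and $s_i=(i,i+1)(-i,-i-1)$ for $1\le i\le n-1$. -}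

module Defs where

open import Algebra.Bundles using (Group)
import Algebra.Definitions.RawMonoid as RawMonoidDefs
import Algebra.Properties.Group as GroupProperties
open import Data.Bool.Base using (if_then_else_)
open import Data.Fin.Base as Fin using (Fin; zero; suc; inject₁; toℕ)
import Data.Fin.Permutation.Components as PC
import Data.Fin.Properties as Fin
open import Data.Fin.Subset using (Subset; _∈_)
open import Data.Fin.Subset.Properties using (_∈?_)
open import Data.List.Base as List
  using (List; []; _∷_; _++_; length; lookup; foldr; take; drop; concatMap; deduplicate; cartesianProductWith)
import Data.List.Membership.Propositional as Listₚ
import Data.List.Membership.Propositional.Properties as Listₚ
open import Data.List.Properties using (length-++; length-take; length-drop; take++drop≡id)
open import Data.List.Relation.Unary.All as All using (All; []; _∷_)
import Data.List.Relation.Unary.All.Properties as All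
open import Data.List.Relation.Unary.AllPairs using ([]; _∷_)
open import Data.List.Relation.Unary.Any as Any using (Any; here; there; index)
import Data.List.Relation.Unary.Any.Properties as Any
import Data.List.Relation.Unary.Enumerates.Setoid as Enumerates
import Data.List.Relation.Unary.Enumerates.Setoid.Properties as Enumerates
import Data.List.Relation.Unary.Unique.DecSetoid.Properties as DecUnique
open import Data.List.Relation.Unary.Unique.Propositional using (Unique)
import Data.List.Relation.Unary.Unique.Setoid as SetoidUnique
open import Data.Nat.Base as ℕ using (ℕ; zero; suc; _≤_; _<_; _≥_; s≤s; ∣_-_∣)
open import Data.Nat.Coprimality using (Coprime)
open import Data.Nat.Divisibility using (_∣_; _∤_; _∣?_)
open import Data.Nat.Induction using (<-rec)
import Data.Nat.Properties as ℕ
open import Data.Product.Base using (Σ; ∃; ∃₂; _×_; _,_; proj₁; proj₂)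
import Data.Product.Properties as Product
open import Data.Sign.Base using (Sign; opposite) renaming (+ to pos; - to neg)
import Data.Sign.Properties as Sign
open import Data.Sum.Base using (_⊎_; inj₁; inj₂)
open import Data.Vec.Base as Vec using (Vec; []; _∷_; tabulate)
import Data.Vec.Properties as Vec
open import Function.Base using (_∘_)
open import Function.Bundles using (Inverse; _⇔_; _↔_; mk↔ₛ′)
import Function.Construct.Composition as Compose
import Function.Construct.Identity as Identity
import Function.Construct.Symmetry as Symmetry
open import Level using (0ℓ)
open import Relation.Binary.Bundles using (Setoid; DecSetoid)
import Relation.Binary.Construct.On as On
open import Relation.Binary.Definitions using (Decidable)
open import Relation.Binary.PropositionalEquality as ≡ using (_≡_; refl)
import Relation.Binary.Reasoning.Setoid as SetoidReasoning
open import Relation.Nullary using (Dec; yes; no; does; contradiction)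
open import Relation.Nullary.Decidable using (_×-dec_; _⊎-dec_; _→-dec_; map′; dec-true; dec-false)

HasCardinality : Setoid 0ℓ 0ℓ → ℕ → Set
HasCardinality A m = Inverse A (≡.setoid (Fin m))

enumeration⇒cardinality : (A : DecSetoid 0ℓ 0ℓ) →
  ∃ (Enumerates.IsEnumeration (DecSetoid.setoid A)) →
  ∃ (HasCardinality (DecSetoid.setoid A))
enumeration⇒cardinality A (xs , complete) = length ys , record
  { to        = position
  ; from      = lookup ys
  ; to-cong   = λ {x} {y} x≈y → lookup-injective ys unique _ _
      (trans (sym (at x)) (trans x≈y (at y)))
  ; from-cong = λ { refl → A.refl }
  ; inverse   = (λ {i} {x} x≈ → lookup-injective ys unique _ _ (trans (sym (at x)) x≈))
              , (λ { {x} refl → sym (at x) })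
  }
  where
  module A = DecSetoid A
  open A using (_≈_; _≟_; sym; trans)
  ys = deduplicate _≟_ xs

  complete′ : Enumerates.IsEnumeration A.setoid ys
  complete′ = Enumerates.deduplicate⁺ A complete

  unique : SetoidUnique.Unique A.setoid ys
  unique = DecUnique.deduplicate-! A xs

  position : A.Carrier → Fin (length ys)
  position x = index (complete′ x)

  at : ∀ x → x ≈ lookup ys (position x)
  at x = Any.lookup-index (complete′ x)

  lookup-injective : ∀ zs → SetoidUnique.Unique A.setoid zs →
    ∀ i j → lookup zs i ≈ lookup zs j → i ≡ j
  lookup-injective (z ∷ zs) (z∉ ∷ u) zero zero _ = refl
  lookup-injective (z ∷ zs) (z∉ ∷ u) zero (suc j) eq =
    contradiction eq (All.lookup z∉ (Listₚ.∈-lookup j))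
  lookup-injective (z ∷ zs) (z∉ ∷ u) (suc i) zero eq =
    contradiction (sym eq) (All.lookup z∉ (Listₚ.∈-lookup i))
  lookup-injective (z ∷ zs) (z∉ ∷ u) (suc i) (suc j) eq =
    ≡.cong suc (lookup-injective zs u i j eq)

-- The Coxeter-theoretic notions, for a finite group with a family s of
-- involutions indexed by Fin n.  A subset J ⊆ S is a Subset n of the indices.
module Parabolic
  (W : Group 0ℓ 0ℓ)
  (_≟_ : Decidable (Group._≈_ W))
  (elements : List (Group.Carrier W))
  (complete : Enumerates.IsEnumeration (Group.setoid W) elements)
  (n : ℕ) (s : Fin n → Group.Carrier W)
  (involutive : ∀ i → Group._≈_ W (Group._∙_ W (s i) (s i)) (Group.ε W))
  where

  open Group W hiding (refl)
  open RawMonoidDefs rawMonoid using () renaming (_×_ to power)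
  private module G = GroupProperties W

  -- W_J, the subgroup generated by J.
  data ⟨_⟩ (J : Subset n) : Carrier → Set where
    gen  : ∀ {i} → i ∈ J → ⟨ J ⟩ (s i)
    unit : ⟨ J ⟩ ε
    mult : ∀ {x y} → ⟨ J ⟩ x → ⟨ J ⟩ y → ⟨ J ⟩ (x ∙ y)
    inv  : ∀ {x} → ⟨ J ⟩ x → ⟨ J ⟩ (x ⁻¹)
    resp : ∀ {x y} → x ≈ y → ⟨ J ⟩ x → ⟨ J ⟩ y

  product : List (Fin n) → Carrier
  product = foldr (λ i x → s i ∙ x) ε

  IsCoxeterElement : Subset n → Carrier → Set
  IsCoxeterElement J c = ∃ λ is →
    Unique is × (∀ i → (i Listₚ.∈ is) ⇔ (i ∈ J)) × c ≈ product is

  Conjugate : Carrier → Carrier → Set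
  Conjugate x y = ∃ λ w → w ∙ x ∙ w ⁻¹ ≈ y

  -- w J w⁻¹ = K for some w.
  ConjugateSubsets : Subset n → Subset n → Set
  ConjugateSubsets J K = ∃ λ w →
    (∀ i → i ∈ J → ∃ λ k → k ∈ K × w ∙ s i ∙ w ⁻¹ ≈ s k) ×
    (∀ k → k ∈ K → ∃ λ i → i ∈ J × w ∙ s i ∙ w ⁻¹ ≈ s k)

  record IsRepresentatives (E : List (Subset n)) : Set where
    field
      representative : ∀ J → ∃ λ K → K Listₚ.∈ E × ConjugateSubsets J K
      irredundant    : ∀ {J K} → J Listₚ.∈ E → K Listₚ.∈ E → ConjugateSubsets J K → J ≡ K

  HasOrder : Carrier → ℕ → Set
  HasOrder x m = m ≥ 1 × power m x ≈ ε × (∀ k → k ≥ 1 → power k x ≈ ε → m ≤ k)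

  IsPRegularPart : ℕ → Carrier → Carrier → Set
  IsPRegularPart p w w′ = ∃ λ w″ →
    w ≈ w′ ∙ w″ × w ≈ w″ ∙ w′ ×
    (∃ λ m → HasOrder w′ m × Coprime m p) ×
    (∃ λ k → HasOrder w″ (p ℕ.^ k))

  ConjugatePRegularParts : ℕ → Carrier → Carrier → Set
  ConjugatePRegularParts p x y = ∃₂ λ x′ y′ →
    IsPRegularPart p x x′ × IsPRegularPart p y y′ × Conjugate x′ y′

  -- The coset space W/W_J: x and y represent the same coset iff x⁻¹y ∈ W_J.
  Cosets : Subset n → Setoid 0ℓ 0ℓ
  Cosets J = record
    { Carrier       = Carrier
    ; _≈_           = λ x y → ⟨ J ⟩ (x ⁻¹ ∙ y)
    ; isEquivalence = record
      { refl  = λ {x} → resp (sym (inverseˡ x)) unit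
      ; sym   = λ {x} {y} h → resp
          (trans (G.⁻¹-anti-homo-∙ (x ⁻¹) y) (∙-congˡ (G.⁻¹-involutive x))) (inv h)
      ; trans = λ {x} {y} {z} h k → resp (cancel x y z) (mult h k)
      }
    }
    where
    cancel : ∀ x y z → (x ⁻¹ ∙ y) ∙ (y ⁻¹ ∙ z) ≈ x ⁻¹ ∙ z
    cancel x y z = begin
      (x ⁻¹ ∙ y) ∙ (y ⁻¹ ∙ z) ≈⟨ assoc _ _ _ ⟩
      x ⁻¹ ∙ (y ∙ (y ⁻¹ ∙ z)) ≈⟨ ∙-congˡ (assoc _ _ _) ⟨
      x ⁻¹ ∙ ((y ∙ y ⁻¹) ∙ z) ≈⟨ ∙-congˡ (∙-congʳ (inverseʳ y)) ⟩
      x ⁻¹ ∙ (ε ∙ z)          ≈⟨ ∙-congˡ (identityˡ z) ⟩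
      x ⁻¹ ∙ z                ∎
      where open SetoidReasoning setoid

  IsFixed : (J K : Subset n) → Carrier → Set
  IsFixed J K x = ∀ u → ⟨ K ⟩ u → Setoid._≈_ (Cosets J) (u ∙ x) x

  FixedPoints : (J K : Subset n) → Setoid 0ℓ 0ℓ
  FixedPoints J K = On.setoid {B = Σ Carrier (IsFixed J K)} (Cosets J) proj₁

  -- Membership in W_J is decidable: by the pigeonhole principle every element
  -- of W_J is a product of at most |W| generators.
  private
    N = length elements

    Word : Subset n → Carrier → List (Fin n) → Set
    Word J x is = All (_∈ J) is × x ≈ product is

    product-++ : ∀ is js → product (is ++ js) ≈ product is ∙ product js
    product-++ []       js = sym (identityˡ _)
    product-++ (i ∷ is) js = trans (∙-congˡ (product-++ is js)) (sym (assoc _ _ _))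

    inverse-word : ∀ {J} is → All (_∈ J) is → ∃ (Word J (product is ⁻¹))
    inverse-word []       []       = [] , [] , G.ε⁻¹≈ε
    inverse-word (i ∷ is) (h ∷ hs) with js , hjs , eq ← inverse-word is hs =
      js ++ i ∷ [] , All.++⁺ hjs (h ∷ []) , (begin
        (s i ∙ product is) ⁻¹          ≈⟨ G.⁻¹-anti-homo-∙ _ _ ⟩
        product is ⁻¹ ∙ s i ⁻¹         ≈⟨ ∙-cong eq (sym (G.inverseˡ-unique _ _ (involutive i))) ⟩
        product js ∙ s i               ≈⟨ ∙-congˡ (identityʳ _) ⟨
        product js ∙ product (i ∷ [])  ≈⟨ product-++ js (i ∷ []) ⟨
        product (js ++ i ∷ [])         ∎)
      where open SetoidReasoning setoid

    word : ∀ {J x} → ⟨ J ⟩ x → ∃ (Word J x)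
    word (gen {i} i∈J) = i ∷ [] , i∈J ∷ [] , sym (identityʳ _)
    word unit          = [] , [] , Group.refl W
    word (mult h k) with is , his , eq ← word h | js , hjs , eq′ ← word k =
      is ++ js , All.++⁺ his hjs , trans (∙-cong eq eq′) (sym (product-++ is js))
    word (inv h) with is , his , eq ← word h with js , hjs , eq′ ← inverse-word is his =
      js , hjs , trans (⁻¹-cong eq) eq′
    word (resp x≈y h) with is , his , eq ← word h = is , his , trans (sym x≈y) eq

    code : Carrier → Fin N
    code x = index (complete x)

    code-injective : ∀ x y → code x ≡ code y → x ≈ y
    code-injective x y eq = trans (Any.lookup-index (complete x))
      (trans (reflexive (≡.cong (lookup elements) eq)) (sym (Any.lookup-index (complete y))))

    shorten : ∀ {J x} is → N < length is → Word J x is →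
      ∃ λ js → length js < length is × Word J x js
    shorten {J} {x} is N<l (his , eq)
      with a , b , a<b , same ← Fin.pigeonhole N<l (λ k → code (product (drop (toℕ k) is))) =
      take (toℕ a) is ++ drop (toℕ b) is
      , shorter
      , All.++⁺ (All.take⁺ (toℕ a) his) (All.drop⁺ (toℕ b) his)
      , (begin
        x                                                ≈⟨ eq ⟩
        product is                                       ≡⟨ ≡.cong product (take++drop≡id (toℕ a) is) ⟨
        product (take (toℕ a) is ++ drop (toℕ a) is)     ≈⟨ product-++ (take (toℕ a) is) _ ⟩
        product (take (toℕ a) is) ∙ product (drop (toℕ a) is)
          ≈⟨ ∙-congˡ (code-injective _ _ same) ⟩
        product (take (toℕ a) is) ∙ product (drop (toℕ b) is)
          ≈⟨ product-++ (take (toℕ a) is) _ ⟨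
        product (take (toℕ a) is ++ drop (toℕ b) is)     ∎)
      where
      open SetoidReasoning setoid
      l = length is
      shorter : length (take (toℕ a) is ++ drop (toℕ b) is) < l
      shorter = ℕ.≤-<-trans (ℕ.≤-reflexive (≡.trans (length-++ (take (toℕ a) is))
          (≡.cong₂ ℕ._+_ (length-take (toℕ a) is) (length-drop (toℕ b) is))))
        (ℕ.≤-<-trans (ℕ.+-monoˡ-≤ (l ℕ.∸ toℕ b) (ℕ.m⊓n≤m (toℕ a) l))
        (ℕ.<-≤-trans (ℕ.+-monoˡ-< (l ℕ.∸ toℕ b) a<b)
        (ℕ.≤-reflexive (ℕ.m+[n∸m]≡n (ℕ.<⇒≤ (Fin.toℕ<n b))))))

    short-word : ∀ {J x} → ⟨ J ⟩ x → ∃ λ is → length is ≤ N × Word J x is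
    short-word {J} {x} h = <-rec P step _ _ refl (proj₂ (word h))
      where
      P : ℕ → Set
      P l = ∀ is → length is ≡ l → Word J x is → ∃ λ js → length js ≤ N × Word J x js
      step : ∀ l → (∀ {m} → m < l → P m) → P l
      step l rec is refl w with length is ℕ.≤? N
      ... | yes l≤N = is , l≤N , w
      ... | no  l≰N with js , js< , w′ ← shorten is (ℕ.≰⇒> l≰N) w = rec js< js refl w′

    Reach : Subset n → ℕ → Carrier → Set
    Reach J zero    x = x ≈ ε
    Reach J (suc k) x = x ≈ ε ⊎ ∃ λ i → i ∈ J × Reach J k (s i ∙ x)

    reach? : ∀ J k x → Dec (Reach J k x)
    reach? J zero    x = x ≟ ε
    reach? J (suc k) x = (x ≟ ε) ⊎-dec Fin.any? (λ i → (i ∈? J) ×-dec reach? J k (s i ∙ x))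

    absorb : ∀ i x → s i ∙ (s i ∙ x) ≈ x
    absorb i x = trans (sym (assoc _ _ _)) (trans (∙-congʳ (involutive i)) (identityˡ x))

    reach-sound : ∀ J k x → Reach J k x → ⟨ J ⟩ x
    reach-sound J zero    x x≈ε                  = resp (sym x≈ε) unit
    reach-sound J (suc k) x (inj₁ x≈ε)           = resp (sym x≈ε) unit
    reach-sound J (suc k) x (inj₂ (i , i∈J , h)) =
      resp (absorb i x) (mult (gen i∈J) (reach-sound J k _ h))

    reach-complete : ∀ J k x is → length is ≤ k → Word J x is → Reach J k x
    reach-complete J zero    x []       l≤k       (h , eq)       = eq
    reach-complete J (suc k) x []       l≤k       (h , eq)       = inj₁ eq
    reach-complete J (suc k) x (i ∷ is) (s≤s l≤k) (i∈J ∷ h , eq) =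
      inj₂ (i , i∈J , reach-complete J k _ is l≤k (h , trans (∙-congˡ eq) (absorb i _)))

  ⟨_⟩? : ∀ J x → Dec (⟨ J ⟩ x)
  ⟨ J ⟩? x = map′ (reach-sound J N x)
    (λ h → let is , l≤N , w = short-word h in reach-complete J N x is l≤N w)
    (reach? J N x)

  private
    coset? : ∀ J x y → Dec (⟨ J ⟩ (x ⁻¹ ∙ y))
    coset? J x y = ⟨ J ⟩? (x ⁻¹ ∙ y)

    coset-resp : ∀ {J x x′ y y′} → x ≈ x′ → y ≈ y′ → ⟨ J ⟩ (x ⁻¹ ∙ y) → ⟨ J ⟩ (x′ ⁻¹ ∙ y′)
    coset-resp x≈ y≈ = resp (∙-cong (⁻¹-cong x≈) y≈)

    isFixed-resp : ∀ {J K x y} → x ≈ y → IsFixed J K x → IsFixed J K y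
    isFixed-resp x≈y h u u∈K = coset-resp (∙-congˡ x≈y) x≈y (h u u∈K)

    isFixed? : ∀ J K x → Dec (IsFixed J K x)
    isFixed? J K x = map′ to from
      (All.all? (λ u → ⟨ K ⟩? u →-dec coset? J (u ∙ x) x) elements)
      where
      to : All (λ u → ⟨ K ⟩ u → ⟨ J ⟩ ((u ∙ x) ⁻¹ ∙ x)) elements → IsFixed J K x
      to h u u∈K with v , v∈ , u≈v ← Listₚ.find (complete u) =
        coset-resp (∙-congʳ (sym u≈v)) (Group.refl W) (All.lookup h v∈ (resp u≈v u∈K))
      from : IsFixed J K x → All (λ u → ⟨ K ⟩ u → ⟨ J ⟩ ((u ∙ x) ⁻¹ ∙ x)) elements
      from h = All.tabulate (λ {u} _ → h u)

    fixedPoint : ∀ J K → Carrier → List (Σ Carrier (IsFixed J K))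
    fixedPoint J K x with isFixed? J K x
    ... | yes h = (x , h) ∷ []
    ... | no  _ = []

    fixedPoints-enumeration : ∀ J K →
      Enumerates.IsEnumeration (FixedPoints J K) (concatMap (fixedPoint J K) elements)
    fixedPoints-enumeration J K (x , h) =
      Any.concatMap⁺ (fixedPoint J K) (Any.map found (complete x))
      where
      found : ∀ {y} → x ≈ y → Any (λ z → ⟨ J ⟩ (x ⁻¹ ∙ proj₁ z)) (fixedPoint J K y)
      found {y} x≈y with isFixed? J K y
      ... | yes _ = here (resp (trans (sym (inverseˡ x)) (∙-congˡ x≈y)) unit)
      ... | no ¬h = contradiction (isFixed-resp x≈y h) ¬h

  fixedPoints-finite : ∀ J K → ∃ (HasCardinality (FixedPoints J K))
  fixedPoints-finite J K = enumeration⇒cardinality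
    (record { isDecEquivalence = record
      { isEquivalence = Setoid.isEquivalence (FixedPoints J K)
      ; _≟_           = λ x y → coset? J (proj₁ x) (proj₁ y) } })
    (_ , fixedPoints-enumeration J K)

  -- The entry β_JK of the parabolic table of marks.
  β : (J K : Subset n) → ℕ
  β J K = proj₁ (fixedPoints-finite J K)

  -- J ∈ F: the row of J, whose columns are indexed by E, is non-zero modulo p.
  F : ℕ → List (Subset n) → Subset n → Set
  F p E J = J Listₚ.∈ E × Any (λ K → p ∤ β J K) E

  ColumnsCongruent : ℕ → List (Subset n) → (K L : Subset n) → Set
  ColumnsCongruent p E K L = All (λ J → p ∣ ∣ β J K - β J L ∣) E

  columnsCongruent? : ∀ p E K L → Dec (ColumnsCongruent p E K L)
  columnsCongruent? p E K L = All.all? (λ J → p ∣? ∣ β J K - β J L ∣) E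

  d : ℕ → List (Subset n) → (K L : Subset n) → ℕ
  d p E K L = if does (columnsCongruent? p E K L) then 1 else 0

-- (σ , i) stands for σ(i+1), so that Point n is {±1,…,±n}.
Point : ℕ → Set
Point n = Sign × Fin n

negate : ∀ {n} → Point n → Point n
negate (σ , i) = opposite σ , i

record SignedPermutation (n : ℕ) : Set where
  field
    perm : Point n ↔ Point n
  open Inverse perm public using (to; from; strictlyInverseˡ; strictlyInverseʳ)
  field
    commutes : ∀ x → to (negate x) ≡ negate (to x)

open SignedPermutation

private
  negate-involutive : ∀ {n} (x : Point n) → negate (negate x) ≡ x
  negate-involutive (σ , i) = ≡.cong (_, i) (Sign.opposite-selfInverse refl)

  from-commutes : ∀ {n} (w : SignedPermutation n) x → from w (negate x) ≡ negate (from w x)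
  from-commutes w x = begin
    from w (negate x)                  ≡⟨ ≡.cong (from w ∘ negate) (strictlyInverseˡ w x) ⟨
    from w (negate (to w (from w x)))  ≡⟨ ≡.cong (from w) (commutes w (from w x)) ⟨
    from w (to w (negate (from w x)))  ≡⟨ strictlyInverseʳ w _ ⟩
    negate (from w x)                  ∎
    where open ≡.≡-Reasoning

-- Products are composed from right to left: (v ∙ w)(x) = v(w(x)).
signedPermutationGroup : ℕ → Group 0ℓ 0ℓ
signedPermutationGroup n = record
  { Carrier = SignedPermutation n
  ; _≈_     = λ v w → ∀ x → to v x ≡ to w x
  ; _∙_     = λ v w → record
      { perm     = Compose.inverse (perm w) (perm v)
      ; commutes = λ x → ≡.trans (≡.cong (to v) (commutes w x)) (commutes v (to w x)) }
  ; ε       = record { perm = Identity.↔-id _ ; commutes = λ _ → refl }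
  ; _⁻¹     = λ w → record { perm = Symmetry.↔-sym (perm w) ; commutes = from-commutes w }
  ; isGroup = record
    { isMonoid = record
      { isSemigroup = record
        { isMagma = record
          { isEquivalence = record
            { refl  = λ _ → refl
            ; sym   = λ h x → ≡.sym (h x)
            ; trans = λ h k x → ≡.trans (h x) (k x) }
          ; ∙-cong = λ {v} {v′} {w} {w′} h k x → ≡.trans (≡.cong (to v) (k x)) (h (to w′ x)) }
        ; assoc = λ _ _ _ _ → refl }
      ; identity = (λ _ _ → refl) , (λ _ _ → refl) }
    ; inverse = (λ w → strictlyInverseʳ w) , (λ w → strictlyInverseˡ w)
    ; ⁻¹-cong = λ {v} {w} h x → begin
        from v x                    ≡⟨ ≡.cong (from v) (strictlyInverseˡ w x) ⟨
        from v (to w (from w x))    ≡⟨ ≡.cong (from v) (h (from w x)) ⟨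
        from v (to v (from w x))    ≡⟨ strictlyInverseʳ v _ ⟩
        from w x                    ∎ } }
  where open ≡.≡-Reasoning

-- s₀ = (-1,1) and sᵢ = (i,i+1)(-i,-i-1) for i ≥ 1.
reflect : ∀ {n} → Fin n → Point n → Point n
reflect zero    (σ , zero)  = opposite σ , zero
reflect zero    (σ , suc k) = σ , suc k
reflect (suc j) (σ , k)     = σ , PC.transpose (inject₁ j) (suc j) k

private
  transpose-comm : ∀ {n} (i j k : Fin n) → PC.transpose i j k ≡ PC.transpose j i k
  transpose-comm i j k with k Fin.≟ i
  transpose-comm i j k | yes k≡i with k Fin.≟ j
  ... | yes k≡j = ≡.trans (≡.sym k≡j) k≡i
  ... | no  _ rewrite dec-true (k Fin.≟ i) k≡i = refl
  transpose-comm i j k | no  k≢i with k Fin.≟ j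
  ... | yes _ = refl
  ... | no  _ rewrite dec-false (k Fin.≟ i) k≢i = refl

  reflect-involutive : ∀ {n} (i : Fin n) x → reflect i (reflect i x) ≡ x
  reflect-involutive zero    (σ , zero)  = negate-involutive (σ , zero)
  reflect-involutive zero    (σ , suc k) = refl
  reflect-involutive (suc j) (σ , k)     = ≡.cong (σ ,_)
    (≡.trans (≡.cong (PC.transpose _ _) (transpose-comm (inject₁ j) (suc j) k))
             (PC.transpose-inverse (inject₁ j) (suc j)))

  reflect-commutes : ∀ {n} (i : Fin n) x → reflect i (negate x) ≡ negate (reflect i x)
  reflect-commutes zero    (σ , zero)  = refl
  reflect-commutes zero    (σ , suc k) = refl
  reflect-commutes (suc j) (σ , k)     = refl

generator : ∀ {n} → Fin n → SignedPermutation n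
generator i = record
  { perm     = mk↔ₛ′ (reflect i) (reflect i) (reflect-involutive i) (reflect-involutive i)
  ; commutes = reflect-commutes i }

module B (n : ℕ) where
  private
    W = signedPermutationGroup n
    open Group W using (_≈_; setoid)

    _≟ₚ_ : Decidable {A = Point n} _≡_
    _≟ₚ_ = Product.≡-dec Sign._≟_ Fin._≟_

    allPoints? : ∀ {P : Point n → Set} → (∀ x → Dec (P x)) → Dec (∀ x → P x)
    allPoints? P? = map′
      (λ { (f , g) (pos , i) → f i ; (f , g) (neg , i) → g i })
      (λ h → (λ i → h (pos , i)) , (λ i → h (neg , i)))
      (Fin.all? (λ i → P? (pos , i)) ×-dec Fin.all? (λ i → P? (neg , i)))

    signs : List Sign
    signs = pos ∷ neg ∷ []

    ∈-signs : ∀ σ → σ Listₚ.∈ signs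
    ∈-signs pos = here refl
    ∈-signs neg = there (here refl)

    points : List (Point n)
    points = cartesianProductWith _,_ signs (List.allFin n)

    ∈-points : ∀ x → x Listₚ.∈ points
    ∈-points (σ , i) = Listₚ.∈-cartesianProductWith⁺ _,_ (∈-signs σ) (Listₚ.∈-allFin i)

    vectors : ∀ m → List (Vec (Point n) m)
    vectors zero    = [] ∷ []
    vectors (suc m) = cartesianProductWith _∷_ points (vectors m)

    ∈-vectors : ∀ {m} (v : Vec (Point n) m) → v Listₚ.∈ vectors m
    ∈-vectors []      = here refl
    ∈-vectors (x ∷ v) = Listₚ.∈-cartesianProductWith⁺ _∷_ (∈-points x) (∈-vectors v)

    extend : Vec (Point n) n → Point n → Point n
    extend v (pos , i) = Vec.lookup v i
    extend v (neg , i) = negate (Vec.lookup v i)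

    extend-commutes : ∀ v x → extend v (negate x) ≡ negate (extend v x)
    extend-commutes v (pos , i) = refl
    extend-commutes v (neg , i) = ≡.sym (negate-involutive _)

    extend-tabulate : ∀ (f : Point n → Point n) → (∀ x → f (negate x) ≡ negate (f x)) →
      ∀ x → extend (tabulate (λ i → f (pos , i))) x ≡ f x
    extend-tabulate f h (pos , i) = Vec.lookup∘tabulate _ i
    extend-tabulate f h (neg , i) = ≡.trans (≡.cong negate (Vec.lookup∘tabulate _ i)) (≡.sym (h (pos , i)))

    inverses? : ∀ v v′ → Dec ((∀ x → extend v (extend v′ x) ≡ x) × (∀ x → extend v′ (extend v x) ≡ x))
    inverses? v v′ = allPoints? (λ x → extend v (extend v′ x) ≟ₚ x)
               ×-dec allPoints? (λ x → extend v′ (extend v x) ≟ₚ x)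

    build : Vec (Point n) n × Vec (Point n) n → List (SignedPermutation n)
    build (v , v′) with inverses? v v′
    ... | yes (l , r) = record
      { perm = mk↔ₛ′ (extend v) (extend v′) l r ; commutes = extend-commutes v } ∷ []
    ... | no _        = []

    build-complete : ∀ w v v′ → (∀ x → extend v x ≡ to w x) → (∀ x → extend v′ x ≡ from w x) →
      Any (w ≈_) (build (v , v′))
    build-complete w v v′ h h′ with inverses? v v′
    ... | yes _ = here (λ x → ≡.sym (h x))
    ... | no ¬i = contradiction
      ( (λ x → ≡.trans (h _) (≡.trans (≡.cong (to w) (h′ x)) (strictlyInverseˡ w x)))
      , (λ x → ≡.trans (h′ _) (≡.trans (≡.cong (from w) (h x)) (strictlyInverseʳ w x)))) ¬i

    elements : List (SignedPermutation n)
    elements = concatMap build (cartesianProductWith _,_ (vectors n) (vectors n))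

    complete : Enumerates.IsEnumeration setoid elements
    complete w = Any.concatMap⁺ build (Any.map (λ { refl → found })
      (Listₚ.∈-cartesianProductWith⁺ _,_ (∈-vectors v) (∈-vectors v′)))
      where
      v  = tabulate (λ i → to w (pos , i))
      v′ = tabulate (λ i → from w (pos , i))
      found : Any (w ≈_) (build (v , v′))
      found = build-complete w v v′ (extend-tabulate (to w) (commutes w))
        (extend-tabulate (from w) (from-commutes w))

    _≟_ : Decidable _≈_
    v ≟ w = allPoints? (λ x → to v x ≟ₚ to w x)

  open Parabolic W _≟_ elements complete n generator reflect-involutive public

{-# OPTIONS --safe #-}

-- W acts on ℤⁿ, and W_J is the stabilizer of a dominant vector, so W/W_J is a set of
-- vectors.  The simple roots are linearly independent, hence c_K and W_K fix the same
-- vectors, and β_JK is the number of fixed points of c_K on W/W_J.  This number is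
-- congruent modulo p to the number of fixed points of the p-regular part of c_K, as the
-- p-part permutes the latter; so conjugate p-regular parts give congruent columns.
-- Conversely, let J run over the maximal proper subsets of S.  Then W/W_J consists of
-- the {0,±1}-vectors with t non-zero entries, for a fixed t, and the number of those
-- fixed by w is the coefficient of xᵗ in ∏ (1 + 2xᵏ), the product running over the lengths
-- k of the positive cycles of w.  Modulo p this product determines the lengths up to
-- merging p cycles of length k into one of length pk, which does not change the p-regular
-- part.  The only negative cycle of c_K passes through ±1, and its length is what the
-- positive cycles leave over.
-- For p = 2, multiplication by −1 is a free involution on W/W_J unless J = S.
module Submission where

open import Defs
open import Algebra.Bundles using (Group; AbelianGroup)
import Algebra.Definitions.RawMonoid as RawMonoidDefinitions
import Algebra.Properties.Group as GroupProperties
open import Data.Bool.Base using (if_then_else_)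
import Data.Bool.Properties as Bool
open import Data.Fin.Base using (Fin; zero; suc; toℕ; inject₁)
open import Data.Fin.Induction using (<-weakInduction; >-weakInduction; <-weakInduction-startingFrom)
open import Data.Fin.Permutation using (↔⇒≡)
import Data.Fin.Permutation.Components as PC
import Data.Fin.Properties as Fin
open import Data.Fin.Subset as Subset using (Subset; ⊤; ⊥; inside; outside)
open import Data.Fin.Subset.Properties using (_∈?_; ∉⊥; ⊆-antisym; ⊆⊤)
import Data.Integer.Base as ℤ
open import Data.Integer.Base using (ℤ; +_; -[1+_])
import Data.Integer.Properties as ℤ
import Data.Integer.Tactic.RingSolver as ℤSolver
open import Data.List.Base
  using (List; []; _∷_; _++_; map; concat; applyUpTo; allFin; length; filter; lookup; replicate; tabulate)
open import Data.List.Membership.Propositional using (_∈_; _∉_)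
import Data.List.Membership.Propositional as List
import Data.List.Membership.Propositional.Properties as List
open import Data.List.Membership.Propositional.Properties.WithK using (unique∧set⇒bag)
open import Data.List.Properties
  using (length-++; length-map; length-replicate; length-tabulate; ++-assoc; map-++; map-cong; map-id; map-∘; map-tabulate
        ; tabulate-cong; ∷-injectiveˡ; ∷-injectiveʳ)
open import Data.List.Relation.Binary.BagAndSetEquality using (∼bag⇒↭)
open import Data.List.Relation.Binary.Disjoint.Propositional using (Disjoint)
open import Data.List.Relation.Binary.Permutation.Propositional as ↭ using (_↭_; ↭-sym; ↭-trans; ↭-prep; ↭-refl)
import Data.List.Relation.Binary.Permutation.Propositional.Properties as ↭
import Data.List.Relation.Binary.Permutation.Setoid.Properties as Permutation
open import Data.List.Relation.Binary.Pointwise.Base using (Pointwise; []; _∷_)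
open import Data.List.Relation.Unary.All as All using (All; []; _∷_)
import Data.List.Relation.Unary.All.Properties as All
open import Data.List.Relation.Unary.AllPairs as AllPairs using (AllPairs; []; _∷_)
import Data.List.Relation.Unary.AllPairs.Properties as AllPairs
open import Data.List.Relation.Unary.Any as Any using (Any; here; there; index)
import Data.List.Relation.Unary.Any.Properties as Any
open import Data.List.Relation.Unary.Unique.Propositional using (Unique)
import Data.List.Relation.Unary.Unique.Propositional.Properties as Unique
open import Data.Nat.Base
open import Data.Nat.Combinatorics using (_C_; nCk+nC[k+1]≡[n+1]C[k+1]; nCn≡1; k>n⇒nCk≡0)
open import Data.Nat.Coprimality as Coprimality using (Coprime; coprime-divisor; coprime-Bézout)
open import Data.Nat.Divisibility
open import Data.Nat.DivMod using (_/_; _%_; m≡m%n+[m/n]*n; m%n<n)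
open import Data.Nat.GCD using (module Bézout)
open import Data.Nat.Induction using (<-rec)
open import Data.Nat.ListAction using (sum)
open import Data.Nat.ListAction.Properties using (sum-↭; sum-++)
open import Data.Nat.Primality
  using (Prime; prime[2]; euclidsLemma; prime⇒nonTrivial; prime⇒nonZero; prime⇒irreducible)
open import Data.Nat.Properties
open import Data.Nat.Tactic.RingSolver using (solve-∀)
open import Data.Product.Base using (Σ; ∃; ∃₂; _×_; _,_; proj₁; proj₂)
import Data.Product.Properties as Product
open import Data.Sign.Base as Sign using (Sign; opposite) renaming (+ to pos; - to neg)
import Data.Sign.Properties as Sign
open import Data.Sum.Base using (_⊎_; inj₁; inj₂)
open import Data.Vec.Base using ([]; _∷_; here; there)
import Data.Vec.Properties as Vec
open import Function.Base using (_∘_; id)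
open import Function.Bundles using (Inverse; Equivalence; mk⇔; _⇔_; mk↔ₛ′)
import Function.Construct.Composition as Compose
import Function.Construct.Identity as Identity
import Function.Construct.Symmetry as Symmetry
open import Level using (0ℓ)
open import Relation.Binary.Bundles using (Setoid)
import Relation.Binary.Construct.On as On
open import Relation.Binary.PropositionalEquality hiding (resp; J)
open import Relation.Nullary using (Dec; yes; no; does; ¬_; contradiction)
open import Relation.Nullary.Decidable using (map′; decidable-stable)
open SignedPermutation

-- Power series modulo p

-- The comparison of two products modulo p is made for sums of g(k) over the lengths k, where g(pk)
-- = p g(k): such sums do not notice that p cycles of length k have been merged into one of length
-- pk. The weight g(k) = k yields the total length of the positive cycles. The weight that is k when
-- k has prime-to-p part b, and 0 otherwise, yields the multiplicity of b among lengths prime to p.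
-- The hypothesis p ≠ 2 serves to pass from p ∣ 2a to p ∣ a, the 2 being that of 1 + 2xᵏ. The
-- obstacle is the negative cycles of the regular part, on which every fixed vector vanishes. Being
-- a power of c_K, the regular part has all its negative cycles inside the one of c_K, and they
-- share one length, the prime-to-p part of the length of that cycle. Their total length is seen in
-- the regular part, but the common length only in c_K; so the products of c_K and c_L are compared
-- as well as those of the regular parts.

infix 4 _≡_[mod_]

-- Multiples of p are added on both sides, so that congruence of natural numbers involves neither
-- subtraction nor a case distinction on which of a and b is larger.
record _≡_[mod_] (a b p : ℕ) : Set where
  constructor mod-by
  field
    x y      : ℕ
    balanced : a + x * p ≡ b + y * p

mod-reflexive : ∀ {p a b} → a ≡ b → a ≡ b [mod p ]
mod-reflexive refl = mod-by 0 0 refl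

mod-sym : ∀ {p a b} → a ≡ b [mod p ] → b ≡ a [mod p ]
mod-sym (mod-by x y eq) = mod-by y x (sym eq)

mod-trans : ∀ {p a b c} → a ≡ b [mod p ] → b ≡ c [mod p ] → a ≡ c [mod p ]
mod-trans {p} {a} {b} {c} (mod-by x y e) (mod-by z w f) = mod-by (x + z) (w + y) (begin
  a + (x + z) * p      ≡⟨ regroup a x z p ⟩
  (a + x * p) + z * p  ≡⟨ cong (_+ z * p) e ⟩
  (b + y * p) + z * p  ≡⟨ exchange b y z p ⟩
  (b + z * p) + y * p  ≡⟨ cong (_+ y * p) f ⟩
  (c + w * p) + y * p  ≡⟨ regroup c w y p ⟨
  c + (w + y) * p      ∎)
  where
  open ≡-Reasoning
  regroup : ∀ a x z p → a + (x + z) * p ≡ (a + x * p) + z * p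
  regroup = solve-∀
  exchange : ∀ b y z p → (b + y * p) + z * p ≡ (b + z * p) + y * p
  exchange = solve-∀

mod-+ : ∀ {p a b c d} → a ≡ b [mod p ] → c ≡ d [mod p ] → a + c ≡ b + d [mod p ]
mod-+ {p} {a} {b} {c} {d} (mod-by x y e) (mod-by z w f) = mod-by (x + z) (y + w)
  (trans (regroup a c x z p) (trans (cong₂ _+_ e f) (sym (regroup b d y w p))))
  where
  regroup : ∀ a c x z p → (a + c) + (x + z) * p ≡ (a + x * p) + (c + z * p)
  regroup = solve-∀

mod-*ˡ : ∀ {p a b} c → a ≡ b [mod p ] → c * a ≡ c * b [mod p ]
mod-*ˡ {p} {a} {b} c (mod-by x y e) = mod-by (c * x) (c * y)
  (trans (factor c a x p) (trans (cong (c *_) e) (sym (factor c b y p))))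
  where
  factor : ∀ c a x p → c * a + c * x * p ≡ c * (a + x * p)
  factor = solve-∀

mod-+-cancelʳ : ∀ {p a b c d} → c ≡ d [mod p ] → a + c ≡ b + d [mod p ] → a ≡ b [mod p ]
mod-+-cancelʳ {p} {a} {b} {c} {d} (mod-by x y e) (mod-by z w f) = mod-by (y + z) (x + w)
  (+-cancelʳ-≡ (c + x * p) _ _ (begin
    a + (y + z) * p + (c + x * p)          ≡⟨ regroup a y z c x p ⟩
    (a + c + z * p) + (x + y) * p          ≡⟨ cong (_+ (x + y) * p) f ⟩
    (b + d + w * p) + (x + y) * p          ≡⟨ regroup′ b x w d y p ⟨
    b + (x + w) * p + (d + y * p)          ≡⟨ cong (λ z → b + (x + w) * p + z) e ⟨
    b + (x + w) * p + (c + x * p)          ∎))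
  where
  open ≡-Reasoning
  regroup : ∀ a y z c x p → a + (y + z) * p + (c + x * p) ≡ (a + c + z * p) + (x + y) * p
  regroup = solve-∀
  regroup′ : ∀ b x w d y p → b + (x + w) * p + (d + y * p) ≡ (b + d + w * p) + (x + y) * p
  regroup′ = solve-∀

mod-0⇒∣ : ∀ {p a} → a ≡ 0 [mod p ] → p ∣ a
mod-0⇒∣ {p} {a} (mod-by x y e) = ∣m+n∣n⇒∣m (subst (p ∣_) (sym e) (n∣m*n y)) (n∣m*n x)
  where
  ∣m+n∣n⇒∣m : ∀ {p m n} → p ∣ m + n → p ∣ n → p ∣ m
  ∣m+n∣n⇒∣m {p} {m} {n} h k = ∣m+n∣m⇒∣n (subst (p ∣_) (+-comm m n) h) k

∣⇒mod-0 : ∀ {p a} → p ∣ a → a ≡ 0 [mod p ]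
∣⇒mod-0 {p} (divides q refl) = mod-by 0 q (+-identityʳ (q * p))

∣∣-∣⇒mod : ∀ {p} a b → p ∣ ∣ a - b ∣ → a ≡ b [mod p ]
∣∣-∣⇒mod {p} a b (divides q eq) with ≤-total a b
... | inj₁ a≤b = mod-by q 0 (trans (cong (λ z → a + z) (trans (sym eq) (m≤n⇒∣m-n∣≡n∸m a≤b)))
                    (trans (m+[n∸m]≡n a≤b) (sym (+-identityʳ b))))
... | inj₂ b≤a = mod-by 0 q (trans (+-identityʳ a) (sym (trans
    (cong (λ z → b + z) (trans (sym eq) (m≤n⇒∣n-m∣≡n∸m b≤a))) (m+[n∸m]≡n b≤a))))

mod⇒∣∣-∣ : ∀ {p} a b → a ≡ b [mod p ] → p ∣ ∣ a - b ∣
mod⇒∣∣-∣ {p} a b h with ≤-total a b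
... | inj₁ a≤b = subst (p ∣_) (sym (m≤n⇒∣m-n∣≡n∸m a≤b)) (mod-0⇒∣ (mod-sym
    (mod-+-cancelʳ (mod-reflexive {a = a} refl)
      (mod-trans h (mod-reflexive (sym (m∸n+n≡m a≤b)))))))
... | inj₂ b≤a = subst (p ∣_) (sym (m≤n⇒∣n-m∣≡n∸m b≤a)) (mod-0⇒∣
    (mod-+-cancelʳ (mod-reflexive {a = b} refl)
      (mod-trans (mod-reflexive (m∸n+n≡m b≤a)) h)))

-- The absorption identity. With p = `suc m` it shows that p divides k times the binomial
-- coefficient, so Euclid's lemma applies.
[1+k]*C : ∀ m k → suc k * (suc m C suc k) ≡ suc m * (m C k)
[1+k]*C zero    zero    = refl
[1+k]*C zero    (suc k) = *-zeroʳ (suc (suc k))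
[1+k]*C (suc m) zero    = begin
  1 * (suc (suc m) C 1)             ≡⟨ *-identityˡ _ ⟩
  suc (suc m) C 1                   ≡⟨ nCk+nC[k+1]≡[n+1]C[k+1] (suc m) 0 ⟨
  1 + (suc m C 1)                   ≡⟨ cong (λ z → 1 + z) (trans (sym (*-identityˡ _)) ([1+k]*C m 0)) ⟩
  1 + suc m * 1                     ∎
  where open ≡-Reasoning
[1+k]*C (suc m) (suc k) = begin
  (2 + k) * (suc (suc m) C (2 + k))                      ≡⟨ cong ((2 + k) *_) (nCk+nC[k+1]≡[n+1]C[k+1] (suc m) (suc k)) ⟨
  (2 + k) * (a + b)                                      ≡⟨ expand k a b ⟩
  suc k * a + a + (2 + k) * b                            ≡⟨ cong₂ (λ u v → u + a + v) ([1+k]*C m k) ([1+k]*C m (suc k)) ⟩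
  suc m * (m C k) + a + suc m * (m C suc k)              ≡⟨ collect m (m C k) a (m C suc k) ⟩
  suc m * ((m C k) + (m C suc k)) + a                    ≡⟨ cong (λ u → suc m * u + a) (nCk+nC[k+1]≡[n+1]C[k+1] m k) ⟩
  suc m * a + a                                          ≡⟨ +-comm (suc m * a) a ⟩
  (2 + m) * (suc m C suc k)                              ∎
  where
  open ≡-Reasoning
  a = suc m C suc k
  b = suc m C (2 + k)
  expand : ∀ k a b → (2 + k) * (a + b) ≡ suc k * a + a + (2 + k) * b
  expand = solve-∀
  collect : ∀ m u a v → suc m * u + a + suc m * v ≡ suc m * (u + v) + a
  collect = solve-∀

p-prime∣C : ∀ {p k} → Prime p → 0 < k → k < p → p ∣ p C k
p-prime∣C {suc m} {suc k} p-prime _ k<p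
  with euclidsLemma (suc k) (suc m C suc k) p-prime
         (subst (suc m ∣_) (sym ([1+k]*C m k)) (m∣m*n (m C k)))
... | inj₁ p∣k = contradiction (∣⇒≤ p∣k) (<⇒≱ k<p)
... | inj₂ h   = h

-- The default value is a parameter because two shifts run in parallel: with 0, of coefficients;
-- with `[]`, of the lists that these coefficients count.
shiftBy : ∀ {A : Set} → A → ℕ → (ℕ → A) → ℕ → A
shiftBy d zero    f t       = f t
shiftBy d (suc k) f zero    = d
shiftBy d (suc k) f (suc t) = shiftBy d k f t

-- Multiplication of a power series by tᵏ.
infixr 8 t^_·_

t^_·_ : ℕ → (ℕ → ℕ) → ℕ → ℕ
t^_·_ = shiftBy 0

t^-+ : ∀ i j f t → (t^ i · (t^ j · f)) t ≡ (t^ i + j · f) t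
t^-+ zero    j f t       = refl
t^-+ (suc i) j f zero    = refl
t^-+ (suc i) j f (suc t) = t^-+ i j f t

t^-resp : ∀ {_∼_ : ℕ → ℕ → Set} → 0 ∼ 0 → ∀ k {f g} → (∀ t → f t ∼ g t) → ∀ t → (t^ k · f) t ∼ (t^ k · g) t
t^-resp r zero    h t       = h t
t^-resp r (suc k) h zero    = r
t^-resp {_∼_} r (suc k) h (suc t) = t^-resp {_∼_} r k h t

t^-cong : ∀ k {f g : ℕ → ℕ} → (∀ t → f t ≡ g t) → ∀ t → (t^ k · f) t ≡ (t^ k · g) t
t^-cong = t^-resp {_≡_} refl

t^-linear : ∀ k f g c t → (t^ k · (λ t → f t + c * g t)) t ≡ (t^ k · f) t + c * (t^ k · g) t
t^-linear zero    f g c t       = refl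
t^-linear (suc k) f g c zero    = sym (*-zeroʳ c)
t^-linear (suc k) f g c (suc t) = t^-linear k f g c t

t^-below : ∀ k f t → t < k → (t^ k · f) t ≡ 0
t^-below (suc k) f zero    _         = refl
t^-below (suc k) f (suc t) (s≤s t<k) = t^-below k f t t<k

t^-diagonal : ∀ k f → (t^ k · f) k ≡ f 0
t^-diagonal zero    f = refl
t^-diagonal (suc k) f = t^-diagonal k f

t^-local : ∀ k {f g : ℕ → ℕ} {p} t → (∀ {s} → s < t → f s ≡ g s [mod p ]) →
  (t^ suc k · f) t ≡ (t^ suc k · g) t [mod p ]
t^-local k       zero    h = mod-reflexive refl
t^-local zero    (suc t) h = h (n<1+n t)
t^-local (suc k) (suc t) h = t^-local k t (h ∘ m<n⇒m<1+n)

infixr 8 [1+2t^_]·_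

-- The 1 accounts for the value 0 on a positive cycle of length k, the 2tᵏ for the values 1 and -1.
[1+2t^_]·_ : ℕ → (ℕ → ℕ) → ℕ → ℕ
([1+2t^ k ]· f) t = f t + 2 * (t^ k · f) t

one : ℕ → ℕ
one zero    = 1
one (suc _) = 0

series : List ℕ → ℕ → ℕ
series []       = one
series (k ∷ ks) = [1+2t^ k ]· series ks

series-comm : ∀ i j f t → ([1+2t^ i ]· [1+2t^ j ]· f) t ≡ ([1+2t^ j ]· [1+2t^ i ]· f) t
series-comm i j f t = begin
  a + 2 * b + 2 * (t^ i · [1+2t^ j ]· f) t       ≡⟨ cong (λ z → a + 2 * b + 2 * z) (t^-linear i f (t^ j · f) 2 t) ⟩
  a + 2 * b + 2 * (c + 2 * (t^ i · t^ j · f) t)  ≡⟨ cong (λ z → a + 2 * b + 2 * (c + 2 * z)) swapped ⟩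
  a + 2 * b + 2 * (c + 2 * (t^ j · t^ i · f) t)  ≡⟨ exchange a b c ((t^ j · t^ i · f) t) ⟩
  a + 2 * c + 2 * (b + 2 * (t^ j · t^ i · f) t)  ≡⟨ cong (λ z → a + 2 * c + 2 * z) (t^-linear j f (t^ i · f) 2 t) ⟨
  a + 2 * c + 2 * (t^ j · [1+2t^ i ]· f) t       ∎
  where
  open ≡-Reasoning
  a = f t
  b = (t^ j · f) t
  c = (t^ i · f) t
  swapped : (t^ i · t^ j · f) t ≡ (t^ j · t^ i · f) t
  swapped = trans (t^-+ i j f t) (trans (cong (λ k → (t^ k · f) t) (+-comm i j)) (sym (t^-+ j i f t)))
  exchange : ∀ a b c d → a + 2 * b + 2 * (c + 2 * d) ≡ a + 2 * c + 2 * (b + 2 * d)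
  exchange = solve-∀

series-cong : ∀ k {f g} → (∀ t → f t ≡ g t) → ∀ t → ([1+2t^ k ]· f) t ≡ ([1+2t^ k ]· g) t
series-cong k h t = cong₂ (λ a b → a + 2 * b) (h t) (t^-cong k h t)

series-↭ : ∀ {A B} → A ↭ B → ∀ t → series A t ≡ series B t
series-↭ ↭.refl         t = refl
series-↭ (↭.prep x h)   t = series-cong x (series-↭ h) t
series-↭ (↭.swap {ys = ys} x y h) t =
  trans (series-cong x (series-cong y (series-↭ h)) t) (series-comm x y (series ys) t)
series-↭ (↭.trans h k)  t = trans (series-↭ h t) (series-↭ k t)

-- A positive exponent makes the term 2tᵏf contribute only earlier coefficients of f to a given
-- degree, so the coefficients are recovered one after the other.
series-cancel : ∀ {p} k {f g : ℕ → ℕ} →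
  (∀ t → ([1+2t^ suc k ]· f) t ≡ ([1+2t^ suc k ]· g) t [mod p ]) → ∀ t → f t ≡ g t [mod p ]
series-cancel {p} k {f} {g} h = <-rec (λ t → f t ≡ g t [mod p ])
  (λ t rec → mod-+-cancelʳ (mod-*ˡ 2 (t^-local k t rec)) (h t))

sumTo : ℕ → (ℕ → ℕ) → ℕ
sumTo zero    f = f 0
sumTo (suc m) f = sumTo m f + f (suc m)

sumTo-cong : ∀ m {f g} → (∀ k → f k ≡ g k) → sumTo m f ≡ sumTo m g
sumTo-cong zero    h = h 0
sumTo-cong (suc m) h = cong₂ _+_ (sumTo-cong m h) (h (suc m))

sumTo-+ : ∀ m f g → sumTo m f + sumTo m g ≡ sumTo m (λ k → f k + g k)
sumTo-+ zero    f g = refl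
sumTo-+ (suc m) f g = trans (regroup (sumTo m f) _ (sumTo m g) _) (cong (_+ (f (suc m) + g (suc m))) (sumTo-+ m f g))
  where
  regroup : ∀ a b c d → (a + b) + (c + d) ≡ (a + c) + (b + d)
  regroup = solve-∀

sumTo-*ˡ : ∀ m c f → c * sumTo m f ≡ sumTo m (λ k → c * f k)
sumTo-*ˡ zero    c f = refl
sumTo-*ˡ (suc m) c f = trans (*-distribˡ-+ c (sumTo m f) _) (cong (_+ c * f (suc m)) (sumTo-*ˡ m c f))

sumTo-suc : ∀ m f → sumTo (suc m) f ≡ f 0 + sumTo m (f ∘ suc)
sumTo-suc zero    f = refl
sumTo-suc (suc m) f = trans (cong (_+ f (suc (suc m))) (sumTo-suc m f)) (+-assoc (f 0) _ _)

sumTo-t^ : ∀ m i (F : ℕ → ℕ → ℕ) t →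
  (t^ i · (λ t → sumTo m (λ k → F k t))) t ≡ sumTo m (λ k → (t^ i · F k) t)
sumTo-t^ m zero    F t       = refl
sumTo-t^ m (suc i) F zero    = sym (zeros m)
  where
  zeros : ∀ m → sumTo m (λ _ → 0) ≡ 0
  zeros zero    = refl
  zeros (suc m) = trans (+-identityʳ _) (zeros m)
sumTo-t^ m (suc i) F (suc t) = sumTo-t^ m i F t

-- The binomial theorem for a power of 1 + 2tⁱ. In the induction step `T (suc k)` receives one
-- contribution from the unshifted and one from the shifted copy, and Pascal's rule adds them.
binomial : ∀ m i A t → series (replicate m i ++ A) t ≡
  sumTo m (λ k → (m C k) * (2 ^ k * (t^ k * i · series A) t))
binomial zero    i A t = sym (trans (*-identityˡ _) (*-identityˡ _))
binomial (suc m) i A t = begin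
  series (replicate m i ++ A) t + 2 * (t^ i · series (replicate m i ++ A)) t
    ≡⟨ cong₂ (λ a b → a + 2 * b) (binomial m i A t) (trans (t^-cong i (binomial m i A) t) (sumTo-t^ m i F t)) ⟩
  sumTo m (λ k → F k t) + 2 * sumTo m (λ k → (t^ i · F k) t)
    ≡⟨ cong (λ z → sumTo m (λ k → F k t) + z) (trans (sumTo-*ˡ m 2 _) (sumTo-cong m shifted)) ⟩
  sumTo m (λ k → F k t) + sumTo m (λ k → (m C k) * T (suc k))
    ≡⟨ cong (_+ sumTo m (λ k → (m C k) * T (suc k))) extended ⟩
  (T₀ + sumTo m (λ k → (m C suc k) * T (suc k))) + sumTo m (λ k → (m C k) * T (suc k))
    ≡⟨ +-assoc T₀ _ _ ⟩
  T₀ + (sumTo m (λ k → (m C suc k) * T (suc k)) + sumTo m (λ k → (m C k) * T (suc k)))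
    ≡⟨ cong (λ z → T₀ + z) (trans (sumTo-+ m _ _) (sumTo-cong m pascal)) ⟩
  T₀ + sumTo m (λ k → (suc m C suc k) * T (suc k))
    ≡⟨ sumTo-suc m (λ k → (suc m C k) * T k) ⟨
  sumTo (suc m) (λ k → (suc m C k) * T k)  ∎
  where
  open ≡-Reasoning
  T : ℕ → ℕ
  T k = 2 ^ k * (t^ k * i · series A) t
  T₀ = 1 * T 0
  F : ℕ → ℕ → ℕ
  F k t = (m C k) * (2 ^ k * (t^ k * i · series A) t)
  pull : ∀ i c g t → (t^ i · (λ t → c * g t)) t ≡ c * (t^ i · g) t
  pull zero    c g t       = refl
  pull (suc i) c g zero    = sym (*-zeroʳ c)
  pull (suc i) c g (suc t) = pull i c g t
  shifted : ∀ k → 2 * (t^ i · F k) t ≡ (m C k) * T (suc k)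
  shifted k = begin
    2 * (t^ i · F k) t                                          ≡⟨ cong (2 *_) (trans (pull i (m C k) _ t) (cong ((m C k) *_) (pull i (2 ^ k) _ t))) ⟩
    2 * ((m C k) * (2 ^ k * (t^ i · t^ k * i · series A) t))    ≡⟨ rearrange (m C k) (2 ^ k) _ ⟩
    (m C k) * (2 * 2 ^ k * (t^ i · t^ k * i · series A) t)      ≡⟨ cong (λ z → (m C k) * (2 * 2 ^ k * z)) (t^-+ i (k * i) (series A) t) ⟩
    (m C k) * T (suc k)                                         ∎
    where
    rearrange : ∀ c d z → 2 * (c * (d * z)) ≡ c * (2 * d * z)
    rearrange = solve-∀
  extended : sumTo m (λ k → F k t) ≡ T₀ + sumTo m (λ k → (m C suc k) * T (suc k))
  extended = begin
    sumTo m (λ k → F k t)                               ≡⟨ +-identityʳ _ ⟨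
    sumTo m (λ k → F k t) + 0                           ≡⟨ cong (λ c → sumTo m (λ k → F k t) + c * T (suc m)) (k>n⇒nCk≡0 (n<1+n m)) ⟨
    sumTo (suc m) (λ k → (m C k) * T k)                 ≡⟨ sumTo-suc m (λ k → (m C k) * T k) ⟩
    T₀ + sumTo m (λ k → (m C suc k) * T (suc k))        ∎
  pascal : ∀ k → (m C suc k) * T (suc k) + (m C k) * T (suc k) ≡ (suc m C suc k) * T (suc k)
  pascal k = trans (sym (*-distribʳ-+ (T (suc k)) (m C suc k) (m C k)))
    (cong (_* T (suc k)) (trans (+-comm (m C suc k) _) (nCk+nC[k+1]≡[n+1]C[k+1] m k)))

sumTo-ends : ∀ p m f → (∀ k → 0 < k → k ≤ m → p ∣ f k) → sumTo (suc m) f ≡ f 0 + f (suc m) [mod p ]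
sumTo-ends p zero    f h = mod-reflexive refl
sumTo-ends p (suc m) f h = mod-+
  (mod-trans (sumTo-ends p m f (λ k 0<k k≤m → h k 0<k (m≤n⇒m≤1+n k≤m)))
    (mod-trans (mod-+ (mod-reflexive {a = f 0} refl) (∣⇒mod-0 (h (suc m) z<s ≤-refl)))
      (mod-reflexive (+-identityʳ (f 0)))))
  (mod-reflexive refl)

-- Row p of Pascal's triangle sums to 2ᵖ, and only its two outer entries survive modulo p.
2^p≡2 : ∀ {p} → Prime p → 2 ^ p ≡ 2 [mod p ]
2^p≡2 {suc m} p-prime = mod-trans (mod-reflexive (sym (powerOfTwo (suc m))))
  (mod-trans (sumTo-ends (suc m) m (suc m C_) (λ k 0<k k≤m → p-prime∣C p-prime 0<k (s≤s k≤m)))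
    (mod-reflexive (cong (λ z → 1 + z) (nCn≡1 (suc m)))))
  where
  powerOfTwo : ∀ m → sumTo m (m C_) ≡ 2 ^ m
  powerOfTwo zero    = refl
  powerOfTwo (suc m) = begin
    sumTo (suc m) (suc m C_)                        ≡⟨ sumTo-suc m (suc m C_) ⟩
    1 + sumTo m (λ k → suc m C suc k)               ≡⟨ cong (λ z → 1 + z) (sumTo-cong m (λ k → nCk+nC[k+1]≡[n+1]C[k+1] m k)) ⟨
    1 + sumTo m (λ k → (m C k) + (m C suc k))       ≡⟨ cong (λ z → 1 + z) (sumTo-+ m _ _) ⟨
    1 + (sumTo m (m C_) + sumTo m (λ k → m C suc k)) ≡⟨ regroup (sumTo m (m C_)) _ ⟩
    sumTo m (m C_) + (1 + sumTo m (λ k → m C suc k)) ≡⟨ cong (λ z → sumTo m (m C_) + z) (sumTo-suc m (m C_)) ⟨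
    sumTo m (m C_) + (sumTo m (m C_) + (m C suc m))  ≡⟨ cong₂ (λ a b → a + (a + b)) (powerOfTwo m) (k>n⇒nCk≡0 (n<1+n m)) ⟩
    2 ^ suc m                                        ∎
    where
    open ≡-Reasoning
    regroup : ∀ a b → 1 + (a + b) ≡ a + (1 + b)
    regroup = solve-∀

-- (1 + 2 tⁱ)ᵖ ≡ 1 + 2ᵖ tᵖⁱ and 2ᵖ ≡ 2 modulo p.
series-merge : ∀ {p} → Prime p → ∀ i A t → series (replicate p i ++ A) t ≡ series (p * i ∷ A) t [mod p ]
series-merge {suc m} p-prime i A t =
  mod-trans (mod-reflexive (binomial p i A t))
  (mod-trans (sumTo-ends p m _ (λ k 0<k k≤m → ∣m⇒∣m*n _ (p-prime∣C p-prime 0<k (s≤s k≤m))))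
    (mod-+ (mod-reflexive (trans (*-identityˡ _) (*-identityˡ _)))
      (mod-trans (mod-reflexive (trans (cong (_* (2 ^ p * x)) (nCn≡1 p)) (trans (*-identityˡ _) (*-comm (2 ^ p) x))))
        (mod-trans (mod-*ˡ x (2^p≡2 p-prime)) (mod-reflexive (*-comm x 2))))))
  where
  p = suc m
  x = (t^ p * i · series A) t


series-low : ∀ i A → 0 < i → All (i <_) A → ∀ t → t ≤ i → series A t ≡ one t
series-low i []      0<i []        t t≤i = refl
series-low i (k ∷ A) 0<i (i<k ∷ h) t t≤i = trans
  (cong₂ (λ a b → a + 2 * b) (series-low i A 0<i h t t≤i) (t^-below k (series A) t (≤-<-trans t≤i i<k)))
  (+-identityʳ (one t))

series-0 : ∀ {A} → All (0 <_) A → series A 0 ≡ 1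
series-0 []              = refl
series-0 {suc k ∷ A} (_ ∷ h) = trans (+-identityʳ _) (series-0 h)

-- All other exponents exceed i, so tⁱ arises only by choosing 2tⁱ in exactly one of the a factors.
series-coefficient : ∀ i A → 0 < i → All (i <_) A → ∀ a → series (replicate a i ++ A) i ≡ 2 * a
series-coefficient (suc i) A 0<i h zero    = series-low (suc i) A 0<i h (suc i) ≤-refl
series-coefficient i A 0<i h (suc a) = trans
  (cong₂ (λ x y → x + 2 * y) (series-coefficient i A 0<i h a)
    (trans (t^-diagonal i (series (replicate a i ++ A)))
      (series-0 (All.++⁺ (All.replicate⁺ a 0<i) (All.map (≤-<-trans z≤n) h)))))
  (double a)
  where
  double : ∀ a → 2 * a + 2 * 1 ≡ 2 * suc a
  double = solve-∀

extract : ∀ i A → All (i ≤_) A → ∃₂ λ a B → A ↭ replicate a i ++ B × All (i <_) B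
extract i []      []        = 0 , [] , ↭-refl , []
extract i (k ∷ A) (i≤k ∷ h) with a , B , eq , i<B ← extract i A h | m≤n⇒m<n∨m≡n i≤k
... | inj₂ refl = suc a , B , ↭-prep k eq , i<B
... | inj₁ i<k  = a , k ∷ B , ↭-trans (↭-prep k eq) (↭-sym (↭.shift k (replicate a i) B)) , i<k ∷ i<B

minimum : ∀ k A → ∃ λ i → i ∈ k ∷ A × All (i ≤_) (k ∷ A)
minimum k []      = k , here refl , ≤-refl ∷ []
minimum k (l ∷ A) with i , i∈ , h ← minimum l A | ≤-total k i
... | inj₁ k≤i = k , here refl , ≤-refl ∷ All.map (≤-trans k≤i) h
... | inj₂ i≤k = i , there i∈ , i≤k ∷ h

∈⇒↭ : ∀ {X : Set} {x : X} {xs} → x ∈ xs → ∃ λ ys → xs ↭ x ∷ ys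
∈⇒↭ {x = x} x∈ with ys , zs , refl ← List.∈-∃++ x∈ = ys ++ zs , ↭.shift x ys zs

sum-map-↭ : ∀ {X : Set} (g : X → ℕ) {xs ys} → xs ↭ ys → sum (map g xs) ≡ sum (map g ys)
sum-map-↭ g h = sum-↭ (↭.map⁺ g h)

-- Weights determined by a product modulo p

module _ {p} (p-prime : Prime p) (p≢2 : p ≢ 2) (g : ℕ → ℕ) (g-* : ∀ i → 0 < i → g (p * i) ≡ p * g i) where

  private
    merged : ∀ i A → 0 < i → sum (map g (replicate p i ++ A)) ≡ sum (map g (p * i ∷ A))
    merged i A 0<i = trans (go p) (cong (_+ sum (map g A)) (sym (g-* i 0<i)))
      where
      go : ∀ m → sum (map g (replicate m i ++ A)) ≡ m * g i + sum (map g A)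
      go zero    = refl
      go (suc m) = trans (cong (λ z → g i + z) (go m)) (sym (+-assoc (g i) (m * g i) _))

    p>1 : 1 < p
    p>1 = nonTrivial⇒n>1 p {{prime⇒nonTrivial p-prime}}

    p∤2 : p ∤ 2
    p∤2 p∣2 with m≤n⇒m<n∨m≡n (∣⇒≤ p∣2)
    ... | inj₁ p<2 = <⇒≱ p<2 p>1
    ... | inj₂ p≡2 = p≢2 p≡2

    halve : ∀ a → p ∣ 2 * a → p ∣ a
    halve a h with euclidsLemma 2 a p-prime h
    ... | inj₁ p∣2 = contradiction p∣2 p∤2
    ... | inj₂ p∣a = p∣a

    Claim : List ℕ → List ℕ → Set
    Claim A B = All (0 <_) A → All (0 <_) B →
      (∀ t → series A t ≡ series B t [mod p ]) → sum (map g A) ≡ sum (map g B)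

    flip : ∀ A B → Claim A B → Claim B A
    flip A B c hB hA h = sym (c hA hB (mod-sym ∘ h))

    -- The induction is on the total number of factors: cancelling removes one on each side, merging
    -- trades p ≥ 2 factors for a single one.
    Recursive : ℕ → Set
    Recursive l = ∀ A B → length A + length B < l → Claim A B

    replicate-+ : ∀ m k (i : ℕ) → replicate (m + k) i ≡ replicate m i ++ replicate k i
    replicate-+ zero    k i = refl
    replicate-+ (suc m) k i = cong (i ∷_) (replicate-+ m k i)

    cancel : ∀ l j A B A′ B′ → Recursive l → length A + length B < suc l →
      A ↭ suc j ∷ A′ → B ↭ suc j ∷ B′ → Claim A B
    cancel l j A B A′ B′ rec len A↭ B↭ hA hB h = trans (sum-map-↭ g A↭) (trans
      (cong (λ z → g (suc j) + z) (rec A′ B′ shorter (All.tail (↭.All-resp-↭ A↭ hA)) (All.tail (↭.All-resp-↭ B↭ hB))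
        (series-cancel j (λ t → mod-trans (mod-reflexive (sym (series-↭ A↭ t)))
          (mod-trans (h t) (mod-reflexive (series-↭ B↭ t)))))))
      (sym (sum-map-↭ g B↭)))
      where
      shorter : length A′ + length B′ < l
      shorter = ≤-trans (s≤s (+-monoʳ-≤ (length A′) (n≤1+n _)))
        (≤-pred (subst (_< suc l) (cong₂ _+_ (↭.↭-length A↭) (↭.↭-length B↭)) len))

    -- The coefficients of tⁱ are 2(a+1) on the side of A and 0 on the side of B. As p is odd it
    -- divides a+1, so at least p copies of i are available for merging.
    merge : ∀ l i A B A₀ a → Recursive l → length A + length B < suc l → 0 < i →
      A ↭ replicate (suc a) i ++ A₀ → All (i <_) A₀ → All (i <_) B → Claim A B
    merge l i A B A₀ a rec len 0<i A↭ i<A₀ i<B hA hB h =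
      trans (sum-map-↭ g A↭′) (trans (merged i A′ 0<i)
        (rec (p * i ∷ A′) B shorter
          (*-mono-≤ (<⇒≤ p>1) 0<i ∷ All.++⁻ʳ (replicate p i) (↭.All-resp-↭ A↭′ hA)) hB
          (λ t → mod-trans (mod-sym (series-merge p-prime i A′ t))
            (mod-trans (mod-reflexive (sym (series-↭ A↭′ t))) (h t)))))
      where
      2a≡0 : 2 * suc a ≡ 0 [mod p ]
      2a≡0 = mod-trans (mod-reflexive (sym (trans (series-↭ A↭ i) (series-coefficient i A₀ 0<i i<A₀ (suc a)))))
        (mod-trans (h i) (mod-reflexive (series-coefficient i B 0<i i<B 0)))
      p≤a : p ≤ suc a
      p≤a = ∣⇒≤ (halve (suc a) (mod-0⇒∣ 2a≡0))
      A′ = replicate (suc a ∸ p) i ++ A₀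
      A↭′ : A ↭ replicate p i ++ A′
      A↭′ = ↭-trans A↭ (↭.↭-reflexive (trans
        (cong (_++ A₀) (trans (cong (λ m → replicate m i) (sym (m+[n∸m]≡n p≤a))) (replicate-+ p _ i)))
        (++-assoc (replicate p i) _ A₀)))
      shorter : suc (length A′) + length B < l
      shorter = ≤-trans (+-monoˡ-< (length B) (≤-trans (+-monoˡ-≤ (length A′) p>1)
        (≤-reflexive (sym (trans (↭.↭-length A↭′) (trans (length-++ (replicate p i))
          (cong (_+ length A′) (length-replicate p)))))))) (≤-pred len)

    -- i ∈ A is the smallest entry: either it occurs in B too and cancels,
    -- or its multiplicity in A is divisible by p.
    reduce : ∀ l i A B → Recursive l → length A + length B < suc l →
      i ∈ A → All (i ≤_) A → All (i ≤_) B → Claim A B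
    reduce l zero    A B rec len i∈A i≤A i≤B hA = contradiction (All.lookup hA i∈A) (n≮n 0)
    reduce l (suc j) A B rec len i∈A i≤A i≤B =
      byMultiplicity (extract (suc j) A i≤A) (extract (suc j) B i≤B)
      where
      Extraction : List ℕ → Set
      Extraction A = ∃₂ λ a A′ → A ↭ replicate a (suc j) ++ A′ × All (suc j <_) A′
      byMultiplicity : Extraction A → Extraction B → Claim A B
      byMultiplicity (zero  , A₀ , A↭ , i<A₀) _ =
        contradiction (All.lookup i<A₀ (↭.∈-resp-↭ A↭ i∈A)) (n≮n (suc j))
      byMultiplicity (suc a , A₀ , A↭ , i<A₀) (suc b , B₀ , B↭ , i<B₀) =
        cancel l j A B _ _ rec len A↭ B↭
      byMultiplicity (suc a , A₀ , A↭ , i<A₀) (zero  , B₀ , B↭ , i<B₀) =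
        merge l (suc j) A B A₀ a rec len (s≤s z≤n) A↭ i<A₀ (↭.All-resp-↭ (↭-sym B↭) i<B₀)

    byMinimum : ∀ l → Recursive l → Recursive (suc l)
    byMinimum l rec []      []      len hA hB h = refl
    byMinimum l rec []      (b ∷ B) len with i , i∈ , i≤ ← minimum b B =
      flip (b ∷ B) [] (reduce l i (b ∷ B) [] rec (subst (_< suc l) (sym (+-identityʳ _)) len) i∈ i≤ [])
    byMinimum l rec (a ∷ A) B       len with i , i∈ , i≤ ← minimum a (A ++ B) | List.∈-++⁻ (a ∷ A) i∈
    ... | inj₁ i∈A = reduce l i (a ∷ A) B rec len i∈A (All.++⁻ˡ (a ∷ A) i≤) (All.++⁻ʳ (a ∷ A) i≤)
    ... | inj₂ i∈B = flip B (a ∷ A) (reduce l i B (a ∷ A) rec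
            (subst (_< suc l) (+-comm (length (a ∷ A)) _) len) i∈B (All.++⁻ʳ (a ∷ A) i≤) (All.++⁻ˡ (a ∷ A) i≤))

    recursive : ∀ l → Recursive l
    recursive zero    A B ()
    recursive (suc l) = byMinimum l (recursive l)

  series⇒sum : ∀ A B → All (0 <_) A → All (0 <_) B →
    (∀ t → series A t ≡ series B t [mod p ]) → sum (map g A) ≡ sum (map g B)
  series⇒sum A B = recursive _ A B (n<1+n _)

-- Inverses modulo m and the prime-to-p part of an integer

least : ∀ {P : ℕ → Set} → (∀ k → Dec (P k)) → ∀ k → P k → ∃ λ m → P m × (∀ j → j < m → ¬ P j)
least {P} P? k = <-rec (λ k → P k → ∃ λ m → P m × (∀ j → j < m → ¬ P j)) step k
  where
  step : ∀ k → (∀ {j} → j < k → P j → ∃ λ m → P m × (∀ j → j < m → ¬ P j)) →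
    P k → ∃ λ m → P m × (∀ j → j < m → ¬ P j)
  step k rec Pk with anyUpTo? P? k
  ... | yes (j , j<k , Pj) = rec j<k Pj
  ... | no  none           = k , Pk , λ j j<k Pj → none (j , j<k , Pj)

inverse-mod : ∀ q m → 0 < m → Coprime q m → ∃ λ a → a * q ≡ 1 [mod m ]
inverse-mod q (suc m) _ coprime with coprime-Bézout coprime
... | Bézout.+- x y eq = x , mod-by 0 y (trans (+-identityʳ (x * q)) (sym eq))
-- Here x is an inverse of -q modulo m+1, and m represents -1, so x m is an inverse of q.
... | Bézout.-+ x y eq = x * m , mod-by y (x * q) (begin
  x * m * q + y * suc m      ≡⟨ cong (λ z → x * m * q + z) eq ⟨
  x * m * q + (1 + x * q)    ≡⟨ regroup x m q ⟩
  1 + x * q * suc m          ∎)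
  where
  open ≡-Reasoning
  regroup : ∀ x m q → x * m * q + (1 + x * q) ≡ 1 + x * q * (1 + m)
  regroup = solve-∀

module PrimeFactor {p} (p-prime : Prime p) where

  p>1 : 1 < p
  p>1 = nonTrivial⇒n>1 p {{prime⇒nonTrivial p-prime}}

  0<p^ : ∀ a → 0 < p ^ a
  0<p^ a = m^n>0 p {{prime⇒nonZero p-prime}} a

  ∤⇒coprime : ∀ {b} → p ∤ b → Coprime b p
  ∤⇒coprime p∤b (d∣b , d∣p) with prime⇒irreducible p-prime d∣p
  ... | inj₁ d≡1  = d≡1
  ... | inj₂ refl = contradiction d∣b p∤b

  coprime⇒∤ : ∀ {b} → Coprime b p → p ∤ b
  coprime⇒∤ coprime p∣b = <⇒≢ p>1 (sym (coprime (p∣b , ∣-refl)))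

  coprime-^ : ∀ {b} → Coprime b p → ∀ a → Coprime b (p ^ a)
  coprime-^ coprime zero    (_ , d∣1) = ∣1⇒≡1 d∣1
  coprime-^ coprime (suc a) (d∣b , d∣p*) = coprime-^ coprime a (d∣b ,
    coprime-divisor (λ { (e∣d , e∣p) → coprime (∣-trans e∣d d∣b , e∣p) }) d∣p*)

  factor : ∀ i → 0 < i → ∃₂ λ a b → i ≡ p ^ a * b × p ∤ b
  factor = <-rec (λ i → 0 < i → ∃₂ λ a b → i ≡ p ^ a * b × p ∤ b) step
    where
    step : ∀ i → (∀ {j} → j < i → 0 < j → ∃₂ λ a b → j ≡ p ^ a * b × p ∤ b) →
      0 < i → ∃₂ λ a b → i ≡ p ^ a * b × p ∤ b
    step i rec 0<i with p ∣? i
    ... | no p∤i = 0 , i , sym (*-identityˡ i) , p∤i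
    ... | yes (divides zero refl) = contradiction 0<i λ ()
    ... | yes (divides (suc q) refl)
      with a , b , eq , p∤b ← rec (m<m*n (suc q) p p>1) z<s =
      suc a , b , trans (cong (_* p) eq) (trans (*-comm (p ^ a * b) p) (sym (*-assoc p (p ^ a) b))) , p∤b

  factor-unique : ∀ a b a′ b′ → p ∤ b → p ∤ b′ → p ^ a * b ≡ p ^ a′ * b′ → b ≡ b′
  factor-unique a b a′ b′ p∤b p∤b′ eq = ∣-antisym (half a b a′ b′ p∤b eq) (half a′ b′ a b p∤b′ (sym eq))
    where
    half : ∀ a b a′ b′ → p ∤ b → p ^ a * b ≡ p ^ a′ * b′ → b ∣ b′
    half a b a′ b′ p∤b eq = coprime-divisor (coprime-^ (∤⇒coprime p∤b) a′) (divides (p ^ a) (sym eq))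

  ∣p^⇒≡p^ : ∀ {i} k → i ∣ p ^ k → ∃ λ a → i ≡ p ^ a
  ∣p^⇒≡p^ {zero}  k 0∣ = contradiction (sym (0∣⇒≡0 0∣)) (<⇒≢ (0<p^ k))
  ∣p^⇒≡p^ {suc i} k i∣ with a , b , eq , p∤b ← factor (suc i) z<s =
    a , trans eq (trans (cong (p ^ a *_) b≡1) (*-identityʳ (p ^ a)))
    where
    b≡1 : b ≡ 1
    b≡1 = coprime-^ (∤⇒coprime p∤b) k (∣-refl , ∣-trans (divides (p ^ a) eq) i∣)

  -- The largest divisor prime to p.
  core : ℕ → ℕ
  core zero    = zero
  core (suc i) = proj₁ (proj₂ (factor (suc i) z<s))

  core-≡ : ∀ i a b → 0 < i → i ≡ p ^ a * b → p ∤ b → core i ≡ b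
  core-≡ (suc i) a b _ eq p∤b with a′ , b′ , eq′ , p∤b′ ← factor (suc i) z<s =
    factor-unique a′ b′ a b p∤b′ p∤b (trans (sym eq′) eq)

  core-* : ∀ i → 0 < i → core (p * i) ≡ core i
  core-* (suc i) _ with a , b , eq , p∤b ← factor (suc i) z<s =
    core-≡ (p * suc i) (suc a) b (*-mono-≤ (<⇒≤ p>1) (z<s {i})) (trans (cong (p *_) eq) (sym (*-assoc p (p ^ a) b))) p∤b

  core-coprime : ∀ i → 0 < i → Coprime i p → core i ≡ i
  core-coprime i 0<i coprime = core-≡ i 0 i 0<i (sym (*-identityˡ i)) (coprime⇒∤ coprime)

  -- Multiplying i by p keeps its prime-to-p part, so this weight is compatible with merging. On
  -- numbers prime to p it is b at b and 0 elsewhere, and its sum over a list is b times the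
  -- multiplicity of b.
  coreWeight : ℕ → ℕ → ℕ
  coreWeight b i with core i ≟ b
  ... | yes _ = i
  ... | no  _ = 0

  coreWeight-* : ∀ b i → 0 < i → coreWeight b (p * i) ≡ p * coreWeight b i
  coreWeight-* b i 0<i with core (p * i) ≟ b | core i ≟ b
  ... | yes _ | yes _ = refl
  ... | no  _ | no  _ = sym (*-zeroʳ p)
  ... | yes e | no ¬e = contradiction (trans (sym (core-* i 0<i)) e) ¬e
  ... | no ¬e | yes e = contradiction (trans (core-* i 0<i) e) ¬e

  coreWeight-yes : ∀ b i → core i ≡ b → coreWeight b i ≡ i
  coreWeight-yes b i e with core i ≟ b
  ... | yes _ = refl
  ... | no ¬e = contradiction e ¬e

  private
    PrimeTo : ℕ → Set
    PrimeTo i = 0 < i × Coprime i p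

    occurs : ∀ b B → All PrimeTo B → 0 < sum (map (coreWeight b) B) → b ∈ B
    occurs b (i ∷ B) ((0<i , i⊥p) ∷ h) 0<Σ with core i ≟ b
    ... | yes e = here (trans (sym e) (core-coprime i 0<i i⊥p))
    ... | no _  = there (occurs b B h 0<Σ)

    sameCounts : ∀ A B → All PrimeTo A → All PrimeTo B →
      (∀ b → sum (map (coreWeight b) A) ≡ sum (map (coreWeight b) B)) → A ↭ B
    sameCounts [] []      _ _ h = ↭-refl
    sameCounts [] (b ∷ B) _ ((0<b , b⊥p) ∷ _) h = contradiction (h b) (<⇒≢ (<-≤-trans 0<b
      (≤-trans (≤-reflexive (sym (coreWeight-yes b b (core-coprime b 0<b b⊥p)))) (m≤m+n _ _))))
    sameCounts (a ∷ A) B ((0<a , a⊥p) ∷ hA) hB h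
      with B′ , B↭ ← ∈⇒↭ (occurs a B hB (subst (0 <_) (h a) (<-≤-trans 0<a
             (≤-trans (≤-reflexive (sym (coreWeight-yes a a (core-coprime a 0<a a⊥p)))) (m≤m+n _ _))))) =
      ↭-trans (↭-prep a (sameCounts A B′ hA (All.tail (↭.All-resp-↭ B↭ hB))
        (λ b → +-cancelˡ-≡ (coreWeight b a) _ _ (trans (h b) (sum-map-↭ (coreWeight b) B↭)))))
        (↭-sym B↭)

  series⇒↭ : p ≢ 2 → ∀ A B → All (λ i → 0 < i × Coprime i p) A → All (λ i → 0 < i × Coprime i p) B →
    (∀ t → series A t ≡ series B t [mod p ]) → A ↭ B
  series⇒↭ p≢2 A B hA hB h = sameCounts A B hA hB
    (λ b → series⇒sum p-prime p≢2 (coreWeight b) (coreWeight-* b) A B (All.map proj₁ hA) (All.map proj₁ hB) h)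

-- Cycles of signed permutations

unique⇒↭ : ∀ {A : Set} {xs ys : List A} → Unique xs → Unique ys →
  (∀ {x} → x ∈ xs → x ∈ ys) → (∀ {x} → x ∈ ys → x ∈ xs) → xs ↭ ys
unique⇒↭ u v f g = ∼bag⇒↭ (unique∧set⇒bag u v (mk⇔ f g))

cardinality-unique : ∀ {X Y : Setoid 0ℓ 0ℓ} {m k} → HasCardinality X m → HasCardinality Y k → Inverse X Y → m ≡ k
cardinality-unique hX hY XY = ↔⇒≡ (Compose.inverse (Symmetry.inverse hX) (Compose.inverse XY hY))

index-≡ : ∀ {A : Set} {x : A} {xs} → Unique xs → (x∈ : x ∈ xs) → ∀ i → x ≡ lookup xs i → index x∈ ≡ i
index-≡ (x∉ ∷ u) (here refl) zero    eq   = refl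
index-≡ (x∉ ∷ u) (here refl) (suc i) eq   = contradiction eq (All.lookup x∉ (List.∈-lookup i))
index-≡ (x∉ ∷ u) (there x∈)  zero    refl = contradiction refl (All.lookup x∉ x∈)
index-≡ (x∉ ∷ u) (there x∈)  (suc i) eq   = cong suc (index-≡ u x∈ i eq)

-- Counting by a complete invariant: h separates the classes of X, and L lists each of its values
-- once.
cardinality-list : ∀ (X : Setoid 0ℓ 0ℓ) {A : Set} (h : Setoid.Carrier X → A) (L : List A) → Unique L →
  (∀ {x y} → Setoid._≈_ X x y → h x ≡ h y) → (∀ {x y} → h x ≡ h y → Setoid._≈_ X x y) →
  (∀ x → h x ∈ L) → (∀ a → a ∈ L → ∃ λ x → h x ≡ a) → HasCardinality X (length L)
cardinality-list X h L unique cong-h reflect-h h∈ hit = record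
  { to        = position
  ; from      = λ i → proj₁ (preimage i)
  ; to-cong   = λ {x} {y} x≈y → index-≡ unique (h∈ x) _ (trans (cong-h x≈y) (Any.lookup-index (h∈ y)))
  ; from-cong = λ { refl → Setoid.refl X }
  ; inverse   = (λ {i} {x} x≈ → index-≡ unique (h∈ x) i (trans (cong-h x≈) (proj₂ (preimage i))))
              , (λ { {x} refl → reflect-h (trans (proj₂ (preimage (position x))) (sym (Any.lookup-index (h∈ x)))) })
  }
  where
  position = λ x → index (h∈ x)
  preimage = λ i → hit (lookup L i) (List.∈-lookup i)

infixr 8 _·_

_·_ : ∀ {n} → Sign → Point n → Point n
s · (σ , i) = s Sign.* σ , i

·-· : ∀ {n} s t (x : Point n) → s · t · x ≡ (s Sign.* t) · x
·-· s t (σ , i) = cong (_, i) (sym (Sign.*-assoc s t σ))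

·-cancel : ∀ {n} s (x : Point n) → s · s · x ≡ x
·-cancel s x = trans (·-· s s x) (cong (_· x) (Sign.s*s≡+ s))

·-comm : ∀ {n} s t (x : Point n) → s · t · x ≡ t · s · x
·-comm s t x = trans (·-· s t x) (trans (cong (_· x) (Sign.*-comm s t)) (sym (·-· t s x)))

·-transpose : ∀ {n} s {x y : Point n} → x ≡ s · y → y ≡ s · x
·-transpose s {x} {y} refl = sym (·-cancel s y)

·-faithful : ∀ {n} s t (x : Point n) → s · x ≡ t · x → s ≡ t
·-faithful s t (σ , i) eq = Sign.*-cancelʳ-≡ σ s t (cong proj₁ eq)

sameAxis : ∀ {n} (x y : Point n) → proj₂ x ≡ proj₂ y → ∃ λ s → x ≡ s · y
sameAxis (σ , i) (τ , .i) refl = σ Sign.* τ ,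
  cong (_, i) (sym (trans (Sign.*-assoc σ τ τ) (trans (cong (σ Sign.*_) (Sign.s*s≡+ τ)) (Sign.*-identityʳ σ))))

to-· : ∀ {n} (u : SignedPermutation n) s x → to u (s · x) ≡ s · to u x
to-· u pos x = refl
to-· u neg x = commutes u x

to-injective : ∀ {n} (u : SignedPermutation n) {x y} → to u x ≡ to u y → x ≡ y
to-injective u {x} {y} eq = trans (sym (strictlyInverseʳ u x)) (trans (cong (from u) eq) (strictlyInverseʳ u y))

iterate : ∀ {n} → SignedPermutation n → ℕ → Point n → Point n
iterate u zero    x = x
iterate u (suc j) x = to u (iterate u j x)

module Cycles {n} (u : SignedPermutation n) where

  it = iterate u

  it-+ : ∀ i j x → it (i + j) x ≡ it i (it j x)
  it-+ zero    j x = refl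
  it-+ (suc i) j x = cong (to u) (it-+ i j x)

  it-· : ∀ j s x → it j (s · x) ≡ s · it j x
  it-· zero    s x = refl
  it-· (suc j) s x = trans (cong (to u) (it-· j s x)) (to-· u s _)

  it-injective : ∀ j {x y} → it j x ≡ it j y → x ≡ y
  it-injective zero    eq = eq
  it-injective (suc j) eq = it-injective j (to-injective u eq)

  it-comm : ∀ i j x → it i (it j x) ≡ it j (it i x)
  it-comm i j x = trans (sym (it-+ i j x)) (trans (cong (λ k → it k x) (+-comm i j)) (it-+ j i x))

  it-* : ∀ q k s x → it k x ≡ s · x → ∃ λ t → it (q * k) x ≡ t · x
  it-* zero    k s x eq = pos , refl
  it-* (suc q) k s x eq with t , eq′ ← it-* q k s x eq = t Sign.* s , (begin
    it (k + q * k) x      ≡⟨ it-+ k (q * k) x ⟩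
    it k (it (q * k) x)   ≡⟨ cong (it k) eq′ ⟩
    it k (t · x)          ≡⟨ it-· k t x ⟩
    t · it k x            ≡⟨ cong (t ·_) eq ⟩
    t · s · x             ≡⟨ ·-· t s x ⟩
    (t Sign.* s) · x      ∎)
    where open ≡-Reasoning

  -- The size is the period of the axis of x, that is, of x up to sign: on a negative cycle the
  -- point itself returns only after twice as many steps. It is stored through its predecessor
  -- because a period must be positive.
  record HalfPeriod (x : Point n) : Set where
    field
      pred-size : ℕ
      sign      : Sign
    size : ℕ
    size = suc pred-size
    field
      closes  : it size x ≡ sign · x
      minimal : ∀ j s → 0 < j → j < size → it j x ≢ s · x

  abstract
    halfPeriod : ∀ x → HalfPeriod x
    halfPeriod x = record
      { pred-size = proj₁ shortest
      ; sign      = proj₁ (sameAxis _ _ (proj₁ (proj₂ shortest)))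
      ; closes    = proj₂ (sameAxis _ _ (proj₁ (proj₂ shortest)))
      ; minimal   = λ { (suc j) s _ (s≤s j<) eq → proj₂ (proj₂ shortest) j j< (cong proj₂ eq) } }
      where
      Returns : ℕ → Set
      Returns j = proj₂ (it (suc j) x) ≡ proj₂ x
      returns : ∃ Returns
      -- Two of the first n+1 iterates lie on one axis, and injectivity strips the i steps they have
      -- in common. The index of `Returns` is shifted by one to exclude the trivial return at time
      -- 0.
      returns with i , j , i<j , same ← Fin.pigeonhole (n<1+n n) (λ (i : Fin (suc n)) → proj₂ (it (toℕ i) x))
        with k , eq ← m≤n⇒∃[o]m+o≡n i<j | s , same′ ← sameAxis _ _ (sym same) =
        k , cong proj₂ (it-injective (toℕ i) {it (suc k) x} {s · x} (begin
          it (toℕ i) (it (suc k) x)           ≡⟨ it-+ (toℕ i) (suc k) x ⟨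
          it (toℕ i + suc k) x                ≡⟨ cong (λ l → it l x) (trans (+-suc (toℕ i) k) eq) ⟩
          it (toℕ j) x                        ≡⟨ same′ ⟩
          s · it (toℕ i) x                    ≡⟨ it-· (toℕ i) s x ⟨
          it (toℕ i) (s · x)                  ∎))
        where open ≡-Reasoning
      shortest : ∃ λ m → Returns m × (∀ j → j < m → ¬ Returns j)
      shortest = least (λ j → proj₂ (it (suc j) x) Fin.≟ proj₂ x) (proj₁ returns) (proj₂ returns)

  pred-size : Point n → ℕ
  pred-size x = HalfPeriod.pred-size (halfPeriod x)

  size : Point n → ℕ
  size x = suc (pred-size x)

  sign : Point n → Sign
  sign x = HalfPeriod.sign (halfPeriod x)

  closes : ∀ x → it (size x) x ≡ sign x · x
  closes x = HalfPeriod.closes (halfPeriod x)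

  it-mod : ∀ j x → ∃ λ s → it j x ≡ s · it (j % size x) x
  it-mod j x with s , eq ← it-* (j / size x) (size x) (sign x) x (closes x) = s , (begin
    it j x                                        ≡⟨ cong (λ k → it k x) (m≡m%n+[m/n]*n j (size x)) ⟩
    it (j % size x + j / size x * size x) x       ≡⟨ it-+ (j % size x) _ x ⟩
    it (j % size x) (it (j / size x * size x) x)  ≡⟨ cong (it (j % size x)) eq ⟩
    it (j % size x) (s · x)                       ≡⟨ it-· (j % size x) s x ⟩
    s · it (j % size x) x                         ∎)
    where open ≡-Reasoning

  -- A non-zero remainder would itself be a return time up to sign, shorter than the size, against
  -- minimality.
  remainder≡0 : ∀ j s x → it j x ≡ s · x → j % size x ≡ 0
  remainder≡0 j s x eq with t , eq′ ← it-mod j x | j % size x in r≡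
  ... | zero  = refl
  ... | suc r = contradiction (trans (·-transpose t (trans (sym eq) eq′)) (·-· t s x))
    (HalfPeriod.minimal (halfPeriod x) (suc r) (t Sign.* s) z<s (subst (_< size x) r≡ (m%n<n j (size x))))

  orbit : Point n → List (Fin n)
  orbit x = applyUpTo (λ j → proj₂ (it j x)) (size x)

  Reaches : Point n → Point n → Set
  Reaches x y = ∃₂ λ j s → y ≡ s · it j x

  ∈-orbit⁺ : ∀ {x y} → Reaches x y → proj₂ y ∈ orbit x
  ∈-orbit⁺ {x} {y} (j , s , refl) = subst (_∈ orbit x) (cong proj₂ (sym (proj₂ (it-mod j x))))
    (List.∈-applyUpTo⁺ (λ j → proj₂ (it j x)) (m%n<n j (size x)))

  ∈-orbit⁻ : ∀ {x y} → proj₂ y ∈ orbit x → Reaches x y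
  ∈-orbit⁻ {x} {y} y∈ with j , _ , eq ← List.∈-applyUpTo⁻ _ y∈ = j , sameAxis y (it j x) eq

  reaches-sym : ∀ {x y} → Reaches x y → Reaches y x
  reaches-sym {x} (j , s , refl) with t , eq ← it-* j (size x) (sign x) x (closes x) =
    -- Together with the j steps already made, this many steps amount to j full turns.
    j * pred-size x , t Sign.* s , sym (begin
      (t Sign.* s) · it k (s · it j x)     ≡⟨ cong ((t Sign.* s) ·_) (it-· k s _) ⟩
      (t Sign.* s) · s · it k (it j x)     ≡⟨ ·-· t s _ ⟨
      t · s · s · it k (it j x)            ≡⟨ cong (t ·_) (·-cancel s _) ⟩
      t · it k (it j x)                    ≡⟨ cong (t ·_) (it-+ k j x) ⟨
      t · it (k + j) x                     ≡⟨ cong (λ l → t · it l x) (trans (+-comm k j) (sym (*-suc j (pred-size x)))) ⟩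
      t · it (j * size x) x                ≡⟨ cong (t ·_) eq ⟩
      t · t · x                            ≡⟨ ·-cancel t x ⟩
      x                                    ∎)
    where
    open ≡-Reasoning
    k = j * pred-size x

  reaches-trans : ∀ {x y z} → Reaches x y → Reaches y z → Reaches x z
  reaches-trans {x} (i , s , refl) (j , t , refl) = j + i , t Sign.* s , (begin
    t · it j (s · it i x)        ≡⟨ cong (t ·_) (it-· j s _) ⟩
    t · s · it j (it i x)        ≡⟨ ·-· t s _ ⟩
    (t Sign.* s) · it j (it i x) ≡⟨ cong ((t Sign.* s) ·_) (it-+ j i x) ⟨
    (t Sign.* s) · it (j + i) x  ∎)
    where open ≡-Reasoning

  unique-orbit : ∀ x → Unique (orbit x)
  unique-orbit x = Unique.applyUpTo⁺₁ (λ j → proj₂ (it j x)) (size x) distinct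
    where
    distinct : ∀ {i j} → i < j → j < size x → proj₂ (it i x) ≢ proj₂ (it j x)
    distinct {i} {j} i<j j<size same with k , refl ← m≤n⇒∃[o]m+o≡n i<j | s , eq ← sameAxis (it j x) (it i x) (sym same) =
      HalfPeriod.minimal (halfPeriod x) (suc k) s z<s (≤-trans (s≤s (s≤s (m≤n+m k i))) j<size)
        (it-injective i (begin
          it i (it (suc k) x) ≡⟨ it-+ i (suc k) x ⟨
          it (i + suc k) x    ≡⟨ cong (λ l → it l x) (+-suc i k) ⟩
          it (suc i + k) x    ≡⟨ eq ⟩
          s · it i x          ≡⟨ it-· i s x ⟨
          it i (s · x)        ∎))
      where open ≡-Reasoning

  Separate : Point n → Point n → Set
  Separate x y = ¬ Reaches x y

  -- Representatives of the orbits of ⟨u, −1⟩ on {±1,…,±n}.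
  record Representatives (xs : List (Point n)) : Set where
    field
      separate : AllPairs Separate xs
      cover    : ∀ y → Any (λ x → Reaches x y) xs

    positions : List (Fin n)
    positions = concat (map orbit xs)

    positions↭allFin : positions ↭ allFin n
    positions↭allFin = unique⇒↭
      (Unique.concat⁺ (All.map⁺ (All.universal unique-orbit xs)) (AllPairs.map⁺ (AllPairs.map disjoint separate)))
      (Unique.allFin⁺ n) (λ _ → List.∈-allFin _)
      (λ {i} _ → List.∈-concat⁺ (Any.map⁺ (Any.map ∈-orbit⁺ (cover (pos , i)))))
      where
      disjoint : ∀ {x y} → Separate x y → Disjoint (orbit x) (orbit y)
      disjoint sep {i} (i∈x , i∈y) = sep (reaches-trans (∈-orbit⁻ {y = pos , i} i∈x) (reaches-sym (∈-orbit⁻ {y = pos , i} i∈y)))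

    sum-orbits : ∀ (g : Fin n → ℕ) → sum (map g (allFin n)) ≡ sum (map (λ x → sum (map g (orbit x))) xs)
    sum-orbits g = trans (sum-map-↭ g (↭-sym positions↭allFin)) (go xs)
      where
      go : ∀ xs → sum (map g (concat (map orbit xs))) ≡ sum (map (λ x → sum (map g (orbit x))) xs)
      go []       = refl
      go (x ∷ xs) = trans (cong sum (map-++ g (orbit x) _)) (trans (sum-++ (map g (orbit x)) _) (cong (λ z → _ + z) (go xs)))

  representatives : ∃ Representatives
  representatives = proj₁ built , record
    { separate = proj₁ (proj₂ built)
    ; cover    = λ y → Any.map (λ (r : Reaches _ (pos , proj₂ y)) → reaches-trans r (0 , proj₁ y ,
        cong (_, proj₂ y) (sym (Sign.*-identityʳ (proj₁ y))))) (proj₂ (proj₂ built) (proj₂ y) (List.∈-allFin _)) }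
    where
    reaches? : ∀ y x → Dec (Reaches x y)
    reaches? y x with Any.any? (proj₂ y Fin.≟_) (orbit x)
    ... | yes h = yes (∈-orbit⁻ h)
    ... | no ¬h = no (¬h ∘ ∈-orbit⁺)
    go : ∀ is → ∃ λ xs → AllPairs Separate xs × ∀ i → i ∈ is → Any (λ x → Reaches x (pos , i)) xs
    go []       = [] , [] , λ _ ()
    go (i ∷ is) with xs , sep , cov ← go is with Any.any? (reaches? (pos , i)) xs
    ... | yes h = xs , sep , λ { j (here refl) → h ; j (there j∈) → cov j j∈ }
    ... | no ¬h = (pos , i) ∷ xs , All.map (λ sep r → sep (reaches-sym r)) (All.¬Any⇒All¬ xs ¬h) ∷ sep
        , λ { j (here refl) → here (0 , pos , refl) ; j (there j∈) → there (cov j j∈) }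
    built = go (allFin n)

sum-replicate : ∀ {A : Set} c (f : ℕ → A) (g : A → ℕ) k → (∀ j → g (f j) ≡ c) → sum (map g (applyUpTo f k)) ≡ k * c
sum-replicate c f g zero    h = refl
sum-replicate c f g (suc k) h = cong₂ _+_ (h 0) (sum-replicate c (f ∘ suc) g k (h ∘ suc))

sum-sizes : ∀ {n} (u : SignedPermutation n) {xs} → Cycles.Representatives u xs → sum (map (Cycles.size u) xs) ≡ n
sum-sizes {n} u {xs} R = begin
  sum (map size xs)                                ≡⟨ cong sum (map-cong (λ x → sym (trans (sum-replicate 1 (λ j → proj₂ (it j x)) (λ _ → 1) (size x) (λ _ → refl)) (*-identityʳ (size x)))) xs) ⟩
  sum (map (λ x → sum (map (λ _ → 1) (orbit x))) xs) ≡⟨ Representatives.sum-orbits R (λ _ → 1) ⟨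
  sum (map (λ _ → 1) (allFin n))                   ≡⟨ ones (allFin n) ⟩
  length (allFin n)                                ≡⟨ length-tabulate id ⟩
  n                                                ∎
  where
  open ≡-Reasoning
  open Cycles u
  ones : ∀ {A : Set} (xs : List A) → sum (map (λ _ → 1) xs) ≡ length xs
  ones []       = refl
  ones (x ∷ xs) = cong suc (ones xs)

-- Fixed points modulo p of maps of p-power order

fold : ∀ {A : Set} → (A → A) → ℕ → A → A
fold f zero    x = x
fold f (suc j) x = f (fold f j x)

fold-+ : ∀ {A : Set} (f : A → A) i j x → fold f (i + j) x ≡ fold f i (fold f j x)
fold-+ f zero    j x = refl
fold-+ f (suc i) j x = cong f (fold-+ f i j x)

indicator : ∀ {P : Set} → Dec P → ℕ
indicator (yes _) = 1
indicator (no _)  = 0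

indicator-yes : ∀ {P : Set} (d : Dec P) → P → indicator d ≡ 1
indicator-yes (yes _) _ = refl
indicator-yes (no ¬h) h = contradiction h ¬h

indicator-no : ∀ {P : Set} (d : Dec P) → ¬ P → indicator d ≡ 0
indicator-no (yes h) ¬h = contradiction h ¬h
indicator-no (no _)  _  = refl

length-filter : ∀ {A : Set} {P : A → Set} (P? : ∀ x → Dec (P x)) xs →
  length (filter P? xs) ≡ sum (map (indicator ∘ P?) xs)
length-filter P? []       = refl
length-filter P? (x ∷ xs) with P? x
... | yes _ = cong suc (length-filter P? xs)
... | no _  = length-filter P? xs

sum-mod : ∀ {A : Set} {p} (f g : A → ℕ) → (∀ x → f x ≡ g x [mod p ]) → ∀ xs → sum (map f xs) ≡ sum (map g xs) [mod p ]
sum-mod f g h []       = mod-reflexive refl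
sum-mod f g h (x ∷ xs) = mod-+ (h x) (sum-mod f g h xs)

Subsetoid : (X : Setoid 0ℓ 0ℓ) → (Setoid.Carrier X → Set) → Setoid 0ℓ 0ℓ
Subsetoid X P = On.setoid {B = Σ (Setoid.Carrier X) P} X proj₁

-- The map f is read as a signed permutation that never changes a sign, so that the theory of cycles
-- applies. Its orbit sizes divide pᵏ; an orbit of size 1 is a fixed point, any other orbit has size
-- divisible by p and contains none.
fin-count : ∀ {N} {p} → Prime p → ∀ k (f : Fin N → Fin N) → (∀ i → fold f (p ^ k) i ≡ i) →
  N ≡ length (filter (λ i → f i Fin.≟ i) (allFin N)) [mod p ]
fin-count {N} {p} p-prime k f periodic = mod-trans (mod-reflexive (sym (sum-sizes u R)))
  (mod-trans (sum-mod size _ orbit-mod xs)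
    (mod-reflexive (sym (trans (length-filter fixed? (allFin N)) (Representatives.sum-orbits R (indicator ∘ fixed?))))))
  where
  open PrimeFactor p-prime
  fixed? : ∀ i → Dec (f i ≡ i)
  fixed? i = f i Fin.≟ i
  -- The iterate of f with exponent pᵏ - 1 is its inverse.
  P-1 = pred (p ^ k)
  1+P-1 : suc P-1 ≡ p ^ k
  1+P-1 = suc-pred (p ^ k) {{>-nonZero (0<p^ k)}}
  u : SignedPermutation N
  u = record
    { perm = mk↔ₛ′ (λ (σ , i) → σ , f i) (λ (σ , i) → σ , fold f P-1 i)
        (λ (σ , i) → cong (σ ,_) (trans (cong (λ m → fold f m i) 1+P-1) (periodic i)))
        (λ (σ , i) → cong (σ ,_) (trans (sym (fold-+ f P-1 1 i))
          (trans (cong (λ m → fold f m i) (trans (+-comm P-1 1) 1+P-1)) (periodic i))))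
    ; commutes = λ _ → refl }
  open Cycles u
  xs = proj₁ representatives
  R  = proj₂ representatives
  it-fold : ∀ j σ i → it j (σ , i) ≡ (σ , fold f j i)
  it-fold zero    σ i = refl
  it-fold (suc j) σ i = cong (to u) (it-fold j σ i)
  size∣ : ∀ x → size x ∣ p ^ k
  size∣ x@(σ , i) = m%n≡0⇒n∣m (p ^ k) (size x) (remainder≡0 (p ^ k) pos x
    (trans (it-fold (p ^ k) σ i) (cong (σ ,_) (periodic i))))
  fixed⇒ : ∀ j x → f (proj₂ (it j x)) ≡ proj₂ (it j x) → ∃ λ s → it 1 x ≡ s · x
  fixed⇒ j x eq with s , eq′ ← sameAxis (it (suc j) x) (it j x) eq =
    s , it-injective j (trans (it-comm j 1 x) (trans eq′ (sym (it-· j s x))))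
  orbit-mod : ∀ x → size x ≡ sum (map (indicator ∘ fixed?) (orbit x)) [mod p ]
  orbit-mod x with ∣p^⇒≡p^ k (size∣ x)
  ... | zero , size≡1 = mod-reflexive (sym (trans
    (sum-replicate 1 _ (indicator ∘ fixed?) (size x) (λ j → indicator-yes (fixed? (proj₂ (it j x)))
      (cong proj₂ (begin
        it (1 + j) x       ≡⟨ it-comm 1 j x ⟩
        it j (it 1 x)      ≡⟨ cong (it j) (trans (cong (λ m → it m x) (sym size≡1)) (closes x)) ⟩
        it j (sign x · x)  ≡⟨ it-· j (sign x) x ⟩
        sign x · it j x    ∎))))
    (*-identityʳ (size x))))
    where open ≡-Reasoning
  ... | suc a , size≡p* = mod-trans (∣⇒mod-0 (subst (p ∣_) (sym size≡p*) (m∣m*n (p ^ a))))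
    (mod-reflexive (sym (trans
      (sum-replicate 0 _ (indicator ∘ fixed?) (size x) (λ j → indicator-no (fixed? (proj₂ (it j x)))
        (λ eq → HalfPeriod.minimal (halfPeriod x) 1 (proj₁ (fixed⇒ j x eq)) z<s
          (subst (1 <_) (sym size≡p*) (<-≤-trans p>1 (m≤m*n p (p ^ a) {{>-nonZero (0<p^ a)}})))
          (proj₂ (fixed⇒ j x eq)))))
      (*-zeroʳ (size x)))))

module _ (X : Setoid 0ℓ 0ℓ) {N} (hX : HasCardinality X N) where
  private
    module X = Setoid X
    open Inverse hX using (to-cong; from-cong; inverse) renaming (to to code; from to decode)
    code-decode : ∀ i → code (decode i) ≡ i
    code-decode i = proj₁ inverse X.refl
    decode-code : ∀ x → decode (code x) X.≈ x
    decode-code x = proj₂ inverse refl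
    code-injective : ∀ {x y} → code x ≡ code y → x X.≈ y
    code-injective {x} {y} eq = X.trans (X.sym (decode-code x)) (X.trans (from-cong eq) (decode-code y))

  subset-cardinality : (P : X.Carrier → Set) → (∀ {x y} → x X.≈ y → P x → P y) →
    (P? : ∀ x → Dec (P x)) → HasCardinality (Subsetoid X P) (length (filter (P? ∘ decode) (allFin N)))
  subset-cardinality P resp P? = cardinality-list (Subsetoid X P) (code ∘ proj₁)
    (filter (P? ∘ decode) (allFin N)) (Unique.filter⁺ (P? ∘ decode) (Unique.allFin⁺ N))
    to-cong code-injective
    (λ (x , Px) → List.∈-filter⁺ (P? ∘ decode) (List.∈-allFin _) (resp (X.sym (decode-code x)) Px))
    (λ i i∈ → (decode i , proj₂ (List.∈-filter⁻ (P? ∘ decode) {xs = allFin N} i∈)) , code-decode i)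

  -- A group of order pᵏ acts with orbits of size 1 or divisible by p.
  fixedPoints-mod : ∀ {p} → Prime p → ∀ k (f : X.Carrier → X.Carrier) → (∀ {x y} → x X.≈ y → f x X.≈ f y) →
    (∀ x → fold f (p ^ k) x X.≈ x) → ∀ {M} → HasCardinality (Subsetoid X (λ x → f x X.≈ x)) M → N ≡ M [mod p ]
  fixedPoints-mod {p} p-prime k f f-cong periodic hM =
    mod-trans (fin-count p-prime k f̂ (λ i → trans (fold-f̂ (p ^ k) i) (trans (to-cong (periodic (decode i))) (code-decode i))))
      (mod-reflexive (cardinality-unique hFix hM (Identity.inverse (Subsetoid X (λ x → f x X.≈ x)))))
    where
    f̂ : Fin N → Fin N
    f̂ i = code (f (decode i))
    fold-f̂ : ∀ m i → fold f̂ m i ≡ code (fold f m (decode i))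
    fold-f̂ zero    i = sym (code-decode i)
    fold-f̂ (suc m) i = trans (cong f̂ (fold-f̂ m i)) (to-cong (f-cong (decode-code _)))
    hFix : HasCardinality (Subsetoid X (λ x → f x X.≈ x)) (length (filter (λ i → f̂ i Fin.≟ i) (allFin N)))
    hFix = cardinality-list (Subsetoid X (λ x → f x X.≈ x)) (code ∘ proj₁)
      (filter (λ i → f̂ i Fin.≟ i) (allFin N)) (Unique.filter⁺ (λ i → f̂ i Fin.≟ i) (Unique.allFin⁺ N))
      to-cong code-injective
      (λ (x , fx≈x) → List.∈-filter⁺ (λ i → f̂ i Fin.≟ i) (List.∈-allFin _)
        (to-cong (X.trans (f-cong (decode-code x)) fx≈x)))
      (λ i i∈ → (decode i , code-injective (trans (proj₂ (List.∈-filter⁻ (λ i → f̂ i Fin.≟ i) {xs = allFin N} i∈)) (sym (code-decode i))))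
        , code-decode i)

-- Dominant vectors

total : ∀ {n} → (Fin n → ℤ) → ℤ
total {zero}  f = + 0
total {suc n} f = f zero ℤ.+ total (f ∘ suc)

-- The fundamental coweights: only the i-th reflection changes tail i.
tail : ∀ {n} → Fin n → (Fin n → ℤ) → ℤ
tail zero    f = total f
tail (suc j) f = tail j (f ∘ suc)

total-≤ : ∀ {n} {f g : Fin n → ℤ} → (∀ i → f i ℤ.≤ g i) → total f ℤ.≤ total g
total-≤ {zero}  h = ℤ.≤-refl
total-≤ {suc n} h = ℤ.+-mono-≤ (h zero) (total-≤ (h ∘ suc))

total-< : ∀ {n} {f g : Fin n → ℤ} → (∀ i → f i ℤ.≤ g i) → ∀ j → f j ℤ.< g j → total f ℤ.< total g
total-< h zero    f<g = ℤ.+-mono-<-≤ f<g (total-≤ (h ∘ suc))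
total-< h (suc j) f<g = ℤ.+-mono-≤-< (h zero) (total-< (h ∘ suc) j f<g)

tail-≤ : ∀ {n} (j : Fin n) {f g : Fin n → ℤ} → (∀ i → f i ℤ.≤ g i) → tail j f ℤ.≤ tail j g
tail-≤ zero    h = total-≤ h
tail-≤ (suc j) h = tail-≤ j (h ∘ suc)

total-cong : ∀ {n} {f g : Fin n → ℤ} → (∀ i → f i ≡ g i) → total f ≡ total g
total-cong {zero}  h = refl
total-cong {suc n} h = cong₂ ℤ._+_ (h zero) (total-cong (h ∘ suc))

tail-cong : ∀ {n} (j : Fin n) {f g : Fin n → ℤ} → (∀ i → f i ≡ g i) → tail j f ≡ tail j g
tail-cong zero    h = total-cong h
tail-cong (suc j) h = tail-cong j (h ∘ suc)

-- The adjacent transposition by recursion on its position, in step with the recursion of `tail`.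
swap : ∀ {n} → Fin n → Fin (suc n) → Fin (suc n)
swap zero    zero          = suc zero
swap zero    (suc zero)    = zero
swap zero    (suc (suc k)) = suc (suc k)
swap (suc j) zero          = zero
swap (suc j) (suc k)       = suc (swap j k)

transpose≡swap : ∀ {n} (j : Fin n) k → PC.transpose (inject₁ j) (suc j) k ≡ swap j k
transpose≡swap zero    zero          = refl
transpose≡swap zero    (suc zero)    = refl
transpose≡swap zero    (suc (suc k)) = refl
transpose≡swap (suc j) zero          = refl
transpose≡swap (suc j) (suc k) = trans (transpose-suc (inject₁ j) (suc j) k) (cong suc (transpose≡swap j k))
  where
  transpose-suc : ∀ {n} (i j k : Fin n) → PC.transpose (suc i) (suc j) (suc k) ≡ suc (PC.transpose i j k)
  transpose-suc i j k with k Fin.≟ i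
  ... | yes _ = refl
  ... | no  _ with k Fin.≟ j
  ...   | yes _ = refl
  ...   | no  _ = refl

total-swap : ∀ {n} (j : Fin n) (f : Fin (suc n) → ℤ) → total (f ∘ swap j) ≡ total f
total-swap zero    f = rotate (f (suc zero)) (f zero) _
  where
  rotate : ∀ a b c → a ℤ.+ (b ℤ.+ c) ≡ b ℤ.+ (a ℤ.+ c)
  rotate = ℤSolver.solve-∀
total-swap (suc j) f = cong (λ z → f zero ℤ.+ z) (total-swap j (f ∘ suc))

tail-swap : ∀ {n} (j : Fin n) k (f : Fin (suc n) → ℤ) → k ≢ suc j → tail k (f ∘ swap j) ≡ tail k f
tail-swap j       zero          f k≢ = total-swap j f
tail-swap zero    (suc zero)    f k≢ = contradiction refl k≢
tail-swap zero    (suc (suc k)) f k≢ = refl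
tail-swap (suc j) (suc k)       f k≢ = tail-swap j k (f ∘ suc) (k≢ ∘ cong suc)

tail-jump : ∀ {n} (j : Fin n) (f : Fin (suc n) → ℤ) →
  tail (suc j) (f ∘ swap j) ℤ.+ f (suc j) ≡ tail (suc j) f ℤ.+ f (inject₁ j)
tail-jump zero    f = rotate (f zero) _ (f (suc zero))
  where
  rotate : ∀ a c b → a ℤ.+ c ℤ.+ b ≡ b ℤ.+ c ℤ.+ a
  rotate = ℤSolver.solve-∀
tail-jump (suc j) f = tail-jump j (f ∘ suc)

Vector : ℕ → Set
Vector n = Point n → ℤ

positive : ∀ {n} → Vector n → Fin n → ℤ
positive F i = F (pos , i)

reflect-tail : ∀ {n} (i k : Fin n) (F : Vector n) → k ≢ i → tail k (positive (F ∘ reflect i)) ≡ tail k (positive F)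
reflect-tail zero    zero    F k≢ = contradiction refl k≢
reflect-tail zero    (suc k) F k≢ = refl
reflect-tail (suc j) k       F k≢ = trans
  (tail-cong k (λ i → cong (λ l → F (pos , l)) (transpose≡swap j i))) (tail-swap j k (positive F) k≢)

reflected : ∀ {n} → Fin n → Point n
reflected i = reflect i (pos , i)

reflected-suc : ∀ {n} (j : Fin n) → reflected (suc j) ≡ (pos , inject₁ j)
reflected-suc j = cong (pos ,_) (trans (transpose≡swap j (suc j)) (swap-suc j))
  where
  swap-suc : ∀ {n} (j : Fin n) → swap j (suc j) ≡ inject₁ j
  swap-suc zero    = refl
  swap-suc (suc j) = cong suc (swap-suc j)

-- Under the i-th reflection the i-th coweight changes by `F (reflected i)` minus `F (pos , i)`,
-- here written without subtraction. The change is zero exactly when F agrees at these two points,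
-- which detects invariance, and positive exactly when F fails to be dominant at i, which drives the
-- sorting.
reflect-jump : ∀ {n} (i : Fin n) (F : Vector n) →
  tail i (positive (F ∘ reflect i)) ℤ.+ F (pos , i) ≡ tail i (positive F) ℤ.+ F (reflected i)
reflect-jump zero    F = rotate (F (neg , zero)) _ (F (pos , zero))
  where
  rotate : ∀ a c b → a ℤ.+ c ℤ.+ b ≡ b ℤ.+ c ℤ.+ a
  rotate = ℤSolver.solve-∀
reflect-jump (suc j) F = trans
  (cong (ℤ._+ F (pos , suc j)) (tail-cong (suc j) (λ i → cong (λ l → F (pos , l)) (transpose≡swap j i))))
  (trans (tail-jump j (positive F)) (cong (λ x → tail (suc j) (positive F) ℤ.+ F x) (sym (reflected-suc j))))

reflect-invariant : ∀ {n} (i : Fin n) (F : Vector n) → F (reflected i) ≡ F (pos , i) →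
  ∀ k → F (reflect i (pos , k)) ≡ F (pos , k)
reflect-invariant zero    F eq zero    = eq
reflect-invariant zero    F eq (suc k) = refl
reflect-invariant (suc j) F eq k = trans (cong (λ l → F (pos , l)) (transpose≡swap j k))
  (go j (positive F) (trans (cong F (sym (reflected-suc j))) eq) k)
  where
  go : ∀ {n} (j : Fin n) (f : Fin (suc n) → ℤ) → f (inject₁ j) ≡ f (suc j) → ∀ k → f (swap j k) ≡ f k
  go zero    f eq zero          = sym eq
  go zero    f eq (suc zero)    = eq
  go zero    f eq (suc (suc k)) = refl
  go (suc j) f eq zero          = refl
  go (suc j) f eq (suc k)       = go j (f ∘ suc) eq k

Dominant : ∀ {n} → Vector n → Set
Dominant F = ∀ i → F (reflected i) ℤ.≤ F (pos , i)

-- The path of reflections into the dominant chamber is kept, because later proofs are inductions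
-- along it; the strict inequality tells which reflections can occur.
data Sorts {n} : Vector n → Set where
  done : ∀ {F} → Dominant F → Sorts F
  step : ∀ {F} i → F (pos , i) ℤ.< F (reflected i) → Sorts (F ∘ reflect i) → Sorts F

-- A reflection at a violated inequality raises one coweight and fixes the others, so the sum of all
-- coweights grows by at least 1. It is bounded because reflections preserve the bound C on the
-- values. The recursion in `go` is on the distance left to this bound.
sort : ∀ {n} C (F : Vector n) → (∀ x → F x ℤ.≤ C) → Sorts F
sort {n} C F F≤C = go (proj₁ enough) F F≤C (proj₂ enough)
  where
  potential : Vector n → ℤ
  potential F = total (λ i → tail i (positive F))

  bound : ℤ
  bound = potential (λ _ → C)

  potential≤bound : ∀ F → (∀ x → F x ℤ.≤ C) → potential F ℤ.≤ bound
  potential≤bound F F≤C = total-≤ (λ i → tail-≤ i (λ k → F≤C (pos , k)))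

  enough : ∃ λ k → bound ℤ.≤ potential F ℤ.+ + k
  enough = ℤ.∣ bound ℤ.- potential F ∣ , ℤ.≤-trans
    (ℤ.≤-reflexive (rearrange bound (potential F)))
    (ℤ.+-monoʳ-≤ (potential F) (x≤∣x∣ (bound ℤ.- potential F)))
    where
    rearrange : ∀ b q → b ≡ q ℤ.+ (b ℤ.- q)
    rearrange = ℤSolver.solve-∀
    x≤∣x∣ : ∀ x → x ℤ.≤ + ℤ.∣ x ∣
    x≤∣x∣ (+ _)    = ℤ.≤-refl
    x≤∣x∣ -[1+ _ ] = ℤ.-≤+

  increases : ∀ i F → F (pos , i) ℤ.< F (reflected i) → potential F ℤ.< potential (F ∘ reflect i)
  increases i F lt = total-< monotone i jump
    where
    jump : tail i (positive F) ℤ.< tail i (positive (F ∘ reflect i))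
    jump = ℤ.≰⇒> (λ le → ℤ.<-irrefl (reflect-jump i F) (ℤ.+-mono-≤-< le lt))
    monotone : ∀ k → tail k (positive F) ℤ.≤ tail k (positive (F ∘ reflect i))
    monotone k with k Fin.≟ i
    ... | yes refl = ℤ.<⇒≤ jump
    ... | no  k≢i  = ℤ.≤-reflexive (sym (reflect-tail i k F k≢i))

  go : ∀ k F → (∀ x → F x ℤ.≤ C) → bound ℤ.≤ potential F ℤ.+ + k → Sorts F
  go k F F≤C near with Fin.any? (λ i → F (pos , i) ℤ.<? F (reflected i))
  ... | no  none     = done (λ i → ℤ.≮⇒≥ (λ lt → none (i , lt)))
  go zero F F≤C near | yes (i , lt) = contradiction
    (ℤ.≤-<-trans (subst (bound ℤ.≤_) (ℤ.+-identityʳ _) near) (increases i F lt))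
    (ℤ.≤⇒≯ (potential≤bound (F ∘ reflect i) (F≤C ∘ reflect i)))
  go (suc k) F F≤C near | yes (i , lt) = step i lt (go k (F ∘ reflect i) (F≤C ∘ reflect i)
    (ℤ.≤-trans near (ℤ.≤-trans (ℤ.≤-reflexive (shuffle (potential F) (+ k)))
      (ℤ.+-monoˡ-≤ (+ k) (ℤ.i<j⇒suc[i]≤j (increases i F lt))))))
    where
    shuffle : ∀ q k → q ℤ.+ (+ 1 ℤ.+ k) ≡ (+ 1 ℤ.+ q) ℤ.+ k
    shuffle = ℤSolver.solve-∀

-- The vector with stabilizer W_J: it increases exactly at the indices outside J.
level : ∀ {n} → Subset n → Fin n → ℕ
level (inside  ∷ J) zero    = 0
level (outside ∷ J) zero    = 1
level (inside  ∷ J) (suc i) = level J i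
level (outside ∷ J) (suc i) = suc (level J i)

infixr 9 _⊙_

_⊙_ : Sign → ℤ → ℤ
pos ⊙ z = z
neg ⊙ z = ℤ.- z

weight : ∀ {n} → Subset n → Vector n
weight J (σ , i) = σ ⊙ (+ level J i)

Odd : ∀ {n} → Vector n → Set
Odd F = ∀ x → F (negate x) ≡ ℤ.- F x

weight-odd : ∀ {n} (J : Subset n) → Odd (weight J)
weight-odd J (pos , i) = refl
weight-odd J (neg , i) = sym (ℤ.neg-involutive _)

level-inject₁ : ∀ {n} (J : Subset (suc n)) j → (suc j Subset.∈ J → level J (suc j) ≡ level J (inject₁ j)) ×
  (suc j Subset.∉ J → level J (suc j) ≡ suc (level J (inject₁ j)))
level-inject₁ (inside  ∷ inside  ∷ J) zero = (λ _ → refl) , (λ j∉ → contradiction (there here) j∉)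
level-inject₁ (inside  ∷ outside ∷ J) zero = (λ { (there ()) }) , (λ _ → refl)
level-inject₁ (outside ∷ inside  ∷ J) zero = (λ _ → refl) , (λ j∉ → contradiction (there here) j∉)
level-inject₁ (outside ∷ outside ∷ J) zero = (λ { (there ()) }) , (λ _ → refl)
level-inject₁ (inside  ∷ J) (suc j) = (λ { (there j∈) → proj₁ (level-inject₁ J j) j∈ })
  , (λ j∉ → proj₂ (level-inject₁ J j) (j∉ ∘ there))
level-inject₁ (outside ∷ J) (suc j) = (λ { (there j∈) → cong suc (proj₁ (level-inject₁ J j) j∈) })
  , (λ j∉ → cong suc (proj₂ (level-inject₁ J j) (j∉ ∘ there)))

weight-∈ : ∀ {n} (J : Subset n) i → i Subset.∈ J → weight J (reflected i) ≡ weight J (pos , i)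
weight-∈ (inside ∷ J) zero here = refl
weight-∈ {suc n} J (suc j) i∈J = trans (cong (weight J) (reflected-suc j)) (cong +_ (sym (proj₁ (level-inject₁ J j) i∈J)))

weight-∉ : ∀ {n} (J : Subset n) i → i Subset.∉ J → weight J (reflected i) ℤ.< weight J (pos , i)
weight-∉ (inside  ∷ J) zero i∉J = contradiction here i∉J
weight-∉ (outside ∷ J) zero i∉J = ℤ.-<+
weight-∉ {suc n} J (suc j) i∉J = subst₂ ℤ._<_ (cong (weight J) (sym (reflected-suc j)))
  (cong +_ (sym (proj₂ (level-inject₁ J j) i∉J))) (ℤ.+<+ (n<1+n _))

level-mono : ∀ {n} (J : Subset n) i k → toℕ i ≤ toℕ k → level J i ≤ level J k
level-mono (inside  ∷ J) zero    k       _         = z≤n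
level-mono (outside ∷ J) zero    zero    _         = ≤-refl
level-mono (outside ∷ J) zero    (suc k) _         = s≤s z≤n
level-mono (inside  ∷ J) (suc i) (suc k) (s≤s i≤k) = level-mono J i k i≤k
level-mono (outside ∷ J) (suc i) (suc k) (s≤s i≤k) = s≤s (level-mono J i k i≤k)

-- The dominant vector (1,...,n). Its strict order refines the order of every `weight J`.
regular : ∀ {n} → Vector n
regular (pos , i) = + suc (toℕ i)
regular (neg , i) = -[1+ toℕ i ]

regular-<⇒weight-≤ : ∀ {n} (J : Subset n) x y → regular x ℤ.< regular y → weight J x ℤ.≤ weight J y
regular-<⇒weight-≤ J (pos , i) (pos , k) (ℤ.+<+ (s≤s i<k)) = ℤ.+≤+ (level-mono J i k (<⇒≤ i<k))
regular-<⇒weight-≤ J (neg , i) (neg , k) (ℤ.-<- k<i) = ℤ.neg-mono-≤ (ℤ.+≤+ (level-mono J k i (<⇒≤ k<i)))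
regular-<⇒weight-≤ J (neg , i) (pos , k) _ = ℤ.≤-trans (ℤ.neg-mono-≤ (ℤ.+≤+ (z≤n {level J i}))) (ℤ.+≤+ z≤n)

-- Dominance makes w map 1,...,n to positive points in strictly increasing order. Inductions from
-- both ends then bound each image by its argument from below and from above.
dominant⇒identity : ∀ {n} (w : SignedPermutation n) → Dominant (regular ∘ to w) → ∀ x → to w x ≡ x
dominant⇒identity {zero}  w dominant (σ , ())
dominant⇒identity {suc n} w dominant = both
  where
  nonneg⇒pos : ∀ (x : Point (suc n)) → regular (negate x) ℤ.≤ regular x → proj₁ x ≡ pos
  nonneg⇒pos (pos , _) _ = refl
  nonneg⇒pos (neg , _) ()

  adjacent : ∀ j → regular (to w (pos , inject₁ j)) ℤ.≤ regular (to w (pos , suc j))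
  adjacent j = subst (λ x → regular (to w x) ℤ.≤ regular (to w (pos , suc j))) (reflected-suc j) (dominant (suc j))

  upward : ∀ (x y : Point (suc n)) → proj₁ x ≡ pos → regular x ℤ.≤ regular y → proj₁ y ≡ pos × toℕ (proj₂ x) ≤ toℕ (proj₂ y)
  upward (pos , i) (pos , k) _ (ℤ.+≤+ (s≤s i≤k)) = refl , i≤k

  allPos : ∀ i → proj₁ (to w (pos , i)) ≡ pos
  allPos = <-weakInduction (λ i → proj₁ (to w (pos , i)) ≡ pos)
    (nonneg⇒pos (to w (pos , zero)) (subst (λ x → regular x ℤ.≤ regular (to w (pos , zero))) (commutes w (pos , zero)) (dominant zero)))
    (λ j h → proj₁ (upward _ (to w (pos , suc j)) h (adjacent j)))

  g : Fin (suc n) → ℕ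
  g i = toℕ (proj₂ (to w (pos , i)))

  g-< : ∀ j → g (inject₁ j) < g (suc j)
  g-< j = ≤∧≢⇒< (proj₂ (upward _ _ (allPos (inject₁ j)) (adjacent j)))
    (λ eq → 1+n≢n (sym (trans (sym (Fin.toℕ-inject₁ j)) (cong (toℕ ∘ proj₂) (to-injective w
      (cong₂ _,_ (trans (allPos (inject₁ j)) (sym (allPos (suc j)))) (Fin.toℕ-injective eq)))))))

  lower : ∀ i → toℕ i ≤ g i
  lower = <-weakInduction (λ i → toℕ i ≤ g i) z≤n
    (λ j h → ≤-<-trans (subst (_≤ g (inject₁ j)) (Fin.toℕ-inject₁ j) h) (g-< j))

  upper : ∀ i → g i ≤ toℕ i
  upper = >-weakInduction (λ i → g i ≤ toℕ i)
    (≤-trans (Fin.toℕ≤pred[n] _) (≤-reflexive (sym (Fin.toℕ-fromℕ n))))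
    (λ j h → ≤-pred (≤-trans (g-< j) (≤-trans h (s≤s (≤-reflexive (sym (Fin.toℕ-inject₁ j)))))))

  onPos : ∀ i → to w (pos , i) ≡ (pos , i)
  onPos i = cong₂ _,_ (allPos i) (Fin.toℕ-injective (≤-antisym (upper i) (lower i)))

  both : ∀ x → to w x ≡ x
  both (pos , i) = onPos i
  both (neg , i) = trans (commutes w (pos , i)) (cong negate (onPos i))

-- Cosets of parabolic subgroups

module Action (n : ℕ) where
  open B n
  open Group (signedPermutationGroup n) public using (_≈_; _∙_; _⁻¹; ε)
  open RawMonoidDefinitions (Group.rawMonoid (signedPermutationGroup n)) public using () renaming (_×_ to power)

  W : Set
  W = SignedPermutation n

  power-iterate : ∀ m (u : W) x → to (power m u) x ≡ iterate u m x
  power-iterate zero    u x = refl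
  power-iterate (suc m) u x = cong (to u) (power-iterate m u x)

  reflect-odd : ∀ i (F : Vector n) → Odd F → F (reflected i) ≡ F (pos , i) → ∀ x → F (reflect i x) ≡ F x
  reflect-odd i F odd eq (pos , k) = reflect-invariant i F eq k
  reflect-odd i F odd eq (neg , k) = begin
    F (reflect i (neg , k))          ≡⟨ cong F (commutes (generator i) (pos , k)) ⟩
    F (negate (reflect i (pos , k))) ≡⟨ odd _ ⟩
    ℤ.- F (reflect i (pos , k))      ≡⟨ cong ℤ.-_ (reflect-invariant i F eq k) ⟩
    ℤ.- F (pos , k)                  ≡⟨ odd _ ⟨
    F (neg , k)                      ∎
    where open ≡-Reasoning

  generated-invariant : ∀ J (F : Vector n) → (∀ i → i Subset.∈ J → ∀ x → F (reflect i x) ≡ F x) →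
    ∀ {u} → ⟨ J ⟩ u → ∀ x → F (to u x) ≡ F x
  generated-invariant J F h (gen i∈J)          x = h _ i∈J x
  generated-invariant J F h unit               x = refl
  generated-invariant J F h (mult {v} {w} p q) x = trans (generated-invariant J F h p (to w x)) (generated-invariant J F h q x)
  generated-invariant J F h (inv {v} p)        x = trans (sym (generated-invariant J F h p (from v x))) (cong F (strictlyInverseˡ v x))
  generated-invariant J F h (resp v≈w p)       x = trans (cong F (sym (v≈w x))) (generated-invariant J F h p x)

  Stabilizes : Subset n → W → Set
  Stabilizes J w = ∀ x → weight J (to w x) ≡ weight J x

  parabolic⇒stabilizes : ∀ J {w} → ⟨ J ⟩ w → Stabilizes J w
  parabolic⇒stabilizes J = generated-invariant J (weight J)
    (λ i i∈J → reflect-odd i (weight J) (weight-odd J) (weight-∈ J i i∈J))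

  -- Sorting regular ∘ w only uses reflections in J, because regular refines weight J.
  stabilizes⇒parabolic : ∀ J w → Stabilizes J w → ⟨ J ⟩ w
  stabilizes⇒parabolic J w = go (sort (+ n) (regular ∘ to w) (regular≤n ∘ to w)) w (λ _ → refl)
    where
    regular≤n : ∀ x → regular x ℤ.≤ + n
    regular≤n (pos , i) = ℤ.+≤+ (Fin.toℕ<n i)
    regular≤n (neg , i) = ℤ.-≤+
    go : ∀ {F} → Sorts F → ∀ w → (∀ x → F x ≡ regular (to w x)) → Stabilizes J w → ⟨ J ⟩ w
    go (done dominant) w F≡ stable = resp
      (λ x → sym (dominant⇒identity w (λ i → subst₂ ℤ._≤_ (F≡ _) (F≡ _) (dominant i)) x)) unit
    go {F} (step i lt sorts) w F≡ stable with i ∈? J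
    ... | yes i∈J = resp (λ x → cong (to w) (strictlyInverseˡ (generator i) x))
      (mult (go sorts (w ∙ generator i) (λ x → F≡ (reflect i x))
        (λ x → trans (stable (reflect i x)) (parabolic⇒stabilizes J (gen i∈J) x))) (gen i∈J))
    -- At i outside J the weight has a strict step. As w stabilizes the weight, the step would
    -- persist at the images under w, whose order under `regular` is the opposite.
    ... | no i∉J = contradiction (weight-∉ J i i∉J) (ℤ.≤⇒≯ (subst₂ ℤ._≤_ (stable _) (stable _)
      (regular-<⇒weight-≤ J _ _ (subst₂ ℤ._<_ (F≡ _) (F≡ _) lt))))

  infix 4 _~[_]_

  _~[_]_ : W → Subset n → W → Set
  x ~[ J ] y = Setoid._≈_ (Cosets J) x y

  -- The coset x W_J corresponds to the vector x · weight J.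
  coset⇒vector : ∀ J x y → x ~[ J ] y → ∀ z → weight J (from x z) ≡ weight J (from y z)
  coset⇒vector J x y h z = trans (cong (weight J ∘ from x) (sym (strictlyInverseˡ y z)))
    (parabolic⇒stabilizes J h (from y z))

  vector⇒coset : ∀ J x y → (∀ z → weight J (from x z) ≡ weight J (from y z)) → x ~[ J ] y
  vector⇒coset J x y h = stabilizes⇒parabolic J (x ⁻¹ ∙ y)
    (λ z → trans (h (to y z)) (cong (weight J) (strictlyInverseʳ y z)))

  from-cong : ∀ {x y : W} → x ≈ y → ∀ z → from x z ≡ from y z
  from-cong {x} {y} = Group.⁻¹-cong (signedPermutationGroup n) {x} {y}

  ≈⇒coset : ∀ J {x y : W} → x ≈ y → x ~[ J ] y
  ≈⇒coset J {x} {y} x≈y = vector⇒coset J x y (λ z → cong (weight J) (from-cong {x} {y} x≈y z))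

  translate : ∀ J u {x y} → x ~[ J ] y → u ∙ x ~[ J ] u ∙ y
  translate J u {x} {y} = resp (λ z → cong (from x) (sym (strictlyInverseʳ u (to y z))))

  tail-product : ∀ j is → j ∉ is → ∀ (F : Vector n) →
    tail j (positive (F ∘ to (product is))) ≡ tail j (positive F)
  tail-product j []       j∉ F = refl
  tail-product j (i ∷ is) j∉ F = trans (tail-product j is (j∉ ∘ there) (F ∘ reflect i))
    (reflect-tail i j F (λ j≡i → j∉ (here j≡i)))

  -- The roots of distinct simple reflections are linearly independent, so a vector
  -- fixed by their product is fixed by each of them.
  product-invariant : ∀ is → Unique is → ∀ (F : Vector n) → (∀ x → F (to (product is) x) ≡ F x) →
    ∀ i → i ∈ is → ∀ x → F (reflect i x) ≡ F x
  product-invariant (j ∷ is) (j∉ ∷ unique) F h = λ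
    { i (here refl) → first
    ; i (there i∈)  → product-invariant is unique F (λ x → trans (sym (first _)) (h x)) i i∈ }
    where
    b = product is
    -- The product b omits the reflection j, hence does not affect the j-th coweight of G composed
    -- with that reflection. Since the whole product fixes G, the reflection alone leaves the j-th
    -- coweight unchanged, so the jump is zero.
    onPositive : ∀ (G : Vector n) → (∀ x → G (reflect j (to b x)) ≡ G x) → ∀ k → G (reflect j (pos , k)) ≡ G (pos , k)
    onPositive G h = reflect-invariant j G (sym (GroupProperties.∙-cancelˡ (AbelianGroup.group ℤ.+-0-abelianGroup) (tail j (positive G)) _ _
      (trans (cong (ℤ._+ G (pos , j)) (sym same)) (reflect-jump j G))))
      where
      same : tail j (positive (G ∘ reflect j)) ≡ tail j (positive G)
      same = trans (sym (tail-product j is (λ j∈ → All.lookup j∉ j∈ refl) (G ∘ reflect j)))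
        (tail-cong j (λ k → h (pos , k)))
    first : ∀ x → F (reflect j x) ≡ F x
    first (pos , k) = onPositive F h k
    -- Coweights see only the values at positive points. The others are reached through
    -- `F ∘ negate`, which the product fixes too, rather than through oddness of F: the result is
    -- also applied to the indicator of an orbit, which is even.
    first (neg , k) = trans (cong F (commutes (generator j) (pos , k)))
      (onPositive (F ∘ negate) (λ x → trans (cong F (sym (trans
        (cong (reflect j) (commutes b x)) (commutes (generator j) (to b x))))) (h (negate x))) k)

  coxeter-invariant : ∀ {K c} → IsCoxeterElement K c → ∀ (F : Vector n) → (∀ x → F (to c x) ≡ F x) →
    ∀ i → i Subset.∈ K → ∀ x → F (reflect i x) ≡ F x
  coxeter-invariant (is , unique , exhaust , c≈) F h i i∈K =
    product-invariant is unique F (λ x → trans (cong F (sym (c≈ x))) (h x)) i (Equivalence.from (exhaust i) i∈K)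

  coxeter-∈ : ∀ {K c} → IsCoxeterElement K c → ⟨ K ⟩ c
  coxeter-∈ {K} {c} (is , _ , exhaust , c≈) = resp {x = product is} (λ x → sym (c≈ x))
    (go is (λ i i∈ → Equivalence.to (exhaust i) i∈))
    where
    go : ∀ is → (∀ i → i ∈ is → i Subset.∈ K) → ⟨ K ⟩ (product is)
    go []       h = unit
    go (i ∷ is) h = mult (gen (h i (here refl))) (go is (λ i i∈ → h i (there i∈)))

  Fixed : Subset n → W → Setoid 0ℓ 0ℓ
  Fixed J u = Subsetoid (Cosets J) (λ x → u ∙ x ~[ J ] x)

  vector-fixed : ∀ J u x → u ∙ x ~[ J ] x → ∀ z → weight J (from x (to u z)) ≡ weight J (from x z)
  vector-fixed J u x h z = trans (sym (coset⇒vector J (u ∙ x) x h (to u z)))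
    (cong (weight J ∘ from x) (strictlyInverseʳ u z))

  fixed-vector : ∀ J u x → (∀ z → weight J (from x (to u z)) ≡ weight J (from x z)) → u ∙ x ~[ J ] x
  fixed-vector J u x h = vector⇒coset J (u ∙ x) x (λ z → trans (sym (h (from u z)))
    (cong (weight J ∘ from x) (strictlyInverseˡ u z)))

  isFixed⇔coxeter : ∀ J {K c} → IsCoxeterElement K c → ∀ x → IsFixed J K x ⇔ (c ∙ x ~[ J ] x)
  isFixed⇔coxeter J {K} {c} isCox x = mk⇔ (λ h → h c (coxeter-∈ {K} {c} isCox))
    (λ h u u∈K → fixed-vector J u x (generated-invariant K (weight J ∘ from x)
      (coxeter-invariant {K} {c} isCox (weight J ∘ from x) (vector-fixed J c x h)) u∈K))

  subset-inverse : ∀ (X : Setoid 0ℓ 0ℓ) {P Q : Setoid.Carrier X → Set} → (∀ x → P x → Q x) → (∀ x → Q x → P x) →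
    Inverse (Subsetoid X P) (Subsetoid X Q)
  subset-inverse X P⇒Q Q⇒P = record
    { to = λ (x , Px) → x , P⇒Q x Px ; from = λ (x , Qx) → x , Q⇒P x Qx
    ; to-cong = id ; from-cong = id ; inverse = id , id }

  fixedPoints↔fixed : ∀ J {K c} → IsCoxeterElement K c → Inverse (FixedPoints J K) (Fixed J c)
  fixedPoints↔fixed J {K} {c} isCox = subset-inverse (Cosets J)
    (λ x → Equivalence.to (isFixed⇔coxeter J {K} {c} isCox x)) (λ x → Equivalence.from (isFixed⇔coxeter J {K} {c} isCox x))

  -- W/W_J is the set of fixed points of the trivial parabolic subgroup, whose Coxeter element is
  -- the empty product.
  cosets-finite : ∀ J → ∃ (HasCardinality (Cosets J))
  cosets-finite J = β J ⊥ , Compose.inverse (Symmetry.inverse everything) (proj₂ (fixedPoints-finite J ⊥))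
    where
    fixed : ∀ x → IsFixed J ⊥ x
    fixed x = Equivalence.from (isFixed⇔coxeter J {c = ε} ([] , [] , (λ i → mk⇔ (λ ()) (λ i∈ → contradiction i∈ ∉⊥)) , λ _ → refl) x)
      (≈⇒coset J {ε ∙ x} {x} (λ _ → refl))
    everything : Inverse (FixedPoints J ⊥) (Cosets J)
    everything = record
      { to = proj₁ ; from = λ x → x , fixed x ; to-cong = id ; from-cong = id ; inverse = id , id }

  abstract
    fixed-finite : ∀ J u → ∃ (HasCardinality (Fixed J u))
    fixed-finite J u = _ , subset-cardinality (Cosets J) (proj₂ (cosets-finite J)) (λ x → u ∙ x ~[ J ] x)
      (λ {x} {y} x~y h → C.trans {u ∙ y} {u ∙ x} {y} (C.sym {u ∙ x} {u ∙ y} (translate J u {x} {y} x~y))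
        (C.trans {u ∙ x} {x} {y} h x~y))
      (λ x → ⟨ J ⟩? ((u ∙ x) ⁻¹ ∙ x))
      where module C = Setoid (Cosets J)

  -- The mark extended from Coxeter elements to all of W, since the regular part of a Coxeter
  -- element need not be one.
  fixCount : Subset n → W → ℕ
  fixCount J u = proj₁ (fixed-finite J u)

  fixCount-unique : ∀ J u {X m} → HasCardinality X m → Inverse X (Fixed J u) → m ≡ fixCount J u
  fixCount-unique J u hX = cardinality-unique hX (proj₂ (fixed-finite J u))

  β≡fixCount : ∀ J {K c} → IsCoxeterElement K c → β J K ≡ fixCount J c
  β≡fixCount J {K} {c} isCox = fixCount-unique J c (proj₂ (fixedPoints-finite J K)) (fixedPoints↔fixed J {K} {c} isCox)

  fixCount-conjugate : ∀ J {x y} → Conjugate x y → fixCount J x ≡ fixCount J y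
  fixCount-conjugate J {x} {y} (g , gxg⁻¹≈y) = fixCount-unique J y (proj₂ (fixed-finite J x)) record
    { to        = λ (z , h) → g ∙ z , C.trans {y ∙ (g ∙ z)} {g ∙ (x ∙ z)} {g ∙ z}
        (≈⇒coset J {y ∙ (g ∙ z)} {g ∙ (x ∙ z)} (λ w → trans (sym (gxg⁻¹≈y (to g (to z w))))
          (cong (to g ∘ to x) (strictlyInverseʳ g (to z w)))))
        (translate J g {x ∙ z} {z} h)
    ; from      = λ (z , h) → g ⁻¹ ∙ z , C.trans {x ∙ (g ⁻¹ ∙ z)} {g ⁻¹ ∙ (y ∙ z)} {g ⁻¹ ∙ z}
        (≈⇒coset J {x ∙ (g ⁻¹ ∙ z)} {g ⁻¹ ∙ (y ∙ z)} (λ w → trans (sym (strictlyInverseʳ g _)) (cong (from g) (gxg⁻¹≈y (to z w)))))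
        (translate J (g ⁻¹) {y ∙ z} {z} h)
    ; to-cong   = λ { {z , _} {z′ , _} → translate J g {z} {z′} }
    ; from-cong = λ { {z , _} {z′ , _} → translate J (g ⁻¹) {z} {z′} }
    ; inverse   = (λ { {z , _} {z′ , _} z′~ → C.trans {g ∙ z′} {g ∙ (g ⁻¹ ∙ z)} {z} (translate J g {z′} {g ⁻¹ ∙ z} z′~)
                    (≈⇒coset J {g ∙ (g ⁻¹ ∙ z)} {z} (λ w → strictlyInverseˡ g (to z w))) })
                , (λ { {z , _} {z′ , _} z′~ → C.trans {g ⁻¹ ∙ z′} {g ⁻¹ ∙ (g ∙ z)} {z} (translate J (g ⁻¹) {z′} {g ∙ z} z′~)
                    (≈⇒coset J {g ⁻¹ ∙ (g ∙ z)} {z} (λ w → strictlyInverseʳ g (to z w))) })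
    }
    where module C = Setoid (Cosets J)

  conjugateSubsets-sym : ∀ {J K} → ConjugateSubsets J K → ConjugateSubsets K J
  conjugateSubsets-sym (w , f , g) = w ⁻¹ , half g , half′ f
    where
    back : ∀ {s t : W} → w ∙ s ∙ w ⁻¹ ≈ t → w ⁻¹ ∙ t ∙ w ⁻¹ ⁻¹ ≈ s
    back {s} {t} eq x = trans (cong (from w) (sym (eq (to w x))))
      (trans (strictlyInverseʳ w _) (cong (to s) (strictlyInverseʳ w x)))
    half : ∀ {J K} → (∀ k → k Subset.∈ K → ∃ λ i → i Subset.∈ J × w ∙ generator i ∙ w ⁻¹ ≈ generator k) →
      (∀ k → k Subset.∈ K → ∃ λ i → i Subset.∈ J × w ⁻¹ ∙ generator k ∙ w ⁻¹ ⁻¹ ≈ generator i)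
    half g k k∈ with i , i∈ , eq ← g k k∈ = i , i∈ , back {generator i} {generator k} eq
    half′ : ∀ {J K} → (∀ i → i Subset.∈ J → ∃ λ k → k Subset.∈ K × w ∙ generator i ∙ w ⁻¹ ≈ generator k) →
      (∀ i → i Subset.∈ J → ∃ λ k → k Subset.∈ K × w ⁻¹ ∙ generator k ∙ w ⁻¹ ⁻¹ ≈ generator i)
    half′ f i i∈ with k , k∈ , eq ← f i i∈ = k , k∈ , back {generator i} {generator k} eq

  conjugate-generated : ∀ {J K w} → (∀ i → i Subset.∈ J → ∃ λ k → k Subset.∈ K × w ∙ generator i ∙ w ⁻¹ ≈ generator k) →
    ∀ {u} → ⟨ J ⟩ u → ⟨ K ⟩ (w ∙ u ∙ w ⁻¹)
  conjugate-generated {w = w} f (gen {i} i∈J) with k , k∈ , eq ← f i i∈J = resp (λ x → sym (eq x)) (gen k∈)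
  conjugate-generated {w = w} f unit = resp (λ x → sym (strictlyInverseˡ w x)) unit
  conjugate-generated {w = w} f (mult {u} {v} p q) = resp
    (λ x → cong (to w ∘ to u) (strictlyInverseʳ w _))
    (mult (conjugate-generated {w = w} f p) (conjugate-generated {w = w} f q))
  conjugate-generated {w = w} f (inv {u} p) = resp (λ x → refl) (inv (conjugate-generated {w = w} f p))
  conjugate-generated {w = w} f (resp {u} {v} u≈v p) = resp (λ x → cong (to w) (u≈v (from w x))) (conjugate-generated {w = w} f p)

  -- Right multiplication by w⁻¹ carries W/W_J to W/W_K and commutes with the action of u from the
  -- left. Thus marks can be evaluated at subsets outside the chosen set of representatives.
  fixCount-conjugateSubsets : ∀ {J K} → ConjugateSubsets J K → ∀ u → fixCount J u ≡ fixCount K u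
  fixCount-conjugateSubsets {J} {K} conj@(w , f , _) u = fixCount-unique K u (proj₂ (fixed-finite J u)) record
    { to        = λ (x , h) → x ∙ w ⁻¹ ,
        resp {x = (u ∙ x ∙ w ⁻¹) ⁻¹ ∙ (x ∙ w ⁻¹)} (λ _ → refl) (right {u ∙ x} {x} h)
    ; from      = λ (x , h) → x ∙ w ,
        resp {x = (u ∙ x ∙ w) ⁻¹ ∙ (x ∙ w)} (λ _ → refl) (left {u ∙ x} {x} h)
    ; to-cong   = λ { {x , _} {y , _} → right {x} {y} }
    ; from-cong = λ { {x , _} {y , _} → left {x} {y} }
    ; inverse   = (λ { {x , _} {y , _} h → Setoid.trans (Cosets K) {y ∙ w ⁻¹} {x ∙ w ∙ w ⁻¹} {x} (right {y} {x ∙ w} h)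
                    (≈⇒coset K {x ∙ w ∙ w ⁻¹} {x} (λ z → cong (to x) (strictlyInverseˡ w z))) })
                , (λ { {x , _} {y , _} h → Setoid.trans (Cosets J) {y ∙ w} {x ∙ w ⁻¹ ∙ w} {x} (left {y} {x ∙ w ⁻¹} h)
                    (≈⇒coset J {x ∙ w ⁻¹ ∙ w} {x} (λ z → cong (to x) (strictlyInverseʳ w z))) })
    }
    where
    right : ∀ {x y} → x ~[ J ] y → x ∙ w ⁻¹ ~[ K ] y ∙ w ⁻¹
    right {x} {y} h = resp {x = w ∙ (x ⁻¹ ∙ y) ∙ w ⁻¹} (λ _ → refl) (conjugate-generated {w = w} f h)
    left : ∀ {x y} → x ~[ K ] y → x ∙ w ~[ J ] y ∙ w
    left {x} {y} h = resp {x = w ⁻¹ ∙ (x ⁻¹ ∙ y) ∙ w ⁻¹ ⁻¹} (λ _ → refl)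
      (conjugate-generated {w = w ⁻¹} (proj₁ (proj₂ (conjugateSubsets-sym conj))) h)

-- Regular parts

mod-scale : ∀ {m a b} q → a ≡ b [mod m ] → q * a ≡ q * b [mod q * m ]
mod-scale {m} {a} {b} q (mod-by x y e) = mod-by x y (trans (factored q a x m) (trans (cong (q *_) e) (sym (factored q b y m))))
  where
  factored : ∀ q a x m → q * a + x * (q * m) ≡ q * (a + x * m)
  factored = solve-∀

module RegularPart (n : ℕ) where
  open B n
  open Action n

  Periodic : W → ℕ → Set
  Periodic u m = ∀ x → iterate u m x ≡ x

  module _ (u : W) where
    open Cycles u

    periodic-* : ∀ m q → Periodic u m → Periodic u (q * m)
    periodic-* m zero    h x = refl
    periodic-* m (suc q) h x = trans (it-+ m (q * m) x) (trans (h _) (periodic-* m q h x))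

    iterate-mod : ∀ {m a b} → Periodic u m → a ≡ b [mod m ] → ∀ x → it a x ≡ it b x
    iterate-mod {m} {a} {b} h (mod-by y z eq) x = begin
      it a x                 ≡⟨ cong (it a) (periodic-* m y h x) ⟨
      it a (it (y * m) x)    ≡⟨ it-+ a (y * m) x ⟨
      it (a + y * m) x       ≡⟨ cong (λ k → it k x) eq ⟩
      it (b + z * m) x       ≡⟨ it-+ b (z * m) x ⟩
      it b (it (z * m) x)    ≡⟨ cong (it b) (periodic-* m z h x) ⟩
      it b x                 ∎
      where open ≡-Reasoning

    iterate-power : ∀ e j x → iterate (power e u) j x ≡ it (j * e) x
    iterate-power e zero    x = refl
    iterate-power e (suc j) x = begin
      to (power e u) (iterate (power e u) j x)   ≡⟨ power-iterate e u _ ⟩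
      it e (iterate (power e u) j x)             ≡⟨ cong (it e) (iterate-power e j x) ⟩
      it e (it (j * e) x)                        ≡⟨ it-+ e (j * e) x ⟨
      it (e + j * e) x                           ∎
      where open ≡-Reasoning

    periodic? : ∀ m → Dec (Periodic u m)
    periodic? m = map′ extend (λ h i → h (pos , i))
      (Fin.all? (λ i → Product.≡-dec Sign._≟_ Fin._≟_ (it m (pos , i)) (pos , i)))
      where
      extend : (∀ i → it m (pos , i) ≡ (pos , i)) → Periodic u m
      extend h (pos , i) = h i
      extend h (neg , i) = trans (it-· m neg (pos , i)) (cong negate (h i))

    -- Twice the size is a genuine period of a point, and the product of these numbers over all axes
    -- is a common one.
    somePeriod : ∃ λ k → Periodic u (suc k)
    somePeriod = pred (proj₁ common) ,
      λ { (pos , i) → positivePeriod i ; (neg , i) → trans (it-· (suc (pred (proj₁ common))) neg (pos , i)) (cong negate (positivePeriod i)) }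
      where
      double : ∀ x → it (2 * size x) x ≡ x
      double x = begin
        it (2 * size x) x              ≡⟨ cong (λ k → it k x) (cong (λ l → size x + l) (+-identityʳ (size x))) ⟩
        it (size x + size x) x         ≡⟨ it-+ (size x) (size x) x ⟩
        it (size x) (it (size x) x)    ≡⟨ cong (it (size x)) (closes x) ⟩
        it (size x) (sign x · x)       ≡⟨ it-· (size x) (sign x) x ⟩
        sign x · it (size x) x         ≡⟨ cong (sign x ·_) (closes x) ⟩
        sign x · sign x · x            ≡⟨ ·-cancel (sign x) x ⟩
        x                              ∎
        where open ≡-Reasoning
      multiple : ∀ q k x → it k x ≡ x → it (q * k) x ≡ x
      multiple zero    k x h = refl
      multiple (suc q) k x h = trans (it-+ k (q * k) x) (trans (cong (it k) (multiple q k x h)) h)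
      go : ∀ is → ∃ λ N → 0 < N × ∀ i → i ∈ is → it N (pos , i) ≡ (pos , i)
      go []       = 1 , z<s , λ _ ()
      go (i ∷ is) with N , 0<N , h ← go is = (2 * size (pos , i)) * N , *-mono-≤ (z<s {2 * size (pos , i) ∸ 1}) 0<N , λ
        { j (here refl) → trans (cong (λ k → it k (pos , i)) (*-comm (2 * size (pos , i)) N)) (multiple N (2 * size (pos , i)) (pos , i) (double (pos , i)))
        ; j (there j∈)  → multiple (2 * size (pos , i)) N (pos , j) (h j j∈) }
      common = go (allFin n)
      positivePeriod : ∀ i → it (suc (pred (proj₁ common))) (pos , i) ≡ (pos , i)
      positivePeriod i = trans (cong (λ k → it k (pos , i)) (suc-pred (proj₁ common) {{>-nonZero (proj₁ (proj₂ common))}}))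
        (proj₂ (proj₂ common) i (List.∈-allFin i))

    order : ∃ (HasOrder u)
    order with k , h ← somePeriod with m , period , smallest ← least (λ j → periodic? (suc j)) k h =
      suc m , s≤s z≤n , (λ x → trans (power-iterate (suc m) u x) (period x))
      , λ { (suc j) _ h → ≮⇒≥ (λ { (s≤s j<m) → smallest j j<m (λ x → trans (sym (power-iterate (suc j) u x)) (h x)) }) }

    hasOrder⇒periodic : ∀ {m} → HasOrder u m → Periodic u m
    hasOrder⇒periodic {m} (_ , h , _) x = trans (sym (power-iterate m u x)) (h x)

    order-∣ : ∀ {m j} → HasOrder u m → Periodic u j → m ∣ j
    order-∣ {suc m} {j} o@(_ , _ , smallest) h with j % suc m in r≡
    ... | zero  = m%n≡0⇒n∣m j (suc m) r≡
    ... | suc r = contradiction (smallest (suc r) z<s (λ x → trans (power-iterate (suc r) u x) (begin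
        it (suc r) x   ≡⟨ iterate-mod (hasOrder⇒periodic o) (mod-by (j / suc m) 0 (trans
                            (trans (cong (_+ j / suc m * suc m) (sym r≡)) (sym (m≡m%n+[m/n]*n j (suc m)))) (sym (+-identityʳ j)))) x ⟩
        it j x         ≡⟨ h x ⟩
        x              ∎)))
      (<⇒≱ (subst (_< suc m) r≡ (m%n<n j (suc m))))
      where open ≡-Reasoning

  module _ {p} (p-prime : Prime p) where
    open PrimeFactor p-prime

    -- The order of w is N = qm with q = pᵏ and p not dividing m. The exponent E = aq is 0 modulo q
    -- and, by the choice of a, 1 modulo m; so the power with exponent E keeps the prime-to-p part
    -- of w, and the power with exponent 1 - E its p-part.
    regularPart : ∀ w → ∃ (IsPRegularPart p w)
    regularPart w with N , N-order ← order w
      with k , m , N≡ , p∤m ← factor N (proj₁ N-order)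
      with a , aq≡1 ← inverse-mod (p ^ k) m (n≢0⇒n>0 (λ { refl → p∤m (divides 0 refl) })) (Coprimality.sym (coprime-^ (∤⇒coprime p∤m) k)) =
      power E w , power f w , product-is-w E f refl , product-is-w f E (+-comm f E)
      , (m′ , order-m′ , λ { (d∣m′ , d∣p) → ∤⇒coprime p∤m (∣-trans d∣m′ m′∣m , d∣p) })
      , (proj₁ q′-power , subst (HasOrder (power f w)) (proj₂ q′-power) order-q′)
      where
      q = p ^ k
      E = a * q
      -- This is 1 - E modulo N, with N - 1 in the role of -1.
      f = 1 + pred N * E
      N-periodic : Periodic w N
      N-periodic = hasOrder⇒periodic w N-order
      1+N-1 : suc (pred N) ≡ N
      1+N-1 = suc-pred N {{>-nonZero (proj₁ N-order)}}
      product-is-w : ∀ i j → i + j ≡ E + f → w ≈ power i w ∙ power j w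
      product-is-w i j i+j≡ x = sym (begin
        to (power i w) (to (power j w) x)  ≡⟨ power-iterate i w _ ⟩
        iterate w i (to (power j w) x)     ≡⟨ cong (iterate w i) (power-iterate j w x) ⟩
        iterate w i (iterate w j x)        ≡⟨ Cycles.it-+ w i j x ⟨
        iterate w (i + j) x                ≡⟨ iterate-mod w N-periodic (mod-by 0 E (trans (+-identityʳ (i + j)) (trans i+j≡
                                                (trans (exponents E (pred N)) (cong (λ l → 1 + E * l) 1+N-1))))) x ⟩
        iterate w 1 x                      ∎)
        where
        open ≡-Reasoning
        exponents : ∀ E l → E + (1 + l * E) ≡ 1 + E * (1 + l)
        exponents = solve-∀
      periodic-power : ∀ i j → j * i ≡ 0 [mod N ] → Periodic (power i w) j
      periodic-power i j h x = trans (iterate-power w i j x) (iterate-mod w N-periodic h x)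
      m*E≡0 : m * E ≡ 0 [mod N ]
      m*E≡0 = ∣⇒mod-0 (divides a (trans (regroup m a q) (cong (a *_) (sym N≡))))
        where
        regroup : ∀ m a q → m * (a * q) ≡ a * (q * m)
        regroup = solve-∀
      q*f≡0 : q * f ≡ 0 [mod N ]
      q*f≡0 = mod-trans (mod-reflexive (expand q (pred N) E))
        (mod-trans (mod-+ (mod-reflexive refl) (mod-*ˡ (pred N)
            (subst (λ l → q * E ≡ q * 1 [mod l ]) (sym N≡) (mod-scale q aq≡1))))
          (mod-trans (mod-reflexive (collect q (pred N))) (∣⇒mod-0 (divides q (cong (q *_) 1+N-1)))))
        where
        expand : ∀ q l E → q * (1 + l * E) ≡ q + l * (q * E)
        expand = solve-∀
        collect : ∀ q l → q + l * (q * 1) ≡ q * (1 + l)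
        collect = solve-∀
      m′ = proj₁ (order (power E w))
      order-m′ = proj₂ (order (power E w))
      m′∣m : m′ ∣ m
      m′∣m = order-∣ (power E w) order-m′ (periodic-power E m m*E≡0)
      q′ = proj₁ (order (power f w))
      order-q′ = proj₂ (order (power f w))
      q′-power : ∃ λ b → q′ ≡ p ^ b
      q′-power = ∣p^⇒≡p^ k (order-∣ (power f w) order-q′ (periodic-power f q q*f≡0))

    -- The cycles are compared in both directions: w′ is a power of w, and some power of p is an
    -- exponent at which w and w′ agree. The period makes the cycle lengths of w′ prime to p.
    record RegularRelation (w w′ : W) : Set where
      field
        exponent       : ℕ
        is-power       : ∀ x → to w′ x ≡ iterate w exponent x
        height         : ℕ
        same-power     : ∀ x → iterate w (p ^ height) x ≡ iterate w′ (p ^ height) x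
        period         : ℕ
        periodic       : Periodic w′ period
        period-coprime : Coprime period p

    -- The two factors commute, so powers of w split. At exponent q the p-part disappears, and a
    -- further exponent a with aq = 1 modulo the order of w′ recovers w′.
    regularRelation : ∀ {w w′} → IsPRegularPart p w w′ → RegularRelation w w′
    regularRelation {w} {w′} (w″ , w≈w′w″ , w≈w″w′ , (m , order-m , m⊥p) , (k , order-q)) = record
      { exponent = a * q ; is-power = is-power′ ; height = k ; same-power = same-power′
      ; period = m ; periodic = hasOrder⇒periodic w′ order-m ; period-coprime = m⊥p }
      where
      q = p ^ k
      inverse′ : ∃ λ a → a * q ≡ 1 [mod m ]
      inverse′ = inverse-mod q m (proj₁ order-m) (Coprimality.sym (coprime-^ m⊥p k))
      a = proj₁ inverse′
      commute : ∀ j x → iterate w′ j (to w″ x) ≡ to w″ (iterate w′ j x)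
      commute zero    x = refl
      commute (suc j) x = trans (cong (to w′) (commute j x)) (trans (sym (w≈w′w″ _)) (w≈w″w′ _))
      split : ∀ j x → iterate w j x ≡ iterate w′ j (iterate w″ j x)
      split zero    x = refl
      split (suc j) x = begin
        to w (iterate w j x)                              ≡⟨ cong (to w) (split j x) ⟩
        to w (iterate w′ j (iterate w″ j x))              ≡⟨ w≈w′w″ _ ⟩
        to w′ (to w″ (iterate w′ j (iterate w″ j x)))     ≡⟨ cong (to w′) (commute j _) ⟨
        to w′ (iterate w′ j (to w″ (iterate w″ j x)))     ∎
        where open ≡-Reasoning
      same-power′ : ∀ x → iterate w q x ≡ iterate w′ q x
      same-power′ x = trans (split q x) (cong (iterate w′ q) (hasOrder⇒periodic w″ order-q x))
      is-power′ : ∀ x → to w′ x ≡ iterate w (a * q) x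
      is-power′ x = sym (begin
        iterate w (a * q) x                            ≡⟨ split (a * q) x ⟩
        iterate w′ (a * q) (iterate w″ (a * q) x)      ≡⟨ cong (iterate w′ (a * q)) (periodic-* w″ q a (hasOrder⇒periodic w″ order-q) x) ⟩
        iterate w′ (a * q) x                           ≡⟨ iterate-mod w′ (hasOrder⇒periodic w′ order-m) (proj₂ inverse′) x ⟩
        iterate w′ 1 x                                 ∎)
        where open ≡-Reasoning

    -- The p-part w″ commutes with w′ and so permutes the fixed points of w′. Those that it fixes
    -- are the fixed points of w: one inclusion holds because w = w″w′, the other because w′ is a
    -- power of w.
    fixCount-regular : ∀ J {w w′} → IsPRegularPart p w w′ → fixCount J w′ ≡ fixCount J w [mod p ]
    fixCount-regular J {w} {w′} regular@(w″ , w≈w′w″ , w≈w″w′ , _ , (k , order-q)) =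
      fixedPoints-mod (Fixed J w′) (proj₂ (fixed-finite J w′)) p-prime k act
        (λ { {x , _} {y , _} → translate J w″ {x} {y} }) act-periodic
        (Compose.inverse (Symmetry.inverse both↔fixed) (proj₂ (fixed-finite J w)))
      where
      module C = Setoid (Cosets J)
      act : Σ W (λ x → w′ ∙ x ~[ J ] x) → Σ W (λ x → w′ ∙ x ~[ J ] x)
      act (x , h) = w″ ∙ x , C.trans {w′ ∙ (w″ ∙ x)} {w″ ∙ (w′ ∙ x)} {w″ ∙ x}
        (≈⇒coset J {w′ ∙ (w″ ∙ x)} {w″ ∙ (w′ ∙ x)} (λ z → trans (sym (w≈w′w″ _)) (w≈w″w′ _)))
        (translate J w″ {w′ ∙ x} {x} h)
      to-fold : ∀ j xh z → to (proj₁ (fold act j xh)) z ≡ iterate w″ j (to (proj₁ xh) z)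
      to-fold zero    xh z = refl
      to-fold (suc j) xh z = cong (to w″) (to-fold j xh z)
      act-periodic : ∀ xh → proj₁ (fold act (p ^ k) xh) ~[ J ] proj₁ xh
      act-periodic xh = ≈⇒coset J {proj₁ (fold act (p ^ k) xh)} {proj₁ xh}
        (λ z → trans (to-fold (p ^ k) xh z) (hasOrder⇒periodic w″ order-q _))
      open RegularRelation (regularRelation regular)
      fixed-iterate : ∀ {x} → w ∙ x ~[ J ] x → ∀ j → power j w ∙ x ~[ J ] x
      fixed-iterate {x} h zero    = ≈⇒coset J {ε ∙ x} {x} (λ _ → refl)
      fixed-iterate {x} h (suc j) = C.trans {w ∙ power j w ∙ x} {w ∙ (power j w ∙ x)} {x}
        (≈⇒coset J {w ∙ power j w ∙ x} {w ∙ (power j w ∙ x)} (λ _ → refl))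
        (C.trans {w ∙ (power j w ∙ x)} {w ∙ x} {x} (translate J w {power j w ∙ x} {x} (fixed-iterate {x} h j)) h)
      fixed-regular : ∀ {x} → w ∙ x ~[ J ] x → w′ ∙ x ~[ J ] x
      fixed-regular {x} h = C.trans {w′ ∙ x} {power exponent w ∙ x} {x}
        (≈⇒coset J {w′ ∙ x} {power exponent w ∙ x} (λ z → trans (is-power _) (sym (power-iterate exponent w _))))
        (fixed-iterate {x} h exponent)
      w″≈ : ∀ {x} → w′ ∙ x ~[ J ] x → w ∙ x ~[ J ] w″ ∙ x
      w″≈ {x} h = C.trans {w ∙ x} {w″ ∙ (w′ ∙ x)} {w″ ∙ x}
        (≈⇒coset J {w ∙ x} {w″ ∙ (w′ ∙ x)} (λ z → w≈w″w′ _)) (translate J w″ {w′ ∙ x} {x} h)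
      both↔fixed : Inverse (Fixed J w) (Subsetoid (Fixed J w′) (λ xh → w″ ∙ proj₁ xh ~[ J ] proj₁ xh))
      both↔fixed = record
        { to = λ (x , h) → (x , fixed-regular {x} h) , C.trans {w″ ∙ x} {w ∙ x} {x} (C.sym {w ∙ x} {w″ ∙ x} (w″≈ {x} (fixed-regular {x} h))) h
        ; from = λ ((x , h′) , h″) → x , C.trans {w ∙ x} {w″ ∙ x} {x} (w″≈ {x} h′) h″
        ; to-cong = id ; from-cong = id ; inverse = id , id }

-- Fixed {0,±1}-vectors

t^-shifted : ∀ k f s → (t^ k · f) (k + s) ≡ f s
t^-shifted zero    f s = refl
t^-shifted (suc k) f s = t^-shifted k f s

series-degree : ∀ A t → sum A < t → series A t ≡ 0
series-degree []      (suc t) _ = refl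
series-degree (k ∷ A) t       A<t with s , refl ← m≤n⇒∃[o]m+o≡n (≤-trans (m≤m+n k (sum A)) (<⇒≤ A<t)) =
  cong₂ (λ a b → a + 2 * b) (series-degree A (k + s) (<-≤-trans A<s (m≤n+m s k)))
    (trans (t^-shifted k (series A) s) (series-degree A s A<s))
  where
  A<s : sum A < s
  A<s = +-cancelˡ-< k (sum A) s A<t

module _ {A : Set} where

  shiftBy-length : ∀ k (f : ℕ → List A) t → length (shiftBy [] k f t) ≡ (t^ k · (length ∘ f)) t
  shiftBy-length zero    f t       = refl
  shiftBy-length (suc k) f zero    = refl
  shiftBy-length (suc k) f (suc t) = shiftBy-length k f t

  shiftBy-All : ∀ {P : List A → Set} → P [] → ∀ k {f} → (∀ t → P (f t)) → ∀ t → P (shiftBy [] k f t)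
  shiftBy-All P[] zero    h t       = h t
  shiftBy-All P[] (suc k) h zero    = P[]
  shiftBy-All {P} P[] (suc k) h (suc t) = shiftBy-All {P} P[] k h t

  ∈-shiftBy⁻ : ∀ k (f : ℕ → List A) t {a} → a ∈ shiftBy [] k f t → ∃ λ s → t ≡ k + s × a ∈ f s
  ∈-shiftBy⁻ zero    f t       a∈ = t , refl , a∈
  ∈-shiftBy⁻ (suc k) f (suc t) a∈ with s , refl , a∈′ ← ∈-shiftBy⁻ k f t a∈ = s , refl , a∈′

  ∈-shiftBy⁺ : ∀ k (f : ℕ → List A) s {a} → a ∈ f s → a ∈ shiftBy [] k f (k + s)
  ∈-shiftBy⁺ zero    f s a∈ = a∈
  ∈-shiftBy⁺ (suc k) f s a∈ = ∈-shiftBy⁺ k f s a∈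

CycleType : Set
CycleType = List (ℕ × Sign)

positives : CycleType → List ℕ
positives []              = []
positives ((k , pos) ∷ T) = k ∷ positives T
positives ((k , neg) ∷ T) = positives T

negatives : CycleType → List ℕ
negatives []              = []
negatives ((k , pos) ∷ T) = negatives T
negatives ((k , neg) ∷ T) = k ∷ negatives T

-- The values of a {0,±1}-vector fixed by a signed permutation are constant along
-- the cycles, and vanish on the negative ones; t is the size of its support.
data Admits : CycleType → List ℤ → ℕ → Set where
  []    : Admits [] [] 0
  zero  : ∀ {k σ T z t} → Admits T z t → Admits ((k , σ) ∷ T) (+ 0 ∷ z) t
  plus  : ∀ {k T z t} → Admits T z t → Admits ((k , pos) ∷ T) (+ 1 ∷ z) (k + t)
  minus : ∀ {k T z t} → Admits T z t → Admits ((k , pos) ∷ T) (-[1+ 0 ] ∷ z) (k + t)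

assignments : CycleType → ℕ → List (List ℤ)
assignments []              zero    = [] ∷ []
assignments []              (suc t) = []
assignments ((k , neg) ∷ T) t       = map (+ 0 ∷_) (assignments T t)
assignments ((k , pos) ∷ T) t       = map (+ 0 ∷_) (assignments T t)
  ++ map (+ 1 ∷_) (shiftBy [] k (assignments T) t) ++ map (-[1+ 0 ] ∷_) (shiftBy [] k (assignments T) t)

length-assignments : ∀ T t → length (assignments T t) ≡ series (positives T) t
length-assignments []              zero    = refl
length-assignments []              (suc t) = refl
length-assignments ((k , neg) ∷ T) t = trans (length-map (+ 0 ∷_) (assignments T t)) (length-assignments T t)
length-assignments ((k , pos) ∷ T) t = begin
  length (map (+ 0 ∷_) X ++ map (+ 1 ∷_) Y ++ map (-[1+ 0 ] ∷_) Y)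
    ≡⟨ length-++ (map (+ 0 ∷_) X) ⟩
  length (map (+ 0 ∷_) X) + length (map (+ 1 ∷_) Y ++ map (-[1+ 0 ] ∷_) Y)
    ≡⟨ cong₂ _+_ (length-map _ X) (trans (length-++ (map (+ 1 ∷_) Y)) (cong₂ _+_ (length-map _ Y) (length-map _ Y))) ⟩
  length X + (length Y + length Y)
    ≡⟨ cong (λ l → length X + (length Y + l)) (+-identityʳ (length Y)) ⟨
  length X + 2 * length Y
    ≡⟨ cong₂ (λ a b → a + 2 * b) (length-assignments T t)
         (trans (shiftBy-length k (assignments T) t) (t^-cong k (length-assignments T) t)) ⟩
  series (k ∷ positives T) t ∎
  where
  open ≡-Reasoning
  X = assignments T t
  Y = shiftBy [] k (assignments T) t

unique-assignments : ∀ T t → Unique (assignments T t)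
unique-assignments []              zero    = [] ∷ []
unique-assignments []              (suc t) = []
unique-assignments ((k , neg) ∷ T) t = Unique.map⁺ ∷-injectiveʳ (unique-assignments T t)
unique-assignments ((k , pos) ∷ T) t = Unique.++⁺ (Unique.map⁺ ∷-injectiveʳ (unique-assignments T t))
  (Unique.++⁺ (Unique.map⁺ ∷-injectiveʳ shifted) (Unique.map⁺ ∷-injectiveʳ shifted)
    (λ { (p , q) → 1≢-1 (heads p q) }))
  (λ { (p , q) → headsOf0 p (List.∈-++⁻ (map (+ 1 ∷_) Y) q) })
  where
  Y = shiftBy [] k (assignments T) t
  shifted : Unique Y
  shifted = shiftBy-All {P = Unique} [] k (unique-assignments T) t
  heads : ∀ {a b : ℤ} {X Y : List (List ℤ)} {z} → z ∈ map (a ∷_) X → z ∈ map (b ∷_) Y → a ≡ b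
  heads {a} {b} p q with _ , _ , refl ← List.∈-map⁻ (a ∷_) p | _ , _ , eq ← List.∈-map⁻ (b ∷_) q = ∷-injectiveˡ eq
  1≢-1 : + 1 ≢ -[1+ 0 ]
  1≢-1 ()
  headsOf0 : ∀ {X : List (List ℤ)} {z} → z ∈ map (+ 0 ∷_) X → ¬ (z ∈ map (+ 1 ∷_) Y ⊎ z ∈ map (-[1+ 0 ] ∷_) Y)
  headsOf0 p (inj₁ q) with () ← heads p q
  headsOf0 p (inj₂ q) with () ← heads p q

∈-assignments⁺ : ∀ {T z t} → Admits T z t → z ∈ assignments T t
∈-assignments⁺ []                                     = here refl
∈-assignments⁺ {(k , neg) ∷ T} (zero h)               = List.∈-map⁺ (+ 0 ∷_) (∈-assignments⁺ h)
∈-assignments⁺ {(k , pos) ∷ T} (zero h)               = List.∈-++⁺ˡ (List.∈-map⁺ (+ 0 ∷_) (∈-assignments⁺ h))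
∈-assignments⁺ {(k , pos) ∷ T} (plus {t = t} h)       = List.∈-++⁺ʳ (map (+ 0 ∷_) (assignments T (k + t)))
  (List.∈-++⁺ˡ (List.∈-map⁺ (+ 1 ∷_) (∈-shiftBy⁺ k (assignments T) t (∈-assignments⁺ h))))
∈-assignments⁺ {(k , pos) ∷ T} (minus {t = t} h)      = List.∈-++⁺ʳ (map (+ 0 ∷_) (assignments T (k + t)))
  (List.∈-++⁺ʳ (map (+ 1 ∷_) (shiftBy [] k (assignments T) (k + t)))
    (List.∈-map⁺ (-[1+ 0 ] ∷_) (∈-shiftBy⁺ k (assignments T) t (∈-assignments⁺ h))))

∈-assignments⁻ : ∀ T t {z} → z ∈ assignments T t → Admits T z t
∈-assignments⁻ []              zero    (here refl) = []
∈-assignments⁻ ((k , neg) ∷ T) t z∈ with z′ , z′∈ , refl ← List.∈-map⁻ (+ 0 ∷_) z∈ = zero (∈-assignments⁻ T t z′∈)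
∈-assignments⁻ ((k , pos) ∷ T) t {z} z∈ = by (List.∈-++⁻ (map (+ 0 ∷_) (assignments T t)) z∈)
  where
  Y = shiftBy [] k (assignments T) t
  nonzero : z ∈ map (+ 1 ∷_) Y ⊎ z ∈ map (-[1+ 0 ] ∷_) Y → Admits ((k , pos) ∷ T) z t
  nonzero (inj₁ z∈) with z′ , z′∈ , refl ← List.∈-map⁻ (+ 1 ∷_) z∈
    with s , refl , z′∈′ ← ∈-shiftBy⁻ k (assignments T) t z′∈ = plus (∈-assignments⁻ T s z′∈′)
  nonzero (inj₂ z∈) with z′ , z′∈ , refl ← List.∈-map⁻ (-[1+ 0 ] ∷_) z∈
    with s , refl , z′∈′ ← ∈-shiftBy⁻ k (assignments T) t z′∈ = minus (∈-assignments⁻ T s z′∈′)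
  by : z ∈ map (+ 0 ∷_) (assignments T t) ⊎ z ∈ (map (+ 1 ∷_) Y ++ map (-[1+ 0 ] ∷_) Y) → Admits ((k , pos) ∷ T) z t
  by (inj₁ z∈) with z′ , z′∈ , refl ← List.∈-map⁻ (+ 0 ∷_) z∈ = zero (∈-assignments⁻ T t z′∈)
  by (inj₂ z∈) = nonzero (List.∈-++⁻ (map (+ 1 ∷_) Y) z∈)

-- S without its d-th element (all of S if there is none).
cut : ∀ n → ℕ → Subset n
cut zero    d       = []
cut (suc n) zero    = outside ∷ ⊤
cut (suc n) (suc d) = inside ∷ cut n d

level-⊤ : ∀ {n} (i : Fin n) → level ⊤ i ≡ 0
level-⊤ zero    = refl
level-⊤ (suc i) = level-⊤ i

sum-constant : ∀ {n} c (f : Fin n → ℕ) → (∀ i → f i ≡ c) → sum (tabulate f) ≡ n * c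
sum-constant {zero}  c f h = refl
sum-constant {suc n} c f h = cong₂ _+_ (h zero) (sum-constant c (f ∘ suc) (h ∘ suc))

-- The levels are d zeros followed by n - d ones. The case d = n, where nothing is cut, gives the
-- zero vector and the constant coefficient.
sum-level-cut : ∀ n d → d ≤ n → sum (tabulate (level (cut n d))) ≡ n ∸ d
sum-level-cut zero    zero    _         = refl
sum-level-cut (suc n) zero    _         = cong suc (trans (sum-constant {n} 1 (λ i → suc (level ⊤ i)) (λ i → cong suc (level-⊤ i))) (*-identityʳ n))
sum-level-cut (suc n) (suc d) (s≤s d≤n) = sum-level-cut n d d≤n

level-cut≤1 : ∀ n d i → level (cut n d) i ≤ 1
level-cut≤1 (suc n) zero    zero    = s≤s z≤n
level-cut≤1 (suc n) zero    (suc i) = s≤s (≤-reflexive (level-⊤ i))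
level-cut≤1 (suc n) (suc d) zero    = z≤n
level-cut≤1 (suc n) (suc d) (suc i) = level-cut≤1 n d i

-- If the first entry of a monotone 0-1 sequence is 1, all entries are 1 and the sum forces d = 0;
-- if it is 0, the remaining entries are too few for d = 0, and the recursion goes on with d - 1.
level-cut-unique : ∀ n d (f : Fin n → ℕ) → d ≤ n → (∀ i → f i ≤ 1) → (∀ i k → toℕ i ≤ toℕ k → f i ≤ f k) →
  sum (tabulate f) ≡ n ∸ d → ∀ i → f i ≡ level (cut n d) i
level-cut-unique (suc n) d f d≤n f≤1 mono Σf with f zero in f₀≡
... | suc _ = full d d≤n Σf
  where
  ones : ∀ i → f i ≡ 1
  ones i = ≤-antisym (f≤1 i) (≤-trans (≤-trans (s≤s z≤n) (≤-reflexive (sym f₀≡))) (mono zero i z≤n))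
  1≡f₀ = trans (sym (ones zero)) f₀≡
  full : ∀ d → d ≤ suc n → suc _ + sum (tabulate (f ∘ suc)) ≡ suc n ∸ d → ∀ i → f i ≡ level (cut (suc n) d) i
  full zero    _         _   zero    = ones zero
  full zero    _         _   (suc i) = trans (ones (suc i)) (cong suc (sym (level-⊤ i)))
  full (suc d) (s≤s d≤n) Σf i = contradiction (trans (sym Σf) (cong₂ _+_ (sym 1≡f₀)
      (trans (sum-constant 1 (f ∘ suc) (ones ∘ suc)) (*-identityʳ n))))
    (<⇒≢ (s≤s (m∸n≤m n d)))
level-cut-unique (suc n) zero    f d≤n f≤1 mono Σf | zero = contradiction Σf
  (<⇒≢ (s≤s (bounded (f ∘ suc) (f≤1 ∘ suc))))
  where
  bounded : ∀ {n} (f : Fin n → ℕ) → (∀ i → f i ≤ 1) → sum (tabulate f) ≤ n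
  bounded {zero}  f h = z≤n
  bounded {suc n} f h = +-mono-≤ (h zero) (bounded (f ∘ suc) (h ∘ suc))
level-cut-unique (suc n) (suc d) f (s≤s d≤n) f≤1 mono Σf | zero = λ
  { zero    → f₀≡
  ; (suc i) → level-cut-unique n d (f ∘ suc) d≤n (f≤1 ∘ suc) (λ i k i≤k → mono (suc i) (suc k) (s≤s i≤k)) Σf i }

sum-allFin : ∀ {n} (f : Fin n → ℕ) → sum (map f (allFin n)) ≡ sum (tabulate f)
sum-allFin f = cong sum (map-tabulate id f)

sum-permuted : ∀ {n} (w : SignedPermutation n) (g : Fin n → ℕ) →
  sum (tabulate (λ i → g (proj₂ (to w (pos , i))))) ≡ sum (tabulate g)
sum-permuted {n} w g = begin
  sum (tabulate (g ∘ axis))              ≡⟨ cong sum (map-tabulate axis g) ⟨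
  sum (map g (tabulate axis))            ≡⟨ sum-map-↭ g (unique⇒↭ (Unique.tabulate⁺ injective) (Unique.allFin⁺ n)
                                              (λ _ → List.∈-allFin _) (λ {i} _ → surjective i)) ⟩
  sum (map g (allFin n))                 ≡⟨ sum-allFin g ⟩
  sum (tabulate g)                       ∎
  where
  open ≡-Reasoning
  axis : Fin n → Fin n
  axis i = proj₂ (to w (pos , i))
  injective : ∀ {i j} → axis i ≡ axis j → i ≡ j
  injective {i} {j} eq with s , eq′ ← sameAxis (to w (pos , i)) (to w (pos , j)) eq =
    cong proj₂ (to-injective w {pos , i} {s · (pos , j)} (trans eq′ (sym (to-· w s _))))
  surjective : ∀ i → i ∈ tabulate axis
  surjective i with σ , k ← from w (pos , i) in eq = subst (_∈ tabulate axis)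
    (cong proj₂ (begin
      σ · to w (pos , k)   ≡⟨ to-· w σ (pos , k) ⟨
      to w (σ Sign.* pos , k) ≡⟨ cong (λ τ → to w (τ , k)) (Sign.*-identityʳ σ) ⟩
      to w (σ , k)         ≡⟨ cong (to w) eq ⟨
      to w (from w (pos , i)) ≡⟨ strictlyInverseˡ w _ ⟩
      (pos , i)            ∎)) (List.∈-tabulate⁺ k)

⊙-⊙ : ∀ s t a → s ⊙ t ⊙ a ≡ (s Sign.* t) ⊙ a
⊙-⊙ pos t   a = refl
⊙-⊙ neg pos a = refl
⊙-⊙ neg neg a = ℤ.neg-involutive a

∣⊙∣ : ∀ s a → ℤ.∣ s ⊙ a ∣ ≡ ℤ.∣ a ∣
∣⊙∣ pos a = refl
∣⊙∣ neg a = ℤ.∣-i∣≡∣i∣ a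

∣∣≤⇒≤ : ∀ {a k} → ℤ.∣ a ∣ ≤ k → a ℤ.≤ + k
∣∣≤⇒≤ {+ _}      h = ℤ.+≤+ h
∣∣≤⇒≤ { -[1+ _ ]} h = ℤ.-≤+

a≡-a⇒a≡0 : ∀ a → a ≡ ℤ.- a → a ≡ + 0
a≡-a⇒a≡0 (+ zero)   _ = refl
a≡-a⇒a≡0 (+ suc _)  ()
a≡-a⇒a≡0 -[1+ _ ]   ()

-a≤a⇒nonneg : ∀ a → ℤ.- a ℤ.≤ a → a ≡ + ℤ.∣ a ∣
-a≤a⇒nonneg (+ _)    _ = refl
-a≤a⇒nonneg -[1+ _ ] ()

odd-· : ∀ {n} {F : Vector n} → Odd F → ∀ s x → F (s · x) ≡ s ⊙ F x
odd-· odd pos x = refl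
odd-· odd neg x = odd x

odd-∘ : ∀ {n} {F : Vector n} → Odd F → ∀ (w : SignedPermutation n) → Odd (F ∘ to w)
odd-∘ {F = F} odd w x = trans (cong F (commutes w x)) (odd (to w x))

support : ∀ {n} → Vector n → ℕ
support F = sum (tabulate (λ i → ℤ.∣ F (pos , i) ∣))

∣odd∣ : ∀ {n} {F : Vector n} → Odd F → ∀ x → ℤ.∣ F x ∣ ≡ ℤ.∣ F (pos , proj₂ x) ∣
∣odd∣ {F = F} odd (pos , i) = refl
∣odd∣ {F = F} odd (neg , i) = trans (cong ℤ.∣_∣ (odd (pos , i))) (ℤ.∣-i∣≡∣i∣ (F (pos , i)))

support-∘ : ∀ {n} {F : Vector n} → Odd F → ∀ w → support (F ∘ to w) ≡ support F
support-∘ {F = F} odd w = trans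
  (cong sum (tabulate-cong (λ i → ∣odd∣ odd (to w (pos , i)))))
  (sum-permuted w (λ i → ℤ.∣ F (pos , i) ∣))

Small : ∀ {n} → Vector n → Set
Small F = ∀ x → ℤ.∣ F x ∣ ≤ 1

weight-small : ∀ n d → Small (weight (cut n d))
weight-small n d (σ , i) = ≤-trans (≤-reflexive (∣⊙∣ σ (+ level (cut n d) i))) (level-cut≤1 n d i)

-- For an odd vector dominance means 0 ≤ F(1) ≤ ... ≤ F(n), so with entries in {0,±1} the size of
-- the support leaves one possibility.
dominant-unique : ∀ {n} d (F : Vector n) → d ≤ n → Odd F → Small F → support F ≡ n ∸ d → Dominant F →
  ∀ x → F x ≡ weight (cut n d) x
dominant-unique {zero}  d F d≤n odd small supp dominant (σ , ())
dominant-unique {suc n} d F d≤n odd small supp dominant = both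
  where
  value : Fin (suc n) → ℤ
  value i = F (pos , i)
  adjacent : ∀ j → value (inject₁ j) ℤ.≤ value (suc j)
  adjacent j = subst (λ x → F x ℤ.≤ value (suc j)) (reflected-suc j) (dominant (suc j))
  nonneg : ∀ i → + 0 ℤ.≤ value i
  nonneg = <-weakInduction (λ i → + 0 ℤ.≤ value i)
    (subst (+ 0 ℤ.≤_) (sym (-a≤a⇒nonneg (value zero) (subst (ℤ._≤ value zero) (odd (pos , zero)) (dominant zero)))) (ℤ.+≤+ z≤n))
    (λ j h → ℤ.≤-trans h (adjacent j))
  f : Fin (suc n) → ℕ
  f i = ℤ.∣ value i ∣
  value≡f : ∀ i → value i ≡ + f i
  value≡f i = sym (ℤ.0≤i⇒+∣i∣≡i (nonneg i))
  mono : ∀ i k → toℕ i ≤ toℕ k → f i ≤ f k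
  mono i k i≤k = <-weakInduction-startingFrom (λ k → f i ≤ f k) {i} ≤-refl
    (λ j h → ≤-trans h (ℤ.drop‿+≤+ (subst₂ ℤ._≤_ (value≡f (inject₁ j)) (value≡f (suc j)) (adjacent j)))) i≤k
  onPos : ∀ i → value i ≡ + level (cut (suc n) d) i
  onPos i = trans (value≡f i) (cong +_ (level-cut-unique (suc n) d f d≤n (λ i → small (pos , i)) mono supp i))
  both : ∀ x → F x ≡ weight (cut (suc n) d) x
  both (pos , i) = onPos i
  both (neg , i) = trans (odd (pos , i)) (cong ℤ.-_ (onPos i))

module FixedVectors (n : ℕ) where
  open B n hiding (F)
  open Action n

  -- Sorting preserves the support, hence ends in the weight itself; the reflections met on the way
  -- compose to the required element.
  orbit-transitive : ∀ d (F : Vector n) → d ≤ n → Odd F → Small F → support F ≡ n ∸ d →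
    ∃ λ x → ∀ z → weight (cut n d) (from x z) ≡ F z
  orbit-transitive d F d≤n odd small supp = go (sort (+ 1) F (λ x → ∣∣≤⇒≤ (small x))) odd small supp
    where
    go : ∀ {F} → Sorts F → Odd F → Small F → support F ≡ n ∸ d → ∃ λ x → ∀ z → weight (cut n d) (from x z) ≡ F z
    go {F} (done dominant) odd small supp = ε , λ z → sym (dominant-unique d F d≤n odd small supp dominant z)
    go {F} (step i _ sorts) odd small supp
      with x , h ← go sorts (odd-∘ odd (generator i)) (small ∘ reflect i) (trans (support-∘ odd (generator i)) supp) =
      generator i ∙ x , λ z → trans (h (reflect i z)) (cong F (strictlyInverseˡ (generator i) z))

  module _ (u : W) where
    open Cycles u

    type : Point n → ℕ × Sign
    type x = size x , sign x

    iterate-fixed : ∀ {F : Vector n} → (∀ x → F (to u x) ≡ F x) → ∀ j x → F (it j x) ≡ F x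
    iterate-fixed h zero    x = refl
    iterate-fixed h (suc j) x = trans (h (it j x)) (iterate-fixed h j x)

    negative⇒0 : ∀ {F : Vector n} → Odd F → (∀ x → F (to u x) ≡ F x) → ∀ x → sign x ≡ neg → F x ≡ + 0
    negative⇒0 {F} odd h x sign≡ = a≡-a⇒a≡0 (F x) (begin
      F x              ≡⟨ iterate-fixed h (size x) x ⟨
      F (it (size x) x) ≡⟨ cong F (trans (closes x) (cong (_· x) sign≡)) ⟩
      F (negate x)     ≡⟨ odd x ⟩
      ℤ.- F x          ∎)
      where open ≡-Reasoning

    positive-period : ∀ x → sign x ≡ pos → ∀ q → it (q * size x) x ≡ x
    positive-period x sign≡ zero    = refl
    positive-period x sign≡ (suc q) = trans (it-+ (size x) (q * size x) x)
      (trans (cong (it (size x)) (positive-period x sign≡ q)) (trans (closes x) (cong (_· x) sign≡)))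

    positive-return : ∀ x → sign x ≡ pos → ∀ l s → it l x ≡ s · x → s ≡ pos
    positive-return x sign≡ l s eq with divides q refl ← m%n≡0⇒n∣m l (size x) (remainder≡0 l s x eq) =
      ·-faithful s pos x (trans (sym eq) (positive-period x sign≡ q))

    -- A positive cycle never meets its negative, so the sign with which a point is reached from x
    -- is well defined. Without this a non-zero value at x could not be spread along the orbit.
    sign-unique : ∀ x → sign x ≡ pos → ∀ j s j′ s′ → s · it j x ≡ s′ · it j′ x → s ≡ s′
    sign-unique x sign≡ j s j′ s′ eq = begin
      s                           ≡⟨ Sign.*-identityʳ s ⟨
      s Sign.* pos                ≡⟨ cong (s Sign.*_) (positive-return x sign≡ (k + j) (s Sign.* s′) back) ⟨
      s Sign.* (s Sign.* s′)      ≡⟨ Sign.*-assoc s s s′ ⟨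
      (s Sign.* s) Sign.* s′      ≡⟨ cong (Sign._* s′) (Sign.s*s≡+ s) ⟩
      s′                          ∎
      where
      open ≡-Reasoning
      k = j′ * pred-size x
      back : it (k + j) x ≡ (s Sign.* s′) · x
      back = begin
        it (k + j) x                      ≡⟨ it-+ k j x ⟩
        it k (it j x)                     ≡⟨ cong (it k) (·-transpose s (sym eq)) ⟩
        it k (s · s′ · it j′ x)           ≡⟨ cong (it k) (·-· s s′ _) ⟩
        it k ((s Sign.* s′) · it j′ x)    ≡⟨ it-· k (s Sign.* s′) (it j′ x) ⟩
        (s Sign.* s′) · it k (it j′ x)    ≡⟨ cong ((s Sign.* s′) ·_) (it-+ k j′ x) ⟨
        (s Sign.* s′) · it (k + j′) x     ≡⟨ cong (λ l → (s Sign.* s′) · it l x) (trans (+-comm k j′) (sym (*-suc j′ (pred-size x)))) ⟩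
        (s Sign.* s′) · it (j′ * size x) x ≡⟨ cong ((s Sign.* s′) ·_) (positive-period x sign≡ j′) ⟩
        (s Sign.* s′) · x                 ∎

    Prescribes : Vector n → Point n → ℤ → Set
    Prescribes F x a = ∀ j s → F (s · it j x) ≡ s ⊙ a

    -- A value at x prescribes the values on its whole orbit under ⟨u, -1⟩. The sign is ambiguous
    -- only on negative cycles, where `Admits` leaves only the value 0.
    extend : ∀ {xs z t} → AllPairs Separate xs → Admits (map type xs) z t → ∃ λ F → Pointwise (Prescribes F) xs z
    extend {[]}     []            []  = (λ _ → + 0) , []
    extend {x ∷ xs} {a ∷ z} (sep ∷ seps) h = F , onOrbit ∷ offOrbit sep (proj₂ IH)
      where
      rest : ∀ {k σ T a z t} → Admits ((k , σ) ∷ T) (a ∷ z) t → ∃ (Admits T z)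
      rest (zero h)  = _ , h
      rest (plus h)  = _ , h
      rest (minus h) = _ , h
      IH = extend seps (proj₂ (rest h))
      value : ∀ y → Dec (proj₂ y ∈ orbit x) → ℤ
      value y (yes y∈) = proj₁ (proj₂ (∈-orbit⁻ {x} {y} y∈)) ⊙ a
      value y (no _)   = proj₁ IH y
      F : Vector n
      F y = value y (Any.any? (proj₂ y Fin.≟_) (orbit x))
      unambiguous : ∀ {σ T t} → sign x ≡ σ → Admits ((size x , σ) ∷ T) (a ∷ z) t →
        ∀ j s j′ s′ → s · it j x ≡ s′ · it j′ x → s ⊙ a ≡ s′ ⊙ a
      unambiguous sign≡ (zero _)  j pos j′ pos eq = refl
      unambiguous sign≡ (zero _)  j pos j′ neg eq = refl
      unambiguous sign≡ (zero _)  j neg j′ pos eq = refl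
      unambiguous sign≡ (zero _)  j neg j′ neg eq = refl
      unambiguous sign≡ (plus _)  j s j′ s′ eq = cong (_⊙ _) (sign-unique x sign≡ j s j′ s′ eq)
      unambiguous sign≡ (minus _) j s j′ s′ eq = cong (_⊙ _) (sign-unique x sign≡ j s j′ s′ eq)
      onOrbit : Prescribes F x a
      onOrbit j s with Any.any? (proj₂ (s · it j x) Fin.≟_) (orbit x)
      ... | yes y∈ = let j′ , s′ , eq = ∈-orbit⁻ {x} {s · it j x} y∈ in unambiguous refl h j′ s′ j s (sym eq)
      ... | no y∉ = contradiction (∈-orbit⁺ {x} {s · it j x} (j , s , refl)) y∉
      other : ∀ {x′ b} → Separate x x′ → Prescribes (proj₁ IH) x′ b → Prescribes F x′ b
      other {x′} sep p j s with Any.any? (proj₂ (s · it j x′) Fin.≟_) (orbit x)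
      ... | yes y∈ = contradiction (reaches-trans (∈-orbit⁻ {x} {s · it j x′} y∈) (reaches-sym (j , s , refl))) sep
      ... | no _   = p j s
      offOrbit : ∀ {xs z} → All (Separate x) xs → Pointwise (Prescribes (proj₁ IH)) xs z → Pointwise (Prescribes F) xs z
      offOrbit []           []       = []
      offOrbit (sep ∷ seps) (p ∷ ps) = other sep p ∷ offOrbit seps ps

    values-admitted : ∀ {F : Vector n} → Odd F → Small F → (∀ x → F (to u x) ≡ F x) → ∀ xs →
      Admits (map type xs) (map F xs) (sum (map (λ x → size x * ℤ.∣ F x ∣) xs))
    values-admitted {F} odd small h []       = []
    values-admitted {F} odd small h (x ∷ xs) = entry (sign x) refl (F x) refl (small x) (values-admitted odd small h xs)
      where
      entry : ∀ σ → sign x ≡ σ → ∀ a → F x ≡ a → ℤ.∣ a ∣ ≤ 1 → ∀ {T z t} → Admits T z t →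
        Admits ((size x , σ) ∷ T) (a ∷ z) (size x * ℤ.∣ a ∣ + t)
      entry σ   _ (+ 0)       _ _ {T} {z} {t} r = subst (λ l → Admits ((size x , σ) ∷ T) (+ 0 ∷ z) (l + t)) (sym (*-zeroʳ (size x))) (zero r)
      entry pos _ (+ 1)       _ _ {T} {z} {t} r = subst (λ l → Admits ((size x , pos) ∷ T) (+ 1 ∷ z) (l + t)) (sym (*-identityʳ (size x))) (plus r)
      entry pos _ -[1+ 0 ]    _ _ {T} {z} {t} r = subst (λ l → Admits ((size x , pos) ∷ T) (-[1+ 0 ] ∷ z) (l + t)) (sym (*-identityʳ (size x))) (minus r)
      entry neg e (+ suc k)   Fx _        r = contradiction (trans (sym Fx) (negative⇒0 odd h x e)) λ ()
      entry neg e -[1+ k ]    Fx _        r = contradiction (trans (sym Fx) (negative⇒0 odd h x e)) λ ()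
      entry pos _ (+ suc (suc k)) _ (s≤s ()) r
      entry pos _ -[1+ suc k ]    _ (s≤s ()) r

    module _ {xs} (R : Representatives xs) where
      open Representatives R

      support-orbits : ∀ {F : Vector n} → Odd F → (∀ x → F (to u x) ≡ F x) →
        support F ≡ sum (map (λ x → size x * ℤ.∣ F x ∣) xs)
      support-orbits {F} odd h = begin
        support F                                        ≡⟨ sum-allFin g ⟨
        sum (map g (allFin n))                           ≡⟨ sum-orbits g ⟩
        sum (map (λ x → sum (map g (orbit x))) xs)       ≡⟨ cong sum (map-cong (λ x → sum-replicate ℤ.∣ F x ∣ (λ j → proj₂ (it j x)) g (size x)
                                                              (λ j → trans (sym (∣odd∣ {F = F} odd (it j x))) (cong ℤ.∣_∣ (iterate-fixed {F} h j x)))) xs) ⟩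
        sum (map (λ x → size x * ℤ.∣ F x ∣) xs)          ∎
        where
        open ≡-Reasoning
        g : Fin n → ℕ
        g i = ℤ.∣ F (pos , i) ∣

      pointwise-lookup : ∀ {F : Vector n} {xs z y} → Pointwise (Prescribes F) xs z → Any (λ x → Reaches x y) xs →
        ∃₂ λ x a → Prescribes F x a × Reaches x y × a ∈ z
      pointwise-lookup     (p ∷ ps) (here r)  = _ , _ , p , r , here refl
      pointwise-lookup {F} (p ∷ ps) (there r) with x , a , q , r , a∈ ← pointwise-lookup {F} ps r = x , a , q , r , there a∈

      admitted-small : ∀ {T z t a} → Admits T z t → a ∈ z → ℤ.∣ a ∣ ≤ 1
      admitted-small (zero h)  (here refl) = z≤n
      admitted-small (plus h)  (here refl) = ≤-refl
      admitted-small (minus h) (here refl) = ≤-refl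
      admitted-small (zero h)  (there a∈)  = admitted-small h a∈
      admitted-small (plus h)  (there a∈)  = admitted-small h a∈
      admitted-small (minus h) (there a∈)  = admitted-small h a∈

      prescribed-values : ∀ {F : Vector n} {xs z} → Pointwise (Prescribes F) xs z → map F xs ≡ z
      prescribed-values         []       = refl
      prescribed-values {F = F} (p ∷ ps) = cong₂ _∷_ (p 0 pos) (prescribed-values {F = F} ps)

      admits-unique : ∀ {T z t t′} → Admits T z t → Admits T z t′ → t ≡ t′
      admits-unique []        []         = refl
      admits-unique (zero h)  (zero h′)  = admits-unique h h′
      admits-unique (plus {k} h)  (plus h′)  = cong (λ l → k + l) (admits-unique h h′)
      admits-unique (minus {k} h) (minus h′) = cong (λ l → k + l) (admits-unique h h′)

      -- A fixed coset is encoded by the values of its vector at the representatives of the cycles.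
      -- Conversely an admissible list of values extends to a fixed vector, and transitivity turns
      -- this vector into a coset.
      fixCount≡series : ∀ d → d ≤ n → fixCount (cut n d) u ≡ series (positives (map type xs)) (n ∸ d)
      fixCount≡series d d≤n = sym (trans (sym (length-assignments T (n ∸ d)))
        (fixCount-unique J u (cardinality-list (Fixed J u) values (assignments T (n ∸ d)) (unique-assignments T (n ∸ d))
          (λ { {x , _} {y , _} x~y → map-cong (coset⇒vector J x y x~y) xs })
          (λ { {x , h} {y , k} → reflect-values x h y k })
          admitted hit) (Identity.inverse (Fixed J u))))
        where
        J = cut n d
        T = map type xs
        vector : W → Vector n
        vector x = weight J ∘ from x
        vector-odd : ∀ x → Odd (vector x)
        vector-odd x = odd-∘ (weight-odd J) (x ⁻¹)
        values : Σ W (λ x → u ∙ x ~[ J ] x) → List ℤ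
        values (x , _) = map (vector x) xs
        map-agrees : ∀ {F G : Vector n} {xs} → map F xs ≡ map G xs → ∀ {y} → Any (λ x → Reaches x y) xs →
          ∃ λ x → F x ≡ G x × Reaches x y
        map-agrees {xs = x ∷ xs} eq (here r)  = x , ∷-injectiveˡ eq , r
        map-agrees {xs = x ∷ xs} eq (there r) = map-agrees (∷-injectiveʳ eq) r
        reflect-values : ∀ x → u ∙ x ~[ J ] x → ∀ y → u ∙ y ~[ J ] y → map (vector x) xs ≡ map (vector y) xs → x ~[ J ] y
        reflect-values x h y k eq = vector⇒coset J x y agree
          where
          agree : ∀ z → vector x z ≡ vector y z
          agree z with r , same , (j , s , refl) ← map-agrees {vector x} {vector y} eq (cover z) = begin
            vector x (s · it j r)    ≡⟨ odd-· (vector-odd x) s _ ⟩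
            s ⊙ vector x (it j r)    ≡⟨ cong (s ⊙_) (iterate-fixed {vector x} (vector-fixed J u x h) j r) ⟩
            s ⊙ vector x r           ≡⟨ cong (s ⊙_) same ⟩
            s ⊙ vector y r           ≡⟨ cong (s ⊙_) (iterate-fixed {vector y} (vector-fixed J u y k) j r) ⟨
            s ⊙ vector y (it j r)    ≡⟨ odd-· (vector-odd y) s _ ⟨
            vector y (s · it j r)    ∎
            where open ≡-Reasoning
        admitted : ∀ xh → values xh ∈ assignments T (n ∸ d)
        admitted (x , h) = ∈-assignments⁺ (subst (Admits T (map (vector x) xs)) support≡
          (values-admitted {vector x} (vector-odd x) (weight-small n d ∘ from x) fixed xs))
          where
          fixed = vector-fixed J u x h
          support≡ : sum (map (λ y → size y * ℤ.∣ vector x y ∣) xs) ≡ n ∸ d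
          support≡ = begin
            sum (map (λ y → size y * ℤ.∣ vector x y ∣) xs)  ≡⟨ support-orbits {vector x} (vector-odd x) fixed ⟨
            support (vector x)                              ≡⟨ support-∘ {F = weight J} (weight-odd J) (x ⁻¹) ⟩
            support (weight J)                              ≡⟨ sum-level-cut n d d≤n ⟩
            n ∸ d                                           ∎
            where open ≡-Reasoning
        hit : ∀ z → z ∈ assignments T (n ∸ d) → ∃ λ xh → values xh ≡ z
        hit z z∈ = (proj₁ orbit-point , fixed-vector J u (proj₁ orbit-point)
            (λ y → trans (proj₂ orbit-point (to u y)) (trans (fixed y) (sym (proj₂ orbit-point y)))))
          , trans (map-cong (proj₂ orbit-point) xs) (prescribed-values {F} (proj₂ extension))
          where
          admits : Admits T z (n ∸ d)
          admits = ∈-assignments⁻ T (n ∸ d) z∈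
          extension = extend separate admits
          F = proj₁ extension
          at : ∀ y → ∃₂ λ x a → Prescribes F x a × Reaches x y × a ∈ z
          at y = pointwise-lookup {F} (proj₂ extension) (cover y)
          odd : Odd F
          odd y with x , a , p , (j , s , refl) , _ ← at y = begin
            F (negate (s · it j x))     ≡⟨ cong F (·-· neg s (it j x)) ⟩
            F ((neg Sign.* s) · it j x) ≡⟨ p j (neg Sign.* s) ⟩
            (neg Sign.* s) ⊙ a          ≡⟨ ⊙-⊙ neg s a ⟨
            ℤ.- (s ⊙ a)                 ≡⟨ cong ℤ.-_ (p j s) ⟨
            ℤ.- F (s · it j x)          ∎
            where open ≡-Reasoning
          fixed : ∀ y → F (to u y) ≡ F y
          fixed y with x , a , p , (j , s , refl) , _ ← at y =
            trans (cong F (to-· u s _)) (trans (p (suc j) s) (sym (p j s)))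
          small : Small F
          small y with x , a , p , (j , s , refl) , a∈ ← at y =
            ≤-trans (≤-reflexive (trans (cong ℤ.∣_∣ (p j s)) (∣⊙∣ s a))) (admitted-small admits a∈)
          support≡ : support F ≡ n ∸ d
          support≡ = trans (support-orbits {F} odd fixed) (admits-unique
            (subst (λ z → Admits T z (sum (map (λ x → size x * ℤ.∣ F x ∣) xs))) (prescribed-values {F} (proj₂ extension)) (values-admitted {F} odd small fixed xs)) admits)
          orbit-point = orbit-transitive d F d≤n odd small support≡

-- Conjugacy of signed permutations

signPower : Sign → ℕ → Sign
signPower σ zero    = pos
signPower σ (suc q) = signPower σ q Sign.* σ

module _ {n} (u : SignedPermutation n) where
  open Cycles u

  iterate-multiple : ∀ x q → it (q * size x) x ≡ signPower (sign x) q · x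
  iterate-multiple x zero    = refl
  iterate-multiple x (suc q) = begin
    it (size x + q * size x) x           ≡⟨ it-+ (size x) (q * size x) x ⟩
    it (size x) (it (q * size x) x)      ≡⟨ cong (it (size x)) (iterate-multiple x q) ⟩
    it (size x) (signPower (sign x) q · x) ≡⟨ it-· (size x) (signPower (sign x) q) x ⟩
    signPower (sign x) q · it (size x) x ≡⟨ cong (signPower (sign x) q ·_) (closes x) ⟩
    signPower (sign x) q · sign x · x    ≡⟨ ·-· (signPower (sign x) q) (sign x) x ⟩
    signPower (sign x) (suc q) · x       ∎
    where open ≡-Reasoning

  size-∣ : ∀ x l s → it l x ≡ s · x → size x ∣ l
  size-∣ x l s eq = m%n≡0⇒n∣m l (size x) (remainder≡0 l s x eq)

  return-along : ∀ {x y} → Reaches x y → ∀ l s → it l x ≡ s · x → it l y ≡ s · y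
  return-along {x} (j , t , refl) l s eq = begin
    it l (t · it j x)   ≡⟨ it-· l t _ ⟩
    t · it l (it j x)   ≡⟨ cong (t ·_) (it-comm l j x) ⟩
    t · it j (it l x)   ≡⟨ cong (λ z → t · it j z) eq ⟩
    t · it j (s · x)    ≡⟨ cong (t ·_) (it-· j s x) ⟩
    t · s · it j x      ≡⟨ ·-comm t s _ ⟩
    s · t · it j x      ∎
    where open ≡-Reasoning

  size-along : ∀ {x y} → Reaches x y → size x ≡ size y
  size-along {x} {y} r = ∣-antisym
    (size-∣ x (size y) (sign y) (return-along (reaches-sym r) (size y) (sign y) (closes y)))
    (size-∣ y (size x) (sign x) (return-along r (size x) (sign x) (closes x)))

  separate-sym : ∀ {x y} → Separate x y → Separate y x
  separate-sym sep r = sep (reaches-sym r)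

  representatives-↭ : ∀ {xs ys} → xs ↭ ys → Representatives xs → Representatives ys
  representatives-↭ eq R = record
    { separate = Permutation.AllPairs-resp-↭ (setoid _) separate-sym ((λ { refl → id }) , (λ { refl → id }))
        (↭.↭⇒↭ₛ eq) separate
    ; cover    = λ y → ↭.Any-resp-↭ eq (cover y) }
    where open Representatives R

-- The data are symmetric in u and v, so the inverse of the conjugating element comes from the same
-- construction.
record Matching {n} (u v : SignedPermutation n) {I : Set} (Z : List I) (a b : I → Point n) : Set where
  field
    sizes     : ∀ {i} → i ∈ Z → Cycles.size u (a i) ≡ Cycles.size v (b i)
    signs     : ∀ {i} → i ∈ Z → Cycles.sign u (a i) ≡ Cycles.sign v (b i)
    separateᵃ : AllPairs (λ i j → Cycles.Separate u (a i) (a j)) Z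
    separateᵇ : AllPairs (λ i j → Cycles.Separate v (b i) (b j)) Z
    coverᵃ    : ∀ y → Any (λ i → Cycles.Reaches u (a i) y) Z
    coverᵇ    : ∀ y → Any (λ i → Cycles.Reaches v (b i) y) Z

matching-sym : ∀ {n} {u v : SignedPermutation n} {I : Set} {Z : List I} {a b} → Matching u v Z a b → Matching v u Z b a
matching-sym M = record
  { sizes = λ i∈ → sym (sizes i∈) ; signs = λ i∈ → sym (signs i∈)
  ; separateᵃ = separateᵇ ; separateᵇ = separateᵃ ; coverᵃ = coverᵇ ; coverᵇ = coverᵃ }
  where open Matching M

module _ {n} {u v : SignedPermutation n} {I : Set} {Z : List I} {a b : I → Point n} where
  private
    module U = Cycles u
    module V = Cycles v

  -- The graph of the conjugating element. As a relation it is visibly symmetric and compatible with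
  -- u, v and -1; what takes work is that it is single-valued.
  Corresponds : Matching u v Z a b → Point n → Point n → Set
  Corresponds M x y = ∃ λ i → i ∈ Z × ∃₂ λ j s → x ≡ s · U.it j (a i) × y ≡ s · V.it j (b i)

  module _ (M : Matching u v Z a b) where
    open Matching M

    transfer-return : ∀ {i} → i ∈ Z → ∀ l s → U.it l (a i) ≡ s · a i → V.it l (b i) ≡ s · b i
    transfer-return {i} i∈ l s eq with divides q refl ← size-∣ u (a i) l s eq = begin
      V.it (q * U.size (a i)) (b i)   ≡⟨ cong (λ k → V.it (q * k) (b i)) (sizes i∈) ⟩
      V.it (q * V.size (b i)) (b i)   ≡⟨ iterate-multiple v (b i) q ⟩
      signPower (V.sign (b i)) q · b i ≡⟨ cong (λ σ → signPower σ q · b i) (signs i∈) ⟨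
      signPower (U.sign (a i)) q · b i ≡⟨ cong (_· b i) (·-faithful (signPower (U.sign (a i)) q) s (a i) (trans (sym (iterate-multiple u (a i) q)) eq)) ⟩
      s · b i                         ∎
      where open ≡-Reasoning

    -- Two descriptions of the same point differ by a return to `a i` up to sign. Its time is a
    -- multiple of the size and its sign a power of the sign of the cycle, and these data agree for
    -- `b i`.
    transfer : ∀ {i} → i ∈ Z → ∀ j s j′ s′ → s · U.it j (a i) ≡ s′ · U.it j′ (a i) → s · V.it j (b i) ≡ s′ · V.it j′ (b i)
    transfer {i} i∈ j s j′ s′ eq = trans (cong (s ·_) (V.it-injective k vEq)) (trans (·-· s (s Sign.* s′) _)
        (cong (_· V.it j′ (b i)) (trans (sym (Sign.*-assoc s s s′)) (cong (Sign._* s′) (Sign.s*s≡+ s)))))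
      where
      open ≡-Reasoning
      x = a i
      y = b i
      k = j′ * U.pred-size x
      t = s Sign.* s′
      k+j′ : k + j′ ≡ j′ * U.size x
      k+j′ = trans (+-comm k j′) (sym (*-suc j′ (U.pred-size x)))
      uEq : U.it (k + j) x ≡ (t Sign.* signPower (U.sign x) j′) · x
      uEq = begin
        U.it (k + j) x                        ≡⟨ U.it-+ k j x ⟩
        U.it k (U.it j x)                     ≡⟨ cong (U.it k) (trans (·-transpose s (sym eq)) (·-· s s′ _)) ⟩
        U.it k (t · U.it j′ x)                ≡⟨ U.it-· k t _ ⟩
        t · U.it k (U.it j′ x)                ≡⟨ cong (t ·_) (trans (sym (U.it-+ k j′ x)) (cong (λ l → U.it l x) k+j′)) ⟩
        t · U.it (j′ * U.size x) x            ≡⟨ cong (t ·_) (iterate-multiple u x j′) ⟩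
        t · signPower (U.sign x) j′ · x       ≡⟨ ·-· t (signPower (U.sign x) j′) x ⟩
        (t Sign.* signPower (U.sign x) j′) · x ∎
      vEq : V.it k (V.it j y) ≡ V.it k (t · V.it j′ y)
      vEq = begin
        V.it k (V.it j y)                     ≡⟨ V.it-+ k j y ⟨
        V.it (k + j) y                        ≡⟨ transfer-return i∈ (k + j) (t Sign.* signPower (U.sign x) j′) uEq ⟩
        (t Sign.* signPower (U.sign x) j′) · y ≡⟨ ·-· t (signPower (U.sign x) j′) y ⟨
        t · signPower (U.sign x) j′ · y       ≡⟨ cong (λ σ → t · signPower σ j′ · y) (signs i∈) ⟩
        t · signPower (V.sign y) j′ · y       ≡⟨ cong (t ·_) (iterate-multiple v y j′) ⟨
        t · V.it (j′ * V.size y) y            ≡⟨ cong (λ l → t · V.it (j′ * l) y) (sizes i∈) ⟨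
        t · V.it (j′ * U.size x) y            ≡⟨ cong (λ l → t · V.it l y) k+j′ ⟨
        t · V.it (k + j′) y                   ≡⟨ cong (t ·_) (V.it-+ k j′ y) ⟩
        t · V.it k (V.it j′ y)                ≡⟨ V.it-· k t _ ⟨
        V.it k (t · V.it j′ y)                ∎

    functional : ∀ {x y y′} → Corresponds M x y → Corresponds M x y′ → y ≡ y′
    functional (i , i∈ , j , s , refl , refl) (i′ , i′∈ , j′ , s′ , eq , refl) with List.∈-AllPairs₂ separateᵃ i∈ i′∈
    ... | inj₁ refl        = transfer i∈ j s j′ s′ eq
    ... | inj₂ (inj₁ sep)  = contradiction (U.reaches-trans (j , s , refl) (U.reaches-sym (j′ , s′ , eq))) sep
    ... | inj₂ (inj₂ sep)  = contradiction (U.reaches-trans (j′ , s′ , eq) (U.reaches-sym (j , s , refl))) sep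

    image : ∀ x → ∃ (Corresponds M x)
    image x with i , i∈ , (j , s , eq) ← List.find (coverᵃ x) = s · V.it j (b i) , i , i∈ , j , s , eq , refl

module _ {n} {u v : SignedPermutation n} {I : Set} {Z : List I} {a b : I → Point n} (M : Matching u v Z a b) where
  private
    module U = Cycles u
    module V = Cycles v

    converse : ∀ {x y} → Corresponds M x y → Corresponds (matching-sym M) y x
    converse (i , i∈ , j , s , p , q) = i , i∈ , j , s , q , p

    converse′ : ∀ {x y} → Corresponds (matching-sym M) y x → Corresponds M x y
    converse′ (i , i∈ , j , s , p , q) = i , i∈ , j , s , q , p

    f : Point n → Point n
    f x = proj₁ (image M x)

    f-corresponds : ∀ x → Corresponds M x (f x)
    f-corresponds x = proj₂ (image M x)

    g : Point n → Point n
    g y = proj₁ (image (matching-sym M) y)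

    g-corresponds : ∀ y → Corresponds (matching-sym M) y (g y)
    g-corresponds y = proj₂ (image (matching-sym M) y)

  conjugator : SignedPermutation n
  conjugator = record
    { perm = mk↔ₛ′ f g
        (λ y → functional M (f-corresponds (g y)) (converse′ (g-corresponds y)))
        (λ x → functional (matching-sym M) (g-corresponds (f x)) (converse (f-corresponds x)))
    ; commutes = λ x → functional M (f-corresponds (negate x)) (negated (f-corresponds x)) }
    where
    negated : ∀ {x y} → Corresponds M x y → Corresponds M (negate x) (negate y)
    negated (i , i∈ , j , s , refl , refl) = i , i∈ , j , neg Sign.* s , ·-· neg s _ , ·-· neg s _

  conjugator-equivariant : ∀ x → to conjugator (to u x) ≡ to v (to conjugator x)
  conjugator-equivariant x = functional M (f-corresponds (to u x)) (advanced (f-corresponds x))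
    where
    advanced : ∀ {x y} → Corresponds M x y → Corresponds M (to u x) (to v y)
    advanced (i , i∈ , j , s , refl , refl) = i , i∈ , suc j , s , to-· u s _ , to-· v s _

zipped : ∀ {A B C : Set} (f : A → C) (g : B → C) xs ys → map f xs ≡ map g ys →
  ∃ λ Z → map proj₁ Z ≡ xs × map proj₂ Z ≡ ys × All (λ (x , y) → f x ≡ g y) Z
zipped f g []       []       eq = [] , refl , refl , []
zipped f g (x ∷ xs) (y ∷ ys) eq with Z , refl , refl , h ← zipped f g xs ys (∷-injectiveʳ eq) =
  (x , y) ∷ Z , refl , refl , ∷-injectiveˡ eq ∷ h

cycleType-split : ∀ T → T ↭ map (_, pos) (positives T) ++ map (_, neg) (negatives T)
cycleType-split []              = ↭-refl
cycleType-split ((k , pos) ∷ T) = ↭-prep _ (cycleType-split T)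
cycleType-split ((k , neg) ∷ T) = ↭-trans (↭-prep _ (cycleType-split T))
  (↭-sym (↭.shift (k , neg) (map (_, pos) (positives T)) (map (_, neg) (negatives T))))

sum-cycleType : ∀ T → sum (positives T) + sum (negatives T) ≡ sum (map proj₁ T)
sum-cycleType []              = refl
sum-cycleType ((k , pos) ∷ T) = trans (+-assoc k _ _) (cong (λ l → k + l) (sum-cycleType T))
sum-cycleType ((k , neg) ∷ T) = trans (exchange (sum (positives T)) k _) (cong (λ l → k + l) (sum-cycleType T))
  where
  exchange : ∀ a b c → a + (b + c) ≡ b + (a + c)
  exchange = solve-∀

constant-lists : ∀ k A B → All (_≡ suc k) A → All (_≡ suc k) B → sum A ≡ sum B → A ≡ B
constant-lists k []      []      _ _ _ = refl
constant-lists k []      (_ ∷ _) _ (refl ∷ _) ()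
constant-lists k (_ ∷ _) []      (refl ∷ _) _ ()
constant-lists k (_ ∷ A) (_ ∷ B) (refl ∷ hA) (refl ∷ hB) eq = cong (suc k ∷_) (constant-lists k A B hA hB (+-cancelˡ-≡ (suc k) _ _ eq))

module Conjugacy (n : ℕ) where
  open B n hiding (F)
  open Action n
  open FixedVectors n

  cycleType : W → CycleType
  cycleType u = map (type u) (proj₁ (Cycles.representatives u))

  sameType⇒conjugate : ∀ u v → cycleType u ↭ cycleType v → Conjugate u v
  sameType⇒conjugate u v = match (proj₂ (Cycles.representatives u)) (proj₂ (Cycles.representatives v))
    where
    match : ∀ {xs ys} → Cycles.Representatives u xs → Cycles.Representatives v ys →
      map (type u) xs ↭ map (type v) ys → Conjugate u v
    match {_} {ys} RU RV T↭ with xs , eq , xs↭ ← ↭.↭-map-inv (type u) T↭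
      with Z , refl , refl , same ← zipped (type u) (type v) xs ys (sym eq) =
      conjugator M , λ x → trans (conjugator-equivariant M (from (conjugator M) x))
        (cong (to v) (strictlyInverseˡ (conjugator M) x))
      where
      module RU′ = Cycles.Representatives (representatives-↭ u xs↭ RU)
      module RV′ = Cycles.Representatives RV
      M : Matching u v Z proj₁ proj₂
      M = record
        { sizes     = λ i∈ → cong proj₁ (All.lookup same i∈)
        ; signs     = λ i∈ → cong proj₂ (All.lookup same i∈)
        ; separateᵃ = AllPairs.map⁻ RU′.separate
        ; separateᵇ = AllPairs.map⁻ RV′.separate
        ; coverᵃ    = λ y → Any.map⁻ (RU′.cover y)
        ; coverᵇ    = λ y → Any.map⁻ (RV′.cover y) }

-- Negative cycles of Coxeter elements and of their regular parts

module NegativeCycles (m : ℕ) where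
  open B (suc m) hiding (F)
  open Action (suc m)
  open RegularPart (suc m)
  open FixedVectors (suc m)
  open Conjugacy (suc m)

  origin : Point (suc m)
  origin = pos , zero

  Negative : W → Point (suc m) → Set
  Negative u x = ∃ λ l → iterate u l x ≡ negate x

  negative-sign : ∀ u x → Negative u x → Cycles.sign u x ≡ neg
  negative-sign u x (l , eq) with Cycles.sign u x in sign≡
  ... | neg = refl
  ... | pos with () ← positive-return u x sign≡ l neg eq

  -- The points of a cycle of c_K form an orbit of W_K.  If it avoids ±1, the signs of
  -- its points are unchanged by every generator of W_K, so the cycle is positive.
  negative⇒origin : ∀ {K c} → IsCoxeterElement K c → ∀ x → Negative c x → Cycles.Reaches c x origin
  negative⇒origin {K} {c} isCox x negative with Any.any? (zero Fin.≟_) (Cycles.orbit c x)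
  ... | yes 0∈ = Cycles.∈-orbit⁻ c {y = origin} 0∈
  ... | no 0∉ = contradiction
    (trans (sym (signed-∈ x (orbit-closed (0 , pos , refl)))) (negative⇒0 c {signed} signed-odd
      (generated-invariant K signed signed-invariant (coxeter-∈ {K} {c} isCox)) x (negative-sign c x negative)))
    (unit≢0 (proj₁ x))
    where
    open Cycles c
    orbit-closed : ∀ {y} → Reaches x y → proj₂ y ∈ orbit x
    orbit-closed = ∈-orbit⁺
    InOrbit : Fin (suc m) → Set
    InOrbit i = i ∈ orbit x
    inOrbit? : ∀ i → Dec (InOrbit i)
    inOrbit? i = Any.any? (i Fin.≟_) (orbit x)
    membership : ∀ {i} → Dec (InOrbit i) → ℤ
    membership (yes _) = + 1
    membership (no _)  = + 0
    indicates : Vector (suc m)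
    indicates y = membership (inOrbit? (proj₂ y))
    membership-cong : ∀ {i j} (d : Dec (InOrbit i)) (e : Dec (InOrbit j)) → (InOrbit i → InOrbit j) → (InOrbit j → InOrbit i) →
      membership d ≡ membership e
    membership-cong (yes _) (yes _) _ _ = refl
    membership-cong (no _)  (no _)  _ _ = refl
    membership-cong (yes h) (no ¬h) f _ = contradiction (f h) ¬h
    membership-cong (no ¬h) (yes h) _ g = contradiction (g h) ¬h
    indicates-fixed : ∀ y → indicates (to c y) ≡ indicates y
    indicates-fixed y = membership-cong (inOrbit? _) (inOrbit? _)
      (λ h → ∈-orbit⁺ (reaches-trans (∈-orbit⁻ {y = to c y} h) (reaches-sym (1 , pos , refl))))
      (λ h → ∈-orbit⁺ (reaches-trans (∈-orbit⁻ {y = y} h) (1 , pos , refl)))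
    indicates-invariant : ∀ i → i Subset.∈ K → ∀ y → indicates (reflect i y) ≡ indicates y
    indicates-invariant = coxeter-invariant {K} {c} isCox indicates indicates-fixed
    -- The even indicator of the orbit, twisted by the sign to become odd. The generators other than
    -- s₀ preserve signs, and s₀ affects only ±1, where the indicator is 0; so W_K fixes this
    -- vector. On a negative cycle it would have to vanish, yet it is ±1 at x.
    signed : Vector (suc m)
    signed y = proj₁ y ⊙ indicates y
    signed-odd : Odd signed
    signed-odd y = sym (⊙-⊙ neg (proj₁ y) (indicates y))
    signed-∈ : ∀ y → InOrbit (proj₂ y) → signed y ≡ proj₁ y ⊙ (+ 1)
    signed-∈ y h = cong (proj₁ y ⊙_) (member (inOrbit? (proj₂ y)) h)
      where
      member : ∀ {i} (d : Dec (InOrbit i)) → InOrbit i → membership d ≡ + 1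
      member (yes _) _ = refl
      member (no ¬h) h = contradiction h ¬h
    signed-invariant : ∀ i → i Subset.∈ K → ∀ y → signed (reflect i y) ≡ signed y
    signed-invariant (suc j) i∈K (σ , k)     = cong (σ ⊙_) (indicates-invariant (suc j) i∈K (σ , k))
    signed-invariant zero    i∈K (σ , suc k) = refl
    signed-invariant zero    i∈K (σ , zero)  = trans (vanishes (opposite σ)) (sym (vanishes σ))
      where
      absent : (d : Dec (InOrbit zero)) → ∀ σ → σ ⊙ membership d ≡ + 0
      absent (yes h) _   = contradiction h 0∉
      absent (no _)  pos = refl
      absent (no _)  neg = refl
      vanishes : ∀ σ → signed (σ , zero) ≡ + 0
      vanishes = absent (inOrbit? zero)
    unit≢0 : ∀ σ → σ ⊙ (+ 1) ≢ + 0
    unit≢0 pos ()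
    unit≢0 neg ()

  module _ {K c} (isCox : IsCoxeterElement K c) where
    open Cycles c

    private
      reach-origin : ∀ {x} → sign x ≡ neg → Reaches x origin
      reach-origin {x} sign≡ = negative⇒origin {K} {c} isCox x (size x , trans (closes x) (cong (_· x) sign≡))

      all-positive : ∀ {x xs} → sign x ≡ neg → All (Separate x) xs → negatives (map (type c) xs) ≡ []
      all-positive sign≡ [] = refl
      all-positive {x} {y ∷ _} sign≡ (sep ∷ seps) with sign y in sign≡′
      ... | pos = all-positive sign≡ seps
      ... | neg = contradiction (reaches-trans (reach-origin sign≡) (reaches-sym (reach-origin sign≡′))) sep

    -- Two negative cycles would both contain ±1 and could not be separate.
    coxeter-negatives : ∀ {xs} → AllPairs Separate xs →
      negatives (map (type c) xs) ≡ [] ⊎ negatives (map (type c) xs) ≡ size origin ∷ []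
    coxeter-negatives {[]}     []           = inj₁ refl
    coxeter-negatives {x ∷ xs} (sep ∷ seps) with sign x in sign≡
    ... | pos = coxeter-negatives seps
    ... | neg = inj₂ (cong₂ _∷_ (size-along c (reach-origin sign≡)) (all-positive sign≡ sep))

    coxeter-negatives-cycleType : negatives (cycleType c) ≡ [] ⊎ negatives (cycleType c) ≡ size origin ∷ []
    coxeter-negatives-cycleType = coxeter-negatives (Representatives.separate (proj₂ representatives))

    nonempty-negatives : ∀ x → Negative c x → negatives (cycleType c) ≡ size origin ∷ []
    nonempty-negatives x (l , eq) with coxeter-negatives-cycleType
    ... | inj₂ h = h
    ... | inj₁ h = contradiction h (occurs (Representatives.cover (proj₂ representatives) x))
      where
      occurs : ∀ {xs} → Any (λ y → Reaches y x) xs → negatives (map (type c) xs) ≢ []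
      occurs {y ∷ xs} (here r) h
        rewrite negative-sign c y (l , return-along c (reaches-sym r) l neg eq) with () ← h
      occurs {y ∷ xs} (there r) h with sign y
      ... | pos = occurs r h

    module RegularCycles {p} (p-prime : Prime p) {w} (regular : IsPRegularPart p c w) where
      open RegularRelation (regularRelation p-prime {c} {w} regular)
      private module C′ = Cycles w

      iterate-regular : ∀ l x → C′.it l x ≡ it (l * exponent) x
      iterate-regular zero    x = refl
      iterate-regular (suc l) x = trans (is-power _) (trans (cong (it exponent) (iterate-regular l x)) (sym (it-+ exponent (l * exponent) x)))

      iterate-height : ∀ q x → it (q * p ^ height) x ≡ C′.it (q * p ^ height) x
      iterate-height zero    x = refl
      iterate-height (suc q) x = trans (it-+ (p ^ height) (q * p ^ height) x) (trans (same-power _)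
        (trans (cong (C′.it (p ^ height)) (iterate-height q x)) (sym (C′.it-+ (p ^ height) (q * p ^ height) x))))

      regular-sizes-coprime : ∀ x → Coprime (C′.size x) p
      regular-sizes-coprime x (d∣size , d∣p) =
        period-coprime (∣-trans d∣size (size-∣ w x period pos (periodic x)) , d∣p)

      regular-size∣ : C′.size origin ∣ size origin
      regular-size∣ with s , eq ← it-* exponent (size origin) (sign origin) origin (closes origin) =
        size-∣ w origin (size origin) s (trans (iterate-regular (size origin) origin)
          (trans (cong (λ l → it l origin) (*-comm (size origin) exponent)) eq))

      -- A return of w at the common power of c and w is a return of c. With `regular-size∣` and
      -- coprimality to p, the size of ±1 under w is thus the prime-to-p part of its size under c.
      size∣regular : size origin ∣ C′.size origin * p ^ height
      size∣regular with s , eq ← C′.it-* (p ^ height) (C′.size origin) (C′.sign origin) origin (C′.closes origin) =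
        size-∣ c origin (C′.size origin * p ^ height) s (trans (iterate-height (C′.size origin) origin)
          (trans (cong (λ l → C′.it l origin) (*-comm (C′.size origin) (p ^ height))) eq))

      regular-negative⇒negative : ∀ {x} → C′.sign x ≡ neg → Negative c x
      regular-negative⇒negative {x} sign≡ = C′.size x * exponent ,
        trans (sym (iterate-regular (C′.size x) x)) (trans (C′.closes x) (cong (_· x) sign≡))

      -- A cycle of c may break up into several cycles of w. Since w is a power of c, it commutes
      -- with c, which permutes these cycles transitively; hence their sizes agree.
      size-along-coxeter : ∀ {x y} → Reaches x y → C′.size x ≡ C′.size y
      size-along-coxeter {x} {y} r = ∣-antisym
        (size-∣ w x (C′.size y) (C′.sign y) (carried (reaches-sym r) (C′.size y) (C′.sign y) (C′.closes y)))
        (size-∣ w y (C′.size x) (C′.sign x) (carried r (C′.size x) (C′.sign x) (C′.closes x)))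
        where
        carried : ∀ {x y} → Reaches x y → ∀ l s → C′.it l x ≡ s · x → C′.it l y ≡ s · y
        carried {x} {y} r l s eq = trans (iterate-regular l y)
          (return-along c r (l * exponent) s (trans (sym (iterate-regular l x)) eq))

      -- If a power of c negates x, then x lies on a negative cycle of c, hence on the one through
      -- ±1.
      regular-negatives : All (_≡ C′.size origin) (negatives (cycleType w))
      regular-negatives = go (proj₁ C′.representatives)
        where
        go : ∀ xs → All (_≡ C′.size origin) (negatives (map (type w) xs))
        go []       = []
        go (x ∷ xs) with C′.sign x in sign≡
        ... | pos = go xs
        ... | neg = size-along-coxeter (negative⇒origin {K} {c} isCox x (regular-negative⇒negative sign≡)) ∷ go xs

      -- As soon as w has a negative cycle, c has one as well, and the size of ±1 under c can be
      -- read off from the cycle type of c.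
      regular-nonempty : negatives (cycleType w) ≡ [] ⊎ negatives (cycleType c) ≡ size origin ∷ []
      regular-nonempty = go (proj₁ C′.representatives)
        where
        go : ∀ xs → negatives (map (type w) xs) ≡ [] ⊎ negatives (cycleType c) ≡ size origin ∷ []
        go []       = inj₁ refl
        go (x ∷ xs) with C′.sign x in sign≡
        ... | pos = go xs
        ... | neg = inj₂ (nonempty-negatives x (regular-negative⇒negative sign≡))

positives-map : ∀ {n} (u : SignedPermutation n) {P : ℕ → Set} → (∀ x → P (Cycles.size u x)) → ∀ xs →
  All P (positives (map (FixedVectors.type n u) xs))
positives-map u h []       = []
positives-map u h (x ∷ xs) with Cycles.sign u x
... | pos = h x ∷ positives-map u h xs
... | neg = positives-map u h xs

cycleType-total : ∀ {n} (u : SignedPermutation n) → sum (positives (Conjugacy.cycleType n u)) + sum (negatives (Conjugacy.cycleType n u)) ≡ n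
cycleType-total {n} u = trans (sum-cycleType (Conjugacy.cycleType n u))
  (trans (cong sum (sym (map-∘ (proj₁ (Cycles.representatives u))))) (sum-sizes u (proj₂ (Cycles.representatives u))))

series-high : ∀ {n} (u : SignedPermutation n) t → n < t → series (positives (Conjugacy.cycleType n u)) t ≡ 0
series-high u t n<t = series-degree (positives (Conjugacy.cycleType _ u)) t
  (≤-<-trans (≤-trans (m≤m+n _ _) (≤-reflexive (cycleType-total u))) n<t)

-- Congruent columns and conjugate regular parts

module OddPrime (m : ℕ) {p} (p-prime : Prime p) where
  open B (suc m) hiding (F)
  open Action (suc m)
  open RegularPart (suc m)
  open FixedVectors (suc m)
  open Conjugacy (suc m)
  open NegativeCycles m
  open PrimeFactor p-prime

  cycleSeries : W → ℕ → ℕ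
  cycleSeries u = series (positives (cycleType u))

  -- The coefficient of degree t ≤ n is the mark for d = n - t; beyond n both products vanish, since
  -- the positive cycles have total length at most n.
  fixCount⇒series : ∀ u v → (∀ d → fixCount (cut (suc m) d) u ≡ fixCount (cut (suc m) d) v [mod p ]) →
    ∀ t → cycleSeries u t ≡ cycleSeries v t [mod p ]
  fixCount⇒series u v h t with t ≤? suc m
  ... | no t≰n = mod-reflexive (trans (series-high u t (≰⇒> t≰n)) (sym (series-high v t (≰⇒> t≰n))))
  ... | yes t≤n = mod-trans (mod-reflexive (sym (coefficient u))) (mod-trans (h (suc m ∸ t)) (mod-reflexive (coefficient v)))
    where
    coefficient : ∀ u → fixCount (cut (suc m) (suc m ∸ t)) u ≡ cycleSeries u t
    coefficient u = trans (fixCount≡series u (proj₂ (Cycles.representatives u)) (suc m ∸ t) (m∸n≤m (suc m) t))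
      (cong (cycleSeries u) (m∸[m∸n]≡n t≤n))

  0<sizes : ∀ u → All (0 <_) (positives (cycleType u))
  0<sizes u = positives-map u (λ x → z<s) (proj₁ (Cycles.representatives u))

  negative-sum : ∀ u v → sum (positives (cycleType u)) ≡ sum (positives (cycleType v)) →
    sum (negatives (cycleType u)) ≡ sum (negatives (cycleType v))
  negative-sum u v eq = +-cancelˡ-≡ (sum (positives (cycleType u))) _ _
    (trans (cycleType-total u) (trans (sym (cycleType-total v)) (cong (_+ sum (negatives (cycleType v))) (sym eq))))

  module _ (p≢2 : p ≢ 2) {K L c e c′ e′} (coxK : IsCoxeterElement K c) (coxL : IsCoxeterElement L e)
    (regC : IsPRegularPart p c c′) (regE : IsPRegularPart p e e′)
    (h : ∀ d → fixCount (cut (suc m) d) c ≡ fixCount (cut (suc m) d) e [mod p ]) where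
    private
      module C = RegularCycles {K} {c} coxK p-prime {c′} regC
      module E = RegularCycles {L} {e} coxL p-prime {e′} regE

      h′ : ∀ d → fixCount (cut (suc m) d) c′ ≡ fixCount (cut (suc m) d) e′ [mod p ]
      h′ d = mod-trans (fixCount-regular p-prime (cut (suc m) d) {c} {c′} regC)
        (mod-trans (h d) (mod-sym (fixCount-regular p-prime (cut (suc m) d) {e} {e′} regE)))

      primeTo : ∀ w → (∀ x → Coprime (Cycles.size w x) p) → All (λ i → 0 < i × Coprime i p) (positives (cycleType w))
      primeTo w coprime = positives-map w {λ i → 0 < i × Coprime i p} (λ x → z<s , coprime x) (proj₁ (Cycles.representatives w))

      positives↭ : positives (cycleType c′) ↭ positives (cycleType e′)
      positives↭ = series⇒↭ p≢2 (positives (cycleType c′)) (positives (cycleType e′))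
        (primeTo c′ C.regular-sizes-coprime) (primeTo e′ E.regular-sizes-coprime) (fixCount⇒series c′ e′ h′)

      -- The positive cycles of c and e need not have the same lengths, only the same lengths up to
      -- merging; the weight `id` still gives equal totals, and the complements in n agree.
      coxeter-sum : sum (negatives (cycleType c)) ≡ sum (negatives (cycleType e))
      coxeter-sum = negative-sum c e (trans (cong sum (sym (map-id (positives (cycleType c))))) (trans
        (series⇒sum p-prime p≢2 id (λ _ _ → refl) (positives (cycleType c)) (positives (cycleType e))
          (0<sizes c) (0<sizes e) (fixCount⇒series c e h))
        (cong sum (map-id (positives (cycleType e))))))

      regular-sum : sum (negatives (cycleType c′)) ≡ sum (negatives (cycleType e′))
      regular-sum = negative-sum c′ e′ (sum-↭ positives↭)

      divide : ∀ {s s′ l l′} k → Coprime s p → s ∣ l → l ≡ l′ → l′ ∣ s′ * p ^ k → s ∣ s′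
      divide {s} {s′} k s⊥p s∣l refl l∣ = coprime-divisor (coprime-^ s⊥p k)
        (subst (s ∣_) (*-comm s′ (p ^ k)) (∣-trans s∣l l∣))

      sameSize : negatives (cycleType c) ≡ Cycles.size c origin ∷ [] → negatives (cycleType e) ≡ Cycles.size e origin ∷ [] →
        Cycles.size c′ origin ≡ Cycles.size e′ origin
      sameSize negC negE = ∣-antisym
        (divide (RegularRelation.height (regularRelation p-prime {e} {e′} regE)) (C.regular-sizes-coprime origin) C.regular-size∣ size≡ E.size∣regular)
        (divide (RegularRelation.height (regularRelation p-prime {c} {c′} regC)) (E.regular-sizes-coprime origin) E.regular-size∣ (sym size≡) C.size∣regular)
        where
        size≡ : Cycles.size c origin ≡ Cycles.size e origin
        size≡ = +-cancelʳ-≡ 0 (Cycles.size c origin) (Cycles.size e origin)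
          (trans (cong sum (sym negC)) (trans coxeter-sum (cong sum negE)))

      empty : ∀ {k A} → All (_≡ suc k) A → sum A ≡ 0 → A ≡ []
      empty []         _ = refl
      empty (refl ∷ _) ()

      -- Each list repeats a single positive length and the totals agree, so an empty list forces
      -- the other to be empty. If neither regular part is known to lack negative cycles, c and e
      -- have them, and the equal sizes of ±1 under c and e give the equal lengths.
      negatives≡ : negatives (cycleType c′) ≡ negatives (cycleType e′)
      negatives≡ = cases C.regular-nonempty E.regular-nonempty
        where
        cases : negatives (cycleType c′) ≡ [] ⊎ negatives (cycleType c) ≡ Cycles.size c origin ∷ [] →
          negatives (cycleType e′) ≡ [] ⊎ negatives (cycleType e) ≡ Cycles.size e origin ∷ [] →
          negatives (cycleType c′) ≡ negatives (cycleType e′)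
        cases (inj₁ none) _           = trans none (sym (empty E.regular-negatives (trans (sym regular-sum) (cong sum none))))
        cases (inj₂ _)    (inj₁ none) = trans (empty C.regular-negatives (trans regular-sum (cong sum none))) (sym none)
        cases (inj₂ negC) (inj₂ negE) = constant-lists (Cycles.pred-size c′ origin)
          (negatives (cycleType c′)) (negatives (cycleType e′)) C.regular-negatives
          (subst (λ k → All (_≡ k) (negatives (cycleType e′))) (sym (sameSize negC negE)) E.regular-negatives)
          regular-sum

    regularParts-conjugate : Conjugate c′ e′
    regularParts-conjugate = sameType⇒conjugate c′ e′
      (↭-trans (cycleType-split (cycleType c′)) (↭-trans
        (↭.++⁺ (↭.map⁺ (_, pos) positives↭) (↭.↭-reflexive (cong (map (_, neg)) negatives≡)))
        (↭-sym (cycleType-split (cycleType e′)))))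

  congruent⇒conjugate : p ≢ 2 → ∀ {K L c e} → IsCoxeterElement K c → IsCoxeterElement L e →
    (∀ d → fixCount (cut (suc m) d) c ≡ fixCount (cut (suc m) d) e [mod p ]) → ConjugatePRegularParts p c e
  congruent⇒conjugate p≢2 {K} {L} {c} {e} coxK coxL h = byParts (regularPart p-prime c) (regularPart p-prime e)
    where
    byParts : ∃ (IsPRegularPart p c) → ∃ (IsPRegularPart p e) → ConjugatePRegularParts p c e
    byParts (c′ , regC) (e′ , regE) = c′ , e′ , regC , regE ,
      regularParts-conjugate p≢2 {K} {L} {c} {e} {c′} {e′} coxK coxL regC regE h

  d≡1⇔congruent : ∀ E K L → (d p E K L ≡ 1) ⇔ ColumnsCongruent p E K L
  d≡1⇔congruent E K L = reflects (columnsCongruent? p E K L)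
    where
    reflects : ∀ {P : Set} (P? : Dec P) → ((if does P? then 1 else 0) ≡ 1) ⇔ P
    reflects (yes h) = mk⇔ (λ _ → h) (λ _ → refl)
    reflects (no ¬h) = mk⇔ (λ ()) (λ h → contradiction h ¬h)

  columns⇒fixCounts : ∀ {E} → IsRepresentatives E → ∀ {K L c e} → IsCoxeterElement K c → IsCoxeterElement L e →
    ColumnsCongruent p E K L → ∀ J → fixCount J c ≡ fixCount J e [mod p ]
  columns⇒fixCounts {E} isReps {K} {L} {c} {e} coxK coxL columns J = by (IsRepresentatives.representative isReps J)
    where
    same : ∀ {Ĵ} → ConjugateSubsets J Ĵ → ∀ K c → IsCoxeterElement K c → fixCount J c ≡ β Ĵ K
    same {Ĵ} conj K c isCox = trans (fixCount-conjugateSubsets conj c) (sym (β≡fixCount Ĵ {K} {c} isCox))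
    by : (∃ λ Ĵ → Ĵ ∈ E × ConjugateSubsets J Ĵ) → fixCount J c ≡ fixCount J e [mod p ]
    by (Ĵ , Ĵ∈E , conj) = mod-trans (mod-reflexive (same conj K c coxK))
      (mod-trans (∣∣-∣⇒mod (β Ĵ K) (β Ĵ L) (All.lookup columns Ĵ∈E)) (mod-reflexive (sym (same conj L e coxL))))

  conjugate⇒columns : ∀ {E K L c e} → IsCoxeterElement K c → IsCoxeterElement L e →
    ConjugatePRegularParts p c e → ColumnsCongruent p E K L
  conjugate⇒columns {E} {K} {L} {c} {e} coxK coxL (c′ , e′ , regC , regE , conj) = All.universal (λ J → mod⇒∣∣-∣ (β J K) (β J L)
    (mod-trans (mod-reflexive (β≡fixCount J {K} {c} coxK)) (mod-trans (mod-sym (fixCount-regular p-prime J regC))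
      (mod-trans (mod-reflexive (fixCount-conjugate J {c′} {e′} conj)) (mod-trans (fixCount-regular p-prime J regE)
        (mod-reflexive (sym (β≡fixCount J {L} {e} coxL)))))))) E

-- The prime 2

module Two (n : ℕ) where
  open B n
  open Action n

  minusOne : W
  minusOne = record { perm = mk↔ₛ′ negate negate (·-cancel {n} neg) (·-cancel {n} neg) ; commutes = λ _ → refl }

  -- A vector that is both odd and even is zero, whereas an index outside J gives a strict step of
  -- the weight.
  weight-even⇒⊤ : (J : Subset n) → (∀ z → weight J (negate z) ≡ weight J z) → J ≡ ⊤
  weight-even⇒⊤ J even = ⊆-antisym ⊆⊤ (λ {i} _ → inJ i (i ∈? J))
    where
    zero-weight : ∀ z → weight J z ≡ + 0
    zero-weight z = a≡-a⇒a≡0 (weight J z) (trans (sym (even z)) (weight-odd J z))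
    inJ : ∀ i → Dec (i Subset.∈ J) → i Subset.∈ J
    inJ i (yes i∈J) = i∈J
    inJ i (no i∉J)  = contradiction (weight-∉ J i i∉J) (ℤ.<-irrefl (trans (zero-weight (reflected i)) (sym (zero-weight (pos , i)))))

  -- Right multiplication by −1 is a free involution of W/W_J for J ≠ S.
  β-even : ∀ {J} → J ≢ ⊤ → ∀ K → 2 ∣ β J K
  β-even {J} J≢⊤ K = mod-0⇒∣ (fixedPoints-mod (FixedPoints J K) (proj₂ (fixedPoints-finite J K)) prime[2] 1 act
    (λ { {x , _} {y , _} → right {x} {y} }) (λ { (x , _) → ≈⇒coset J {x ∙ minusOne ∙ minusOne} {x} (λ z → cong (to x) (·-cancel neg z)) })
    {0} nobody)
    where
    right : ∀ {x y} → x ~[ J ] y → x ∙ minusOne ~[ J ] y ∙ minusOne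
    -- Since -1 is central, multiplying both representatives by it does not change x⁻¹y.
    right {x} {y} = resp {x = x ⁻¹ ∙ y} {y = (x ∙ minusOne) ⁻¹ ∙ (y ∙ minusOne)}
      (λ z → sym (trans (cong negate (commutes (x ⁻¹ ∙ y) z)) (·-cancel neg (from x (to y z)))))
    act : Σ W (IsFixed J K) → Σ W (IsFixed J K)
    act (x , h) = x ∙ minusOne , λ u u∈K → right {u ∙ x} {x} (h u u∈K)
    free : ∀ x → ¬ (x ∙ minusOne ~[ J ] x)
    free x h = J≢⊤ (weight-even⇒⊤ J even)
      where
      even : ∀ z → weight J (negate z) ≡ weight J z
      even z = begin
        weight J (negate z)                  ≡⟨ cong (weight J ∘ negate) (strictlyInverseʳ x z) ⟨
        weight J (negate (from x (to x z)))  ≡⟨ coset⇒vector J (x ∙ minusOne) x h (to x z) ⟩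
        weight J (from x (to x z))           ≡⟨ cong (weight J) (strictlyInverseʳ x z) ⟩
        weight J z                           ∎
        where open ≡-Reasoning
    nobody : HasCardinality (Subsetoid (FixedPoints J K) (λ x → Setoid._≈_ (FixedPoints J K) (act x) x)) 0
    nobody = record
      { to = λ ((x , _) , h) → contradiction h (free x) ; from = λ ()
      ; to-cong = λ { {(x , _) , h} → contradiction h (free x) } ; from-cong = λ { {()} }
      ; inverse = (λ { {()} }) , (λ { {(x , _) , h} → contradiction h (free x) }) }

  weight-⊤ : ∀ {n} (z : Point n) → weight ⊤ z ≡ + 0
  weight-⊤ (pos , i) = cong +_ (level-⊤ i)
  weight-⊤ (neg , i) = cong (λ l → ℤ.- (+ l)) (level-⊤ i)

  all⊤ : ∀ x → ⟨ ⊤ ⟩ x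
  all⊤ x = stabilizes⇒parabolic ⊤ x (λ z → trans (weight-⊤ {n} (to x z)) (sym (weight-⊤ {n} z)))

  β-⊤ : ∀ K → β ⊤ K ≡ 1
  β-⊤ K = cardinality-unique (proj₂ (fixedPoints-finite ⊤ K)) point (Identity.inverse (FixedPoints ⊤ K))
    where
    point : HasCardinality (FixedPoints ⊤ K) 1
    point = record
      { to = λ _ → zero ; from = λ _ → ε , λ u _ → all⊤ ((u ∙ ε) ⁻¹ ∙ ε)
      ; to-cong = λ _ → refl ; from-cong = λ { refl → all⊤ (ε ⁻¹ ∙ ε) }
      ; inverse = (λ { {zero} _ → refl }) , (λ { {x , _} _ → all⊤ (ε ⁻¹ ∙ x) }) }

  -- Conjugation carries W into W_K and fixes the central element -1, which therefore stabilizes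
  -- `weight K`.
  conjugate-⊤ : ∀ {K} → ConjugateSubsets ⊤ K → K ≡ ⊤
  conjugate-⊤ {K} (w , f , _) = weight-even⇒⊤ K even
    where
    even : ∀ z → weight K (negate z) ≡ weight K z
    even z = begin
      weight K (negate z)                  ≡⟨ cong (weight K ∘ negate) (strictlyInverseˡ w z) ⟨
      weight K (negate (to w (from w z)))  ≡⟨ cong (weight K) (commutes w (from w z)) ⟨
      weight K (to w (negate (from w z)))  ≡⟨ parabolic⇒stabilizes K (conjugate-generated {w = w} f (all⊤ minusOne)) z ⟩
      weight K z                           ∎
      where open ≡-Reasoning

  ⊤∈ : ∀ {E} → IsRepresentatives E → ⊤ ∈ E
  ⊤∈ isReps with K , K∈E , conj ← IsRepresentatives.representative isReps ⊤ = subst (_∈ _) (conjugate-⊤ conj) K∈E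

  -- The row of S consists of ones, and every other row is even. That S belongs to E follows because
  -- only S itself is conjugate to S.
  F⇔⊤ : ∀ {E} → IsRepresentatives E → ∀ J → F 2 E J ⇔ (J ≡ ⊤)
  F⇔⊤ {E} isReps J = mk⇔ forward backward
    where
    forward : F 2 E J → J ≡ ⊤
    forward (_ , odd) = decidable-stable (Vec.≡-dec Bool._≟_ J ⊤)
      (λ J≢⊤ → let K , _ , 2∤β = List.find odd in 2∤β (β-even J≢⊤ K))
    backward : J ≡ ⊤ → F 2 E J
    backward refl = ⊤∈ isReps , List.lose (⊤∈ isReps) (λ 2∣β → contradiction (∣⇒≤ (subst (2 ∣_) (β-⊤ ⊤) 2∣β)) λ { (s≤s ()) })

  columns-⊤ : ∀ E K → ColumnsCongruent 2 E K ⊤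
  columns-⊤ E K = All.universal congruent E
    where
    cases : ∀ J → Dec (J ≡ ⊤) → β J K ≡ β J ⊤ [mod 2 ]
    cases J (yes refl) = mod-reflexive (trans (β-⊤ K) (sym (β-⊤ ⊤)))
    cases J (no J≢⊤)   = mod-trans (∣⇒mod-0 (β-even J≢⊤ K)) (mod-sym (∣⇒mod-0 (β-even J≢⊤ ⊤)))
    congruent : ∀ J → 2 ∣ ∣ β J K - β J ⊤ ∣
    congruent J = mod⇒∣∣-∣ (β J K) (β J ⊤) (cases J (Vec.≡-dec Bool._≟_ J ⊤))

theorem7 : (n : ℕ) → n ≥ 1 → let open B n in
    (p : ℕ) → Prime p →
    (E : List (Subset n)) → IsRepresentatives E →
    (p ≢ 2 → ∀ K L → K ∈ E → F p E L →
    ∀ cK cL → IsCoxeterElement K cK → IsCoxeterElement L cL →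
    (d p E K L ≡ 1) ⇔ ConjugatePRegularParts p cK cL)
    × (p ≡ 2 →
    (∀ J → F p E J ⇔ (J ≡ ⊤)) × (∀ K → K ∈ E → d p E K ⊤ ≡ 1))
-- Writing n as `suc m` supplies the point ±1, through which the negative cycle passes.
theorem7 (suc m) _ p p-prime E isReps = odd , even
  where
  open B (suc m)
  open OddPrime m p-prime
  odd : p ≢ 2 → ∀ K L → K ∈ E → F p E L → ∀ cK cL → IsCoxeterElement K cK → IsCoxeterElement L cL →
    (d p E K L ≡ 1) ⇔ ConjugatePRegularParts p cK cL
  odd p≢2 K L _ _ cK cL coxK coxL = mk⇔
    (λ d≡1 → congruent⇒conjugate p≢2 {K} {L} {cK} {cL} coxK coxL
      (λ k → columns⇒fixCounts isReps {K} {L} {cK} {cL} coxK coxL (Equivalence.to (d≡1⇔congruent E K L) d≡1) (cut (suc m) k)))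
    (λ conj → Equivalence.from (d≡1⇔congruent E K L) (conjugate⇒columns {E} {K} {L} {cK} {cL} coxK coxL conj))
  even : p ≡ 2 → (∀ J → F p E J ⇔ (J ≡ ⊤)) × (∀ K → K ∈ E → d p E K ⊤ ≡ 1)
  even refl = Two.F⇔⊤ (suc m) isReps
    , λ K _ → Equivalence.from (d≡1⇔congruent E K ⊤) (Two.columns-⊤ (suc m) E K)
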